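{- Let $\mathcal D$ be a finite set with $T=|\mathcal D|\ge 1$, let $\mathcal Q$ be a nonempty finite family of functions with $k=|\mathcal Q|\ge 1$, let $n\ge 1$ be an integer, and suppose every $q\in\mathcal Q$ maps $\mathcal D$ to $[-1,1]$. For every real $\varepsilon>0$ there exists a randomized mechanism $M$, with inputs $x\in\mathcal D^n$ and output in $\mathbb R^{\mathcal Q}$, that is pure $\varepsilon$-differentially private and satisfies $$\sup_{x\in\mathcal D^n}\mathbb E\,\|M(x)-F(x)\|_\infty\le 129e\,\min\left\{1,\sqrt{\frac{\log(2T)\log(2k)}{\varepsilon n}}\right\}.$$
   Context: For $x=(x_1,\dots,x_n)\in\mathcal D^n$ and $q\in\mathcal Q$, put $F_q(x)=\frac1n\sum_{i=1}^n q(x_i)$ and $F(x)=(F_q(x))_{q\in\mathcal Q}\in\mathbb R^{\mathcal Q}$. Here $\|z\|_\infty=\max_{q\in\mathcal Q}|z_q|$, $\log$ is the natural logarithm, and $e$ is Euler's number. All probability spaces are finite: a randomized mechanism assigns to each $x\in\mathcal D^n$ a random output $M(x)$ whose law has finite support. Two databases $x,x'\in\mathcal D^n$ are neighboring if they differ in exactly one coordinate (Hamming distance one). The mechanism $M$ is pure $\varepsilon$-differentially private if for all neighboring $x,x'$ and every subset $E$ of its output space, $\mathbb P[M(x)\in E]\le e^{\varepsilon}\,\mathbb P[M(x')\in E]$. -}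

module Defs where

open import Axiom.ExcludedMiddle using (ExcludedMiddle)
open import Data.Bool.Base using (if_then_else_)
open import Data.Fin.Base using (Fin; toℕ)
open import Data.Nat.Base as ℕ using (ℕ; zero; suc; _!)
import Data.Nat.Properties as ℕₚ
open import Data.Integer.Base using (+_)
open import Data.Product.Base using (∃; _×_; _,_; proj₁; proj₂)
open import Data.Rational.Base as ℚ using (ℚ; 0ℚ; 1ℚ; ½)
import Data.Rational.Properties as ℚₚ
import Data.Rational.Solver as ℚSolver
open import Data.Sum.Base using (inj₁; inj₂)
open import Data.Vec.Base using (Vec; lookup)
import Data.Vec.Functional as Vector
open import Level using (0ℓ)
open import Relation.Binary.PropositionalEquality
  using (_≡_; _≢_; refl; sym; trans; cong; cong₂; subst)
open import Relation.Nullary.Decidable.Core using (does; yes; no)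

private
  module Rational where
    open ℚₚ.≤-Reasoning
    open ℚSolver.+-*-Solver

    halves : ∀ ε → ½ ℚ.* ε ℚ.+ ½ ℚ.* ε ≡ ε
    halves ε = trans (sym (ℚₚ.*-distribʳ-+ ε ½ ½)) (ℚₚ.*-identityˡ ε)

    pos-* : ∀ {p q} → 0ℚ ℚ.< p → 0ℚ ℚ.< q → 0ℚ ℚ.< p ℚ.* q
    pos-* {p} {q} 0<p 0<q = ℚₚ.positive⁻¹ (p ℚ.* q)
      where instance _ = ℚₚ.pos*pos⇒pos p {{ℚ.positive 0<p}} q {{ℚ.positive 0<q}}

    pos-½ : ∀ {ε} → 0ℚ ℚ.< ε → 0ℚ ℚ.< ½ ℚ.* ε
    pos-½ = pos-* (ℚₚ.positive⁻¹ ½)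

    p≤∣p∣ : ∀ p → p ℚ.≤ ℚ.∣ p ∣
    p≤∣p∣ p with ℚₚ.≤-total 0ℚ p
    ... | inj₁ 0≤p = ℚₚ.≤-reflexive (sym (ℚₚ.0≤p⇒∣p∣≡p 0≤p))
    ... | inj₂ p≤0 = ℚₚ.≤-trans p≤0 (ℚₚ.0≤∣p∣ p)

    flip-- : ∀ p q → ℚ.∣ p ℚ.- q ∣ ≡ ℚ.∣ q ℚ.- p ∣
    flip-- p q = trans (sym (ℚₚ.∣-p∣≡∣p∣ (p ℚ.- q)))
      (cong ℚ.∣_∣ (solve 2 (λ p q → :- (p :- q) := q :- p) refl p q))

    close⇒≤ : ∀ {p q ε} → ℚ.∣ p ℚ.- q ∣ ℚ.≤ ε → p ℚ.≤ q ℚ.+ ε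
    close⇒≤ {p} {q} {ε} h = begin
      p                      ≡⟨ solve 2 (λ p q → p := q :+ (p :- q)) refl p q ⟩
      q ℚ.+ (p ℚ.- q)        ≤⟨ ℚₚ.+-monoʳ-≤ q (ℚₚ.≤-trans (p≤∣p∣ (p ℚ.- q)) h) ⟩
      q ℚ.+ ε                ∎

    ≤⇒-≤ : ∀ {p q ε} → p ℚ.≤ q ℚ.+ ε → p ℚ.- q ℚ.≤ ε
    ≤⇒-≤ {p} {q} {ε} h = begin
      p ℚ.- q                ≤⟨ ℚₚ.+-monoˡ-≤ (ℚ.- q) h ⟩
      q ℚ.+ ε ℚ.- q          ≡⟨ solve 2 (λ q ε → q :+ ε :- q := ε) refl q ε ⟩
      ε                      ∎

    ≤⇒close : ∀ {p q ε} → p ℚ.≤ q ℚ.+ ε → q ℚ.≤ p ℚ.+ ε → ℚ.∣ p ℚ.- q ∣ ℚ.≤ ε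
    ≤⇒close {p} {q} {ε} h k with ℚₚ.∣p∣≡p∨∣p∣≡-p (p ℚ.- q)
    ... | inj₁ e = subst (ℚ._≤ ε) (sym e) (≤⇒-≤ {p} {q} h)
    ... | inj₂ e = subst (ℚ._≤ ε)
      (sym (trans e (solve 2 (λ p q → :- (p :- q) := q :- p) refl p q))) (≤⇒-≤ {q} {p} k)

    close-+ : ∀ {p q r s δ ε} → ℚ.∣ p ℚ.- q ∣ ℚ.≤ δ → ℚ.∣ r ℚ.- s ∣ ℚ.≤ ε →
              ℚ.∣ (p ℚ.+ r) ℚ.- (q ℚ.+ s) ∣ ℚ.≤ δ ℚ.+ ε
    close-+ {p} {q} {r} {s} {δ} {ε} h k = begin
      ℚ.∣ (p ℚ.+ r) ℚ.- (q ℚ.+ s) ∣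
        ≡⟨ cong ℚ.∣_∣ (solve 4 (λ p q r s → (p :+ r) :- (q :+ s) := (p :- q) :+ (r :- s))
             refl p q r s) ⟩
      ℚ.∣ (p ℚ.- q) ℚ.+ (r ℚ.- s) ∣
        ≤⟨ ℚₚ.∣p+q∣≤∣p∣+∣q∣ (p ℚ.- q) (r ℚ.- s) ⟩
      ℚ.∣ p ℚ.- q ∣ ℚ.+ ℚ.∣ r ℚ.- s ∣
        ≤⟨ ℚₚ.+-mono-≤ h k ⟩
      δ ℚ.+ ε ∎

    close-⊔ : ∀ {p q r s ε} → ℚ.∣ p ℚ.- q ∣ ℚ.≤ ε → ℚ.∣ r ℚ.- s ∣ ℚ.≤ ε →
              ℚ.∣ (p ℚ.⊔ r) ℚ.- (q ℚ.⊔ s) ∣ ℚ.≤ ε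
    close-⊔ {p} {q} {r} {s} {ε} h k =
      ≤⇒close (bound p q r s h k) (bound q p s r (flipped p q h) (flipped r s k))
      where
      flipped : ∀ p q → ℚ.∣ p ℚ.- q ∣ ℚ.≤ ε → ℚ.∣ q ℚ.- p ∣ ℚ.≤ ε
      flipped p q = subst (ℚ._≤ ε) (flip-- p q)
      bound : ∀ p q r s → ℚ.∣ p ℚ.- q ∣ ℚ.≤ ε → ℚ.∣ r ℚ.- s ∣ ℚ.≤ ε →
              p ℚ.⊔ r ℚ.≤ (q ℚ.⊔ s) ℚ.+ ε
      bound p q r s h k = ℚₚ.⊔-lub
        (ℚₚ.≤-trans (close⇒≤ {p} {q} h) (ℚₚ.+-monoˡ-≤ ε (ℚₚ.p≤p⊔q q s)))
        (ℚₚ.≤-trans (close⇒≤ {r} {s} k) (ℚₚ.+-monoˡ-≤ ε (ℚₚ.p≤q⊔p q s)))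

    close-neg : ∀ {p q ε} → ℚ.∣ p ℚ.- q ∣ ℚ.≤ ε → ℚ.∣ (ℚ.- p) ℚ.- (ℚ.- q) ∣ ℚ.≤ ε
    close-neg {p} {q} {ε} = subst (ℚ._≤ ε) (trans (flip-- p q)
      (cong ℚ.∣_∣ (solve 2 (λ p q → q :- p := :- p :- (:- q)) refl p q)))

    *-mono-≤ : ∀ {p q r s} → 0ℚ ℚ.≤ r → 0ℚ ℚ.≤ q → p ℚ.≤ q → r ℚ.≤ s →
               p ℚ.* r ℚ.≤ q ℚ.* s
    *-mono-≤ {p} {q} {r} {s} 0≤r 0≤q h k = begin
      p ℚ.* r  ≤⟨ ℚₚ.*-monoʳ-≤-nonNeg r {{ℚ.nonNegative 0≤r}} h ⟩
      q ℚ.* r  ≤⟨ ℚₚ.*-monoˡ-≤-nonNeg q {{ℚ.nonNegative 0≤q}} k ⟩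
      q ℚ.* s  ∎

    *-distribˡ-- : ∀ p q r → p ℚ.* (q ℚ.- r) ≡ p ℚ.* q ℚ.- p ℚ.* r
    *-distribˡ-- p q r = trans (ℚₚ.*-distribˡ-+ p q (ℚ.- r))
      (cong (p ℚ.* q ℚ.+_) (sym (ℚₚ.neg-distribʳ-* p r)))

    telescope : ∀ a b c → a ℚ.- c ≡ (a ℚ.- b) ℚ.+ (b ℚ.- c)
    telescope = solve 3 (λ a b c → a :- c := (a :- b) :+ (b :- c)) refl

    *-diff : ∀ p q r s → p ℚ.* r ℚ.- q ℚ.* s ≡ p ℚ.* (r ℚ.- s) ℚ.+ s ℚ.* (p ℚ.- q)
    *-diff p q r s = trans (telescope (p ℚ.* r) (p ℚ.* s) (q ℚ.* s))
      (sym (cong₂ ℚ._+_ (*-distribˡ-- p r s)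
        (trans (*-distribˡ-- s p q) (cong₂ ℚ._-_ (ℚₚ.*-comm s p) (ℚₚ.*-comm s q)))))

    close-* : ∀ {p q r s δ K L} → 0ℚ ℚ.≤ K → 0ℚ ℚ.≤ L →
              ℚ.∣ p ∣ ℚ.≤ K → ℚ.∣ s ∣ ℚ.≤ L →
              ℚ.∣ p ℚ.- q ∣ ℚ.≤ δ → ℚ.∣ r ℚ.- s ∣ ℚ.≤ δ →
              ℚ.∣ p ℚ.* r ℚ.- q ℚ.* s ∣ ℚ.≤ (K ℚ.+ L) ℚ.* δ
    close-* {p} {q} {r} {s} {δ} {K} {L} 0≤K 0≤L p≤K s≤L h k = begin
      ℚ.∣ p ℚ.* r ℚ.- q ℚ.* s ∣
        ≡⟨ cong ℚ.∣_∣ (*-diff p q r s) ⟩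
      ℚ.∣ p ℚ.* (r ℚ.- s) ℚ.+ s ℚ.* (p ℚ.- q) ∣
        ≤⟨ ℚₚ.∣p+q∣≤∣p∣+∣q∣ (p ℚ.* (r ℚ.- s)) (s ℚ.* (p ℚ.- q)) ⟩
      ℚ.∣ p ℚ.* (r ℚ.- s) ∣ ℚ.+ ℚ.∣ s ℚ.* (p ℚ.- q) ∣
        ≡⟨ cong₂ ℚ._+_ (ℚₚ.∣p*q∣≡∣p∣*∣q∣ p (r ℚ.- s)) (ℚₚ.∣p*q∣≡∣p∣*∣q∣ s (p ℚ.- q)) ⟩
      ℚ.∣ p ∣ ℚ.* ℚ.∣ r ℚ.- s ∣ ℚ.+ ℚ.∣ s ∣ ℚ.* ℚ.∣ p ℚ.- q ∣
        ≤⟨ ℚₚ.+-mono-≤ (*-mono-≤ (ℚₚ.0≤∣p∣ (r ℚ.- s)) 0≤K p≤K k)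
                       (*-mono-≤ (ℚₚ.0≤∣p∣ (p ℚ.- q)) 0≤L s≤L h) ⟩
      K ℚ.* δ ℚ.+ L ℚ.* δ
        ≡⟨ sym (ℚₚ.*-distribʳ-+ δ K L) ⟩
      (K ℚ.+ L) ℚ.* δ ∎

    divide : ∀ {C ε} → 0ℚ ℚ.< C → 0ℚ ℚ.< ε → ∃ λ δ → (0ℚ ℚ.< δ) × (C ℚ.* δ ≡ ε)
    divide {C} {ε} 0<C 0<ε = C⁻¹ ℚ.* ε
      , pos-* (ℚₚ.positive⁻¹ C⁻¹ {{ℚₚ.1/pos⇒pos C}}) 0<ε
      , trans (sym (ℚₚ.*-assoc C C⁻¹ ε))
          (trans (cong (ℚ._* ε) (ℚₚ.*-inverseʳ C)) (ℚₚ.*-identityˡ ε))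
      where
      instance
        C-pos : ℚ.Positive C
        C-pos = ℚ.positive 0<C
        C-nonZero : ℚ.NonZero C
        C-nonZero = ℚₚ.pos⇒nonZero C
      C⁻¹ : ℚ
      C⁻¹ = ℚ.1/ C

    self-close : ∀ {ε} p → 0ℚ ℚ.< ε → ℚ.∣ p ℚ.- p ∣ ℚ.≤ ε
    self-close {ε} p 0<ε =
      subst (λ d → ℚ.∣ d ∣ ℚ.≤ ε) (sym (ℚₚ.+-inverseʳ p)) (ℚₚ.<⇒≤ 0<ε)

IsCauchy : (ℕ → ℚ) → Set
IsCauchy a = ∀ {ε} → 0ℚ ℚ.< ε →
  ∃ λ N → ∀ m n → N ℕ.≤ m → N ℕ.≤ n → ℚ.∣ a m ℚ.- a n ∣ ℚ.≤ ε

private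
  module Cauchy where
    open Rational

    -- Opaque: unfolding these proofs makes conversion checking explode.
    abstract
      joint : ∀ {M N m} → M ℕ.⊔ N ℕ.≤ m → (M ℕ.≤ m) × (N ℕ.≤ m)
      joint {M} {N} h = ℕₚ.m⊔n≤o⇒m≤o M N h , ℕₚ.m⊔n≤o⇒n≤o M N h

      const-cauchy : ∀ p → IsCauchy (λ _ → p)
      const-cauchy p 0<ε = 0 , λ _ _ _ _ → self-close p 0<ε

      +-cauchy : ∀ {a b} → IsCauchy a → IsCauchy b → IsCauchy (λ n → a n ℚ.+ b n)
      +-cauchy {a} {b} ca cb {ε} 0<ε with ca (pos-½ 0<ε) | cb (pos-½ 0<ε)
      ... | M , ha | N , hb = M ℕ.⊔ N , λ m n hm hn →
        let (m₁ , m₂) = joint hm ; (n₁ , n₂) = joint hn in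
        subst (ℚ.∣ (a m ℚ.+ b m) ℚ.- (a n ℚ.+ b n) ∣ ℚ.≤_) (halves ε)
          (close-+ {a m} {a n} {b m} {b n} (ha m n m₁ n₁) (hb m n m₂ n₂))

      neg-cauchy : ∀ {a} → IsCauchy a → IsCauchy (λ n → ℚ.- a n)
      neg-cauchy {a} ca 0<ε with ca 0<ε
      ... | N , h = N , λ m n hm hn → close-neg {a m} {a n} (h m n hm hn)

      ⊔-cauchy : ∀ {a b} → IsCauchy a → IsCauchy b → IsCauchy (λ n → a n ℚ.⊔ b n)
      ⊔-cauchy {a} {b} ca cb 0<ε with ca 0<ε | cb 0<ε
      ... | M , ha | N , hb = M ℕ.⊔ N , λ m n hm hn →
        let (m₁ , m₂) = joint hm ; (n₁ , n₂) = joint hn in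
        close-⊔ {a m} {a n} {b m} {b n} (ha m n m₁ n₁) (hb m n m₂ n₂)

      bounded : ∀ {a} → IsCauchy a →
        ∃ λ K → (0ℚ ℚ.< K) × ∃ λ N → ∀ m → N ℕ.≤ m → ℚ.∣ a m ∣ ℚ.≤ K
      bounded {a} ca with ca (ℚₚ.positive⁻¹ 1ℚ)
      ... | N , h = ℚ.∣ a N ∣ ℚ.+ 1ℚ
                  , ℚₚ.+-mono-≤-< (ℚₚ.0≤∣p∣ (a N)) (ℚₚ.positive⁻¹ 1ℚ)
                  , N , λ m hm → begin
        ℚ.∣ a m ∣                          ≡⟨ cong ℚ.∣_∣ (solve 2 (λ p q → p := q :+ (p :- q)) refl (a m) (a N)) ⟩
        ℚ.∣ a N ℚ.+ (a m ℚ.- a N) ∣        ≤⟨ ℚₚ.∣p+q∣≤∣p∣+∣q∣ (a N) (a m ℚ.- a N) ⟩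
        ℚ.∣ a N ∣ ℚ.+ ℚ.∣ a m ℚ.- a N ∣    ≤⟨ ℚₚ.+-monoʳ-≤ ℚ.∣ a N ∣ (h m N hm ℕₚ.≤-refl) ⟩
        ℚ.∣ a N ∣ ℚ.+ 1ℚ                   ∎
        where open ℚₚ.≤-Reasoning
              open ℚSolver.+-*-Solver

      *-cauchy : ∀ {a b} → IsCauchy a → IsCauchy b → IsCauchy (λ n → a n ℚ.* b n)
      *-cauchy {a} {b} ca cb {ε} 0<ε =
        let (K , 0<K , A , a≤K) = bounded ca
            (L , 0<L , B , b≤L) = bounded cb
            (δ , 0<δ , eq) = divide (ℚₚ.+-mono-< 0<K 0<L) 0<ε
            (M , ha) = ca 0<δ
            (N , hb) = cb 0<δ
        in (A ℕ.⊔ B) ℕ.⊔ (M ℕ.⊔ N) , λ m n hm hn →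
          let (mAB , mMN) = joint hm ; (nAB , nMN) = joint hn
              (mA , _) = joint mAB ; (_ , nB) = joint {A} nAB
              (mM , mN) = joint mMN ; (nM , nN) = joint nMN in
          subst (ℚ.∣ a m ℚ.* b m ℚ.- a n ℚ.* b n ∣ ℚ.≤_) eq
            (close-* {a m} {a n} {b m} {b n} {δ} {K} {L} (ℚₚ.<⇒≤ 0<K) (ℚₚ.<⇒≤ 0<L)
              (a≤K m mA) (b≤L n nB) (ha m n mM nM) (hb m n mN nN))

-- Real numbers are Cauchy sequences of rationals. Equality of reals is the
-- relation _≈_ below, not _≡_.
record ℝ : Set where
  constructor mkℝ
  field
    seq    : ℕ → ℚ
    cauchy : IsCauchy seq
open ℝ public

infix  4 _≤_ _<_ _≈_
infixl 6 _+_ _-_ _⊔_ _⊓_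
infixl 7 _*_
infix  8 -_

record _≤_ (x y : ℝ) : Set where
  constructor mk≤
  field
    eventually : ∀ {ε} → 0ℚ ℚ.< ε →
      ∃ λ N → ∀ n → N ℕ.≤ n → seq x n ℚ.≤ seq y n ℚ.+ ε

record _<_ (x y : ℝ) : Set where
  constructor mk<
  field
    separated : ∃ λ ε → (0ℚ ℚ.< ε) ×
      ∃ λ N → ∀ n → N ℕ.≤ n → seq x n ℚ.+ ε ℚ.≤ seq y n

_≈_ : ℝ → ℝ → Set
x ≈ y = (x ≤ y) × (y ≤ x)

fromℚ : ℚ → ℝ
fromℚ p = mkℝ (λ _ → p) (Cauchy.const-cauchy p)

fromℕ : ℕ → ℝ
fromℕ n = fromℚ (+ n ℚ./ 1)

0ℝ 1ℝ : ℝ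
0ℝ = fromℕ 0
1ℝ = fromℕ 1

_+_ : ℝ → ℝ → ℝ
x + y = mkℝ (λ n → seq x n ℚ.+ seq y n) (Cauchy.+-cauchy {seq x} {seq y} (cauchy x) (cauchy y))

-_ : ℝ → ℝ
-_ x = mkℝ (λ n → ℚ.- seq x n) (Cauchy.neg-cauchy {seq x} (cauchy x))

_-_ : ℝ → ℝ → ℝ
_-_ x y = x + (- y)

_*_ : ℝ → ℝ → ℝ
x * y = mkℝ (λ n → seq x n ℚ.* seq y n) (Cauchy.*-cauchy {seq x} {seq y} (cauchy x) (cauchy y))

_⊔_ : ℝ → ℝ → ℝ
x ⊔ y = mkℝ (λ n → seq x n ℚ.⊔ seq y n) (Cauchy.⊔-cauchy {seq x} {seq y} (cauchy x) (cauchy y))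

_⊓_ : ℝ → ℝ → ℝ
x ⊓ y = - ((- x) ⊔ (- y))

∣_∣ : ℝ → ℝ
∣ x ∣ = x ⊔ (- x)

infixr 8 _^_
_^_ : ℝ → ℕ → ℝ
x ^ zero  = 1ℝ
x ^ suc n = x * x ^ n

∑ : ∀ {n} → (Fin n → ℝ) → ℝ
∑ = Vector.foldr _+_ 0ℝ

infix 4 _⟶_
_⟶_ : (ℕ → ℝ) → ℝ → Set
s ⟶ y = ∀ {ε} → 0ℝ < ε → ∃ λ N → ∀ n → N ℕ.≤ n → ∣ s n - y ∣ < ε

-- Starting the fold at 0 is harmless, as absolute values are nonnegative.
∥_∥∞ : ∀ {k} → (Fin k → ℝ) → ℝ
∥ z ∥∞ = Vector.foldr _⊔_ 0ℝ (λ j → ∣ z j ∣)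

-- A probability law of finite support, presented as finitely many weighted
-- outcomes. Outcomes may repeat; the mass of a point is then the sum of the
-- weights of its repetitions.
record Law (A : Set) : Set where
  field
    size    : ℕ
    outcome : Fin size → A
    weight  : Fin size → ℝ
    nonneg  : ∀ ω → 0ℝ ≤ weight ω
    total   : ∑ weight ≈ 1ℝ
open Law public

𝔼 : ∀ {A} → Law A → (A → ℝ) → ℝ
𝔼 μ f = ∑ λ ω → weight μ ω * f (outcome μ ω)

Neighboring : ∀ {D : Set} {n} → Vec D n → Vec D n → Set
Neighboring x x′ = ∃ λ i → (lookup x i ≢ lookup x′ i) ×
                           (∀ j → j ≢ i → lookup x j ≡ lookup x′ j)

-- A subset of ℝᵏ has to respect the equality of real vectors.
record Subset (k : ℕ) : Set₁ where
  field
    member  : (Fin k → ℝ) → Set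
    respect : ∀ {y z} → (∀ j → y j ≈ z j) → member y → member z
open Subset public

Mechanism : Set → ℕ → ℕ → Set
Mechanism D n k = Vec D n → Law (Fin k → ℝ)

module Classical (lem : ExcludedMiddle 0ℓ) where

  -- Definite description, with the junk value 0 when nothing satisfies P.
  -- It is only applied to P that hold of exactly one real up to _≈_ at the
  -- arguments where the operations below are meaningful.
  the : (ℝ → Set) → ℝ
  the P with lem {∃ P}
  ... | yes (y , _) = y
  ... | no  _       = 0ℝ

  infixl 7 _÷_
  _÷_ : ℝ → ℝ → ℝ
  x ÷ y = the λ z → z * y ≈ x

  exp : ℝ → ℝ
  exp x = the λ y → (λ N → ∑ {N} λ i → x ^ toℕ i ÷ fromℕ (toℕ i !)) ⟶ y

  log : ℝ → ℝ
  log x = the λ y → exp y ≈ x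

  sqrt : ℝ → ℝ
  sqrt x = the λ y → (0ℝ ≤ y) × (y * y ≈ x)

  ℙ[_∈_] : ∀ {k} → Law (Fin k → ℝ) → Subset k → ℝ
  ℙ[ μ ∈ E ] = 𝔼 μ λ y → if does (lem {member E y}) then 1ℝ else 0ℝ

  F : ∀ {D : Set} {n k} → (Fin k → D → ℝ) → Vec D n → Fin k → ℝ
  F {n = n} q x j = ∑ (λ i → q j (lookup x i)) ÷ fromℕ n

  PureDP : ∀ {D n k} → ℝ → Mechanism D n k → Set₁
  PureDP ε M = ∀ x x′ → Neighboring x x′ →
    ∀ E → ℙ[ M x ∈ E ] ≤ exp ε * ℙ[ M x′ ∈ E ]

{-# OPTIONS --safe #-}

-- The mechanism composes exponential mechanisms at geometrically decreasing scales. A state consists of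
-- candidate answers Y (scaled by n) together with an accuracy H; the score of a state on x is the Hamming
-- distance from x to the databases that Y describes up to H, so it has sensitivity one. If a database x′ is
-- within distance h of such a database, then its answers differ from Y, up to H, by a signed sum of 2h records,
-- and by Maurey sampling m signed records approximate this sum up to 8hθ as soon as mθ² ≥ log(2k)/2. Hence
-- (2T)ᵐ refinements of Y suffice, and the exponential mechanism with parameter λ picks one at distance about
-- m log(2T)/λ from x. Let a be the square root in the theorem. With distances n 8⁻ʲ and privacy parameters
-- ε 2⁻ʲ⁻², the accuracies lost at the steps sum to O(n a), and one stops when 4⁻ʲ reaches 16 a. Only the
-- expected excess of the distance over its nominal value n 8⁻ʲ has to be carried along.
module Submission where

open import Algebra.Bundles using (CommutativeRing)
open import Algebra.Solver.Ring.AlmostCommutativeRing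
  using (fromCommutativeRing; _-Raw-AlmostCommutative⟶_)
import Algebra.Solver.Ring as RingSolver
open import Axiom.ExcludedMiddle using (ExcludedMiddle)
open import Data.Bool.Base using (Bool; true; false; if_then_else_)
open import Data.Fin.Base as Fin using (Fin; zero; suc; toℕ)
import Data.Fin.Properties as Finₚ
open import Data.Integer.Base as ℤ using (+_; -[1+_])
import Data.Integer.Properties as ℤₚ
open import Data.List.Base as List using (List; []; _∷_; _++_; length)
open import Data.List.Membership.Propositional using (_∈_)
import Data.List.Membership.Propositional.Properties as ∈ₚ
import Data.List.Properties as Listₚ
open import Data.List.Relation.Unary.Any using (here; there)
open import Data.Maybe.Base using (Maybe; just; nothing)
open import Data.Nat.Base as ℕ using (ℕ; zero; suc; s≤s; z≤n; _!)
import Data.Nat.Properties as ℕₚ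
open import Data.Product.Base using (Σ; ∃; _×_; _,_; proj₁; proj₂)
open import Data.Rational.Base as ℚ using (ℚ; 0ℚ; 1ℚ; ½)
import Data.Rational.Properties as ℚₚ
import Data.Rational.Solver as ℚSolver
import Data.Rational.Unnormalised.Base as ℚᵘ
import Data.Rational.Unnormalised.Properties as ℚᵘₚ
open import Data.Sum.Base using (_⊎_; inj₁; inj₂; [_,_]′)
open import Data.Vec.Base as Vec using (Vec; []; _∷_; lookup; _[_]≔_)
import Data.Vec.Properties as Vecₚ
open import Function.Base using (_∘_)
open import Function.Bundles using (_↔_; Inverse)
open import Level using (0ℓ)
open import Relation.Binary.Definitions using (_Respects₂_)
import Relation.Binary.Reasoning.Base.Triple as Triple
open import Relation.Binary.PropositionalEquality
  using (_≡_; refl; sym; trans; cong; cong₂; subst; subst₂)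
open import Relation.Binary.Structures using (IsEquivalence; IsPreorder)
open import Relation.Nullary using (¬_; Dec; yes; no; does; contradiction)

-- One sampling step on the whole database yields only a cube-root rate: error nθ needs m ≈
-- log(2k)/θ² records, the exponential mechanism then stops at distance about log(2k) log(2T)/(εθ²),
-- and balancing the two fixes θ³. But the sampling error is proportional to the length of the path
-- that is sampled, so a coarse step that merely shortens the path makes the next, less accurate
-- rate affordable. This dictates the scales. With distances n R⁻ʲ and privacy ε p⁻ʲ, the sample
-- size is of order εn (Rp)⁻ʲ / log(2T), the rate of order a (Rp)^(j/2), and the accuracy lost of
-- order n a (p/R)^(j/2). Privacy and accuracy both form convergent geometric series when 1 < p < R;
-- the choice R = 8, p = 2 makes Rp a square, so that no further roots occur. The excess grows like
-- 2ʲ/ε, but its last and largest term is still O(n a) at the stopping scale. The stopping rule 16 a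
-- 4ʲ ≥ 1 marks where the rate 8 a 4ʲ would leave the range θ ≤ ½ of the exponential moment bound;
-- before that, the sample size is at least 2, so rounding it down is harmless.

module ℚS = ℚSolver.+-*-Solver

-- Rational arithmetic

module ℚLemmas where
  open ℚS
  open import Data.Rational.Base using (_+_; _*_; _-_; _≤_; _<_; -_; ∣_∣)

  -- The certificate style used throughout: the difference `e` is exhibited in a visibly nonnegative
  -- form, and what remains is an identity for the ring solver. `≤-by` is the same device for reals.
  ≤-cert : ∀ {p q} e → 0ℚ ≤ e → p + e ≡ q → p ≤ q
  ≤-cert {p} e 0≤e refl = subst (_≤ p + e) (ℚₚ.+-identityʳ p) (ℚₚ.+-monoʳ-≤ p 0≤e)

  gap : ∀ {p q} → p ≤ q → 0ℚ ≤ q - p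
  gap {p} {q} h = subst (_≤ q - p) (ℚₚ.+-inverseʳ p) (ℚₚ.+-monoˡ-≤ (- p) h)

  +-nonneg : ∀ {p q} → 0ℚ ≤ p → 0ℚ ≤ q → 0ℚ ≤ p + q
  +-nonneg = ℚₚ.+-mono-≤

  *-nonneg : ∀ {p q} → 0ℚ ≤ p → 0ℚ ≤ q → 0ℚ ≤ p * q
  *-nonneg {p} {q} 0≤p 0≤q = ℚₚ.nonNegative⁻¹ (p * q)
    {{ℚₚ.nonNeg*nonNeg⇒nonNeg p {{ℚ.nonNegative 0≤p}} q {{ℚ.nonNegative 0≤q}}}}

  *-pos : ∀ {p q} → 0ℚ < p → 0ℚ < q → 0ℚ < p * q
  *-pos {p} {q} 0<p 0<q = ℚₚ.positive⁻¹ (p * q)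
    {{ℚₚ.pos*pos⇒pos p {{ℚ.positive 0<p}} q {{ℚ.positive 0<q}}}}

  ½-pos : ∀ {ε} → 0ℚ < ε → 0ℚ < ½ * ε
  ½-pos = *-pos (ℚₚ.positive⁻¹ ½)

  ≤∣∣ : ∀ p → p ≤ ∣ p ∣
  ≤∣∣ p with ℚₚ.≤-total 0ℚ p
  ... | inj₁ 0≤p = ℚₚ.≤-reflexive (sym (ℚₚ.0≤p⇒∣p∣≡p 0≤p))
  ... | inj₂ p≤0 = ℚₚ.≤-trans p≤0 (ℚₚ.0≤∣p∣ p)

  -≤∣∣ : ∀ p → - p ≤ ∣ p ∣
  -≤∣∣ p = subst (- p ≤_) (ℚₚ.∣-p∣≡∣p∣ p) (≤∣∣ (- p))

  ∣∣≤ : ∀ {p q} → p ≤ q → - p ≤ q → ∣ p ∣ ≤ q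
  ∣∣≤ {p} {q} h k with ℚₚ.∣p∣≡p∨∣p∣≡-p p
  ... | inj₁ e = subst (_≤ q) (sym e) h
  ... | inj₂ e = subst (_≤ q) (sym e) k

  close⁺ : ∀ {p q ε} → ∣ p - q ∣ ≤ ε → p ≤ q + ε
  close⁺ {p} {q} {ε} h = ≤-cert (ε - (p - q)) (gap (ℚₚ.≤-trans (≤∣∣ (p - q)) h))
    (solve 3 (λ p q e → p :+ (e :- (p :- q)) := q :+ e) refl p q ε)

  close⁻ : ∀ {p q ε} → ∣ p - q ∣ ≤ ε → q ≤ p + ε
  close⁻ {p} {q} {ε} h = ≤-cert (ε - (- (p - q))) (gap (ℚₚ.≤-trans (-≤∣∣ (p - q)) h))
    (solve 3 (λ p q e → q :+ (e :- (:- (p :- q))) := p :+ e) refl p q ε)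

  ≤⇒close : ∀ {p q ε} → p ≤ q + ε → q ≤ p + ε → ∣ p - q ∣ ≤ ε
  ≤⇒close {p} {q} {ε} h k = ∣∣≤
    (≤-cert (q + ε - p) (gap h) (solve 3 (λ p q e → p :- q :+ (q :+ e :- p) := e) refl p q ε))
    (≤-cert (p + ε - q) (gap k) (solve 3 (λ p q e → :- (p :- q) :+ (p :+ e :- q) := e) refl p q ε))

  divide : ∀ {C ε} → 0ℚ < C → 0ℚ < ε → ∃ λ δ → (0ℚ < δ) × (C * δ ≡ ε)
  divide {C} {ε} 0<C 0<ε = C⁻¹ * ε
    , *-pos (ℚₚ.positive⁻¹ C⁻¹ {{ℚₚ.1/pos⇒pos C}}) 0<ε
    , trans (sym (ℚₚ.*-assoc C C⁻¹ ε))
        (trans (cong (_* ε) (ℚₚ.*-inverseʳ C)) (ℚₚ.*-identityˡ ε))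
    where
    instance
      C-pos : ℚ.Positive C
      C-pos = ℚ.positive 0<C
      C-nonZero : ℚ.NonZero C
      C-nonZero = ℚₚ.pos⇒nonZero C
    C⁻¹ : ℚ
    C⁻¹ = ℚ.1/ C

  -- Serves `*-nonneg` on reals, whose representatives are only eventually at least -δ. According to
  -- the sign of `p`, the sum equals p(q + δ) + δ(K - p) or (p + δ)K + (-p)(K - q), with all factors
  -- nonnegative.
  almost-nonneg-* : ∀ {p q δ K} → 0ℚ ≤ p + δ → 0ℚ ≤ q + δ → 0ℚ ≤ δ → 0ℚ ≤ K →
                    ∣ p ∣ ≤ K → ∣ q ∣ ≤ K → 0ℚ ≤ p * q + K * δ
  almost-nonneg-* {p} {q} {δ} {K} hp hq hδ hK kp kq with ℚₚ.≤-total 0ℚ p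
  ... | inj₁ 0≤p = subst (0ℚ ≤_)
      (solve 4 (λ p q d k → p :* (q :+ d) :+ d :* (k :- p) := p :* q :+ k :* d) refl p q δ K)
      (+-nonneg (*-nonneg 0≤p hq) (*-nonneg hδ (gap (ℚₚ.≤-trans (≤∣∣ p) kp))))
  ... | inj₂ p≤0 = subst (0ℚ ≤_)
      (solve 4 (λ p q d k → (p :+ d) :* k :+ (con 0ℚ :- p) :* (k :- q) := p :* q :+ k :* d) refl p q δ K)
      (+-nonneg (*-nonneg hp hK) (*-nonneg (gap p≤0) (gap (ℚₚ.≤-trans (≤∣∣ q) kq))))

  halves : ∀ ε → ½ * ε + ½ * ε ≡ ε
  halves ε = trans (sym (ℚₚ.*-distribʳ-+ ε ½ ½)) (ℚₚ.*-identityˡ ε)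

  -- The gcd inside `ℚ./` does not reduce for variable numerators, hence the detour through
  -- unnormalised rationals here and in the next lemmas.
  /1-homo-+ : ∀ m n → + (m ℕ.+ n) ℚ./ 1 ≡ (+ m ℚ./ 1) + (+ n ℚ./ 1)
  /1-homo-+ m n = ℚₚ.toℚᵘ-injective (ℚᵘₚ.≃-trans (ℚₚ.toℚᵘ-fromℚᵘ (ℚᵘ.mkℚᵘ (+ (m ℕ.+ n)) 0))
    (ℚᵘₚ.≃-trans (ℚᵘ.*≡* (cong (ℤ._* + 1) (cong₂ ℤ._+_ (sym (ℤₚ.*-identityʳ (+ m))) (sym (ℤₚ.*-identityʳ (+ n))))))
    (ℚᵘₚ.≃-sym (ℚᵘₚ.≃-trans (ℚₚ.toℚᵘ-homo-+ (+ m ℚ./ 1) (+ n ℚ./ 1))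
      (ℚᵘₚ.+-cong (ℚₚ.toℚᵘ-fromℚᵘ (ℚᵘ.mkℚᵘ (+ m) 0)) (ℚₚ.toℚᵘ-fromℚᵘ (ℚᵘ.mkℚᵘ (+ n) 0)))))))

  /1-homo-* : ∀ m n → + (m ℕ.* n) ℚ./ 1 ≡ (+ m ℚ./ 1) * (+ n ℚ./ 1)
  /1-homo-* m n = ℚₚ.toℚᵘ-injective (ℚᵘₚ.≃-trans (ℚₚ.toℚᵘ-fromℚᵘ (ℚᵘ.mkℚᵘ (+ (m ℕ.* n)) 0))
    (ℚᵘₚ.≃-trans (ℚᵘ.*≡* (cong (ℤ._* + 1) (ℤₚ.pos-* m n)))
    (ℚᵘₚ.≃-sym (ℚᵘₚ.≃-trans (ℚₚ.toℚᵘ-homo-* (+ m ℚ./ 1) (+ n ℚ./ 1))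
      (ℚᵘₚ.*-cong (ℚₚ.toℚᵘ-fromℚᵘ (ℚᵘ.mkℚᵘ (+ m) 0)) (ℚₚ.toℚᵘ-fromℚᵘ (ℚᵘ.mkℚᵘ (+ n) 0)))))))

  /1-mono-≤ : ∀ {m n} → m ℕ.≤ n → + m ℚ./ 1 ≤ + n ℚ./ 1
  /1-mono-≤ {m} {n} h = ℚₚ.toℚᵘ-cancel-≤
    (ℚᵘₚ.≤-respˡ-≃ (ℚᵘₚ.≃-sym (ℚₚ.toℚᵘ-fromℚᵘ (ℚᵘ.mkℚᵘ (+ m) 0)))
    (ℚᵘₚ.≤-respʳ-≃ (ℚᵘₚ.≃-sym (ℚₚ.toℚᵘ-fromℚᵘ (ℚᵘ.mkℚᵘ (+ n) 0)))
      (ℚᵘ.*≤* (ℤₚ.*-monoʳ-≤-nonNeg (+ 1) (ℤ.+≤+ h)))))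

  /1-mono-< : ∀ {m n} → m ℕ.< n → + m ℚ./ 1 < + n ℚ./ 1
  /1-mono-< {m} {n} h = ℚₚ.toℚᵘ-cancel-<
    (ℚᵘₚ.<-respˡ-≃ (ℚᵘₚ.≃-sym (ℚₚ.toℚᵘ-fromℚᵘ (ℚᵘ.mkℚᵘ (+ m) 0)))
    (ℚᵘₚ.<-respʳ-≃ (ℚᵘₚ.≃-sym (ℚₚ.toℚᵘ-fromℚᵘ (ℚᵘ.mkℚᵘ (+ n) 0)))
      (ℚᵘ.*<* (ℤₚ.*-monoʳ-<-pos (+ 1) (ℤ.+<+ h)))))

  archimedean : ∀ p → ∃ λ N → p ≤ + N ℚ./ 1
  archimedean p@(ℚ.mkℚ (+ a) d _) = a , ℚₚ.toℚᵘ-cancel-≤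
    (ℚᵘₚ.≤-respʳ-≃ (ℚᵘₚ.≃-sym (ℚₚ.toℚᵘ-fromℚᵘ (ℚᵘ.mkℚᵘ (+ a) 0)))
      (ℚᵘ.*≤* (ℤₚ.*-monoˡ-≤-nonNeg (+ a) (ℤ.+≤+ (s≤s z≤n)))))
  archimedean p@(ℚ.mkℚ -[1+ a ] d _) = 0 , ℚₚ.toℚᵘ-cancel-≤
    (ℚᵘₚ.≤-respʳ-≃ (ℚᵘₚ.≃-sym (ℚₚ.toℚᵘ-fromℚᵘ (ℚᵘ.mkℚᵘ (+ 0) 0))) (ℚᵘ.*≤* ℤ.-≤+))

  recip-suc : ∀ n → ∃ λ δ → (0ℚ < δ) × ((+ suc n ℚ./ 1) * δ ≡ 1ℚ)
  recip-suc n = divide (/1-mono-< {0} {suc n} (s≤s z≤n)) (ℚₚ.positive⁻¹ 1ℚ)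

  recip-suc-small : ∀ {ε} → 0ℚ < ε → ∃ λ N → ∀ n → N ℕ.≤ n → proj₁ (recip-suc n) ≤ ε
  recip-suc-small {ε} 0<ε = N , λ n N≤n →
    let (r , 0<r , nr≡1) = recip-suc n
        n⁺ = + suc n ℚ./ 1
        δ≤n⁺ : δ ≤ n⁺
        δ≤n⁺ = ℚₚ.≤-trans δ≤N (/1-mono-≤ (ℕₚ.≤-trans N≤n (ℕₚ.n≤1+n n)))
    in ≤-cert (r * (ε * (n⁺ - δ))) (*-nonneg (ℚₚ.<⇒≤ 0<r) (*-nonneg (ℚₚ.<⇒≤ 0<ε) (gap δ≤n⁺)))
      (trans (solve 4 (λ r e n d → r :+ r :* (e :* (n :- d)) := r :+ (e :* (n :* r) :- r :* (e :* d))) refl r ε n⁺ δ)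
      (trans (cong₂ (λ a b → r + (ε * a - r * b)) nr≡1 εδ≡1)
        (solve 2 (λ r e → r :+ (e :* con 1ℚ :- r :* con 1ℚ) := e) refl r ε)))
    where
    δ = proj₁ (divide 0<ε (ℚₚ.positive⁻¹ 1ℚ))
    εδ≡1 = proj₂ (proj₂ (divide 0<ε (ℚₚ.positive⁻¹ 1ℚ)))
    N = proj₁ (archimedean δ)
    δ≤N = proj₂ (archimedean δ)

open import Defs

private
  module Q = ℚLemmas

-- The ordered ring of real numbers

abstract
  ≤-pointwise : ∀ {x y} → (∀ n → seq x n ℚ.≤ seq y n) → x ≤ y
  ≤-pointwise {x} {y} h = mk≤ λ {ε} 0<ε → 0 , λ n _ →
    Q.≤-cert (seq y n ℚ.- seq x n ℚ.+ ε) (Q.+-nonneg (Q.gap (h n)) (ℚₚ.<⇒≤ 0<ε))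
      (solve 3 (λ x y e → x :+ (y :- x :+ e) := y :+ e) refl (seq x n) (seq y n) ε)
    where open ℚS

≈-pointwise : ∀ {x y} → (∀ n → seq x n ≡ seq y n) → x ≈ y
≈-pointwise h = ≤-pointwise (λ n → ℚₚ.≤-reflexive (h n))
              , ≤-pointwise (λ n → ℚₚ.≤-reflexive (sym (h n)))

≤-refl : ∀ {x} → x ≤ x
≤-refl = ≤-pointwise λ _ → ℚₚ.≤-refl

abstract
  ≤-trans : ∀ {x y z} → x ≤ y → y ≤ z → x ≤ z
  ≤-trans {x} {y} {z} (mk≤ p) (mk≤ q) = mk≤ λ {ε} 0<ε →
    let (M , p′) = p (Q.½-pos 0<ε) ; (N , q′) = q (Q.½-pos 0<ε) in
    M ℕ.⊔ N , λ n h →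
      Q.≤-cert ((seq y n ℚ.+ ½ ℚ.* ε ℚ.- seq x n) ℚ.+ (seq z n ℚ.+ ½ ℚ.* ε ℚ.- seq y n))
        (Q.+-nonneg (Q.gap (p′ n (ℕₚ.m⊔n≤o⇒m≤o M N h))) (Q.gap (q′ n (ℕₚ.m⊔n≤o⇒n≤o M N h))))
        (solve 4 (λ x y z e → x :+ ((y :+ con ½ :* e :- x) :+ (z :+ con ½ :* e :- y)) := z :+ e)
          refl (seq x n) (seq y n) (seq z n) ε)
    where
    open ℚS

abstract
  +-mono-≤ : ∀ {x y u v} → x ≤ y → u ≤ v → x + u ≤ y + v
  +-mono-≤ {x} {y} {u} {v} (mk≤ p) (mk≤ q) = mk≤ λ {ε} 0<ε →
    let (M , p′) = p (Q.½-pos 0<ε) ; (N , q′) = q (Q.½-pos 0<ε) in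
    M ℕ.⊔ N , λ n h →
      Q.≤-cert ((seq y n ℚ.+ ½ ℚ.* ε ℚ.- seq x n) ℚ.+ (seq v n ℚ.+ ½ ℚ.* ε ℚ.- seq u n))
        (Q.+-nonneg (Q.gap (p′ n (ℕₚ.m⊔n≤o⇒m≤o M N h))) (Q.gap (q′ n (ℕₚ.m⊔n≤o⇒n≤o M N h))))
        (solve 5 (λ x y u v e → (x :+ u) :+ ((y :+ con ½ :* e :- x) :+ (v :+ con ½ :* e :- u)) := (y :+ v) :+ e)
          refl (seq x n) (seq y n) (seq u n) (seq v n) ε)
    where open ℚS

abstract
  neg-mono-≤ : ∀ {x y} → x ≤ y → - y ≤ - x
  neg-mono-≤ {x} {y} (mk≤ p) = mk≤ λ {ε} 0<ε → let (N , p′) = p 0<ε in N , λ n h →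
    Q.≤-cert (seq y n ℚ.+ ε ℚ.- seq x n) (Q.gap (p′ n h))
      (solve 3 (λ x y e → :- y :+ (y :+ e :- x) := :- x :+ e) refl (seq x n) (seq y n) ε)
    where open ℚS

abstract
  bounded : ∀ x → ∃ λ K → (0ℚ ℚ.< K) × ∃ λ N → ∀ n → N ℕ.≤ n → ℚ.∣ seq x n ∣ ℚ.≤ K
  bounded x with cauchy x (ℚₚ.positive⁻¹ 1ℚ)
  ... | N , h = ℚ.∣ seq x N ∣ ℚ.+ 1ℚ
              , ℚₚ.+-mono-≤-< (ℚₚ.0≤∣p∣ (seq x N)) (ℚₚ.positive⁻¹ 1ℚ)
              , N , λ n N≤n → ℚₚ.≤-trans
                  (ℚₚ.≤-reflexive (cong ℚ.∣_∣ (solve 2 (λ p q → p := q :+ (p :- q)) refl (seq x n) (seq x N))))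
                  (ℚₚ.≤-trans (ℚₚ.∣p+q∣≤∣p∣+∣q∣ (seq x N) (seq x n ℚ.- seq x N))
                    (ℚₚ.+-monoʳ-≤ ℚ.∣ seq x N ∣ (h n N N≤n ℕₚ.≤-refl)))
    where open ℚS

abstract
  *-nonneg : ∀ {x y} → 0ℝ ≤ x → 0ℝ ≤ y → 0ℝ ≤ x * y
  *-nonneg {x} {y} (mk≤ p) (mk≤ q) = mk≤ λ {ε} 0<ε →
    let (K , 0<K , A , xK) = bounded x
        (L , 0<L , B , yL) = bounded y
        (δ , 0<δ , eq) = Q.divide (ℚₚ.+-mono-< 0<K 0<L) 0<ε
        (M , p′) = p 0<δ ; (N , q′) = q 0<δ
        0≤K = ℚₚ.<⇒≤ 0<K ; 0≤L = ℚₚ.<⇒≤ 0<L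
    in (A ℕ.⊔ B) ℕ.⊔ (M ℕ.⊔ N) , λ n h →
      let AB = ℕₚ.m⊔n≤o⇒m≤o (A ℕ.⊔ B) (M ℕ.⊔ N) h
          MN = ℕₚ.m⊔n≤o⇒n≤o (A ℕ.⊔ B) (M ℕ.⊔ N) h
      in subst (λ e → 0ℚ ℚ.≤ seq x n ℚ.* seq y n ℚ.+ e) eq
        (Q.almost-nonneg-* (p′ n (ℕₚ.m⊔n≤o⇒m≤o M N MN)) (q′ n (ℕₚ.m⊔n≤o⇒n≤o M N MN))
          (ℚₚ.<⇒≤ 0<δ) (Q.+-nonneg 0≤K 0≤L)
          (ℚₚ.≤-trans (xK n (ℕₚ.m⊔n≤o⇒m≤o A B AB))
            (subst (ℚ._≤ K ℚ.+ L) (ℚₚ.+-identityʳ K) (ℚₚ.+-monoʳ-≤ K 0≤L)))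
          (ℚₚ.≤-trans (yL n (ℕₚ.m⊔n≤o⇒n≤o A B AB))
            (subst (ℚ._≤ K ℚ.+ L) (ℚₚ.+-identityˡ L) (ℚₚ.+-monoˡ-≤ L 0≤K))))

≈-refl : ∀ {x} → x ≈ x
≈-refl = ≤-refl , ≤-refl

≈-sym : ∀ {x y} → x ≈ y → y ≈ x
≈-sym (p , q) = q , p

≈-trans : ∀ {x y z} → x ≈ y → y ≈ z → x ≈ z
≈-trans (p , p′) (q , q′) = ≤-trans p q , ≤-trans q′ p′

≈-isEquivalence : IsEquivalence _≈_
≈-isEquivalence = record { refl = ≈-refl ; sym = ≈-sym ; trans = ≈-trans }

+-cong : ∀ {x y u v} → x ≈ y → u ≈ v → x + u ≈ y + v
+-cong (p , p′) (q , q′) = +-mono-≤ p q , +-mono-≤ p′ q′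

neg-cong : ∀ {x y} → x ≈ y → - x ≈ - y
neg-cong (p , p′) = neg-mono-≤ p′ , neg-mono-≤ p

fromℚ-mono-≤ : ∀ {p q} → p ℚ.≤ q → fromℚ p ≤ fromℚ q
fromℚ-mono-≤ h = ≤-pointwise λ _ → h

∣seq∣≤⇒≤ : ∀ {x K} → (∃ λ N → ∀ n → N ℕ.≤ n → ℚ.∣ seq x n ∣ ℚ.≤ K) → x ≤ fromℚ K
∣seq∣≤⇒≤ {x} {K} (N , h) = mk≤ λ {ε} 0<ε → N , λ n N≤n →
  Q.≤-cert ((K ℚ.- seq x n) ℚ.+ ε) (Q.+-nonneg (Q.gap (ℚₚ.≤-trans (Q.≤∣∣ (seq x n)) (h n N≤n))) (ℚₚ.<⇒≤ 0<ε))
    (solve 3 (λ x k e → x :+ ((k :- x) :+ e) := k :+ e) refl (seq x n) K ε)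
  where open ℚS

private
  -- The factor `u` has arbitrary sign, so it is shifted by a bound K of its absolute value: yu - xu
  -- = (y - x)(K + u) + (x - y)K. Since x ≈ y, both differences are nonnegative and `*-nonneg`
  -- applies to each product.
  *-congʳ-≤ : ∀ {x y} u → x ≈ y → x * u ≤ y * u
  *-congʳ-≤ {x} {y} u (x≤y , y≤x) =
    let (K , 0<K , uK) = bounded u
        0≤y-x : 0ℝ ≤ y - x
        0≤y-x = ≤-trans (proj₁ (≈-pointwise λ n → sym (ℚₚ.+-inverseʳ (seq x n)))) (+-mono-≤ x≤y (≤-refl { - x}))
        0≤x-y : 0ℝ ≤ x - y
        0≤x-y = ≤-trans (proj₁ (≈-pointwise λ n → sym (ℚₚ.+-inverseʳ (seq y n)))) (+-mono-≤ y≤x (≤-refl { - y}))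
        0≤K : 0ℝ ≤ fromℚ K
        0≤K = fromℚ-mono-≤ (ℚₚ.<⇒≤ 0<K)
        0≤K+u : 0ℝ ≤ fromℚ K + u
        0≤K+u = ≤-trans (proj₁ (≈-pointwise λ n → solve 1 (λ u → con 0ℚ := :- u :+ u) refl (seq u n)))
          (+-mono-≤ (∣seq∣≤⇒≤ {x = - u} (proj₁ uK , λ n h →
            subst (ℚ._≤ K) (sym (ℚₚ.∣-p∣≡∣p∣ (seq u n))) (proj₂ uK n h))) (≤-refl {u}))
    in ≤-trans (proj₁ (≈-pointwise λ n → solve 3 (λ x u k → x :* u := con 0ℚ :+ con 0ℚ :+ x :* u)
                  refl (seq x n) (seq u n) K))
      (≤-trans (+-mono-≤ (+-mono-≤ (*-nonneg 0≤y-x 0≤K+u) (*-nonneg 0≤x-y 0≤K)) (≤-refl {x * u}))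
        (proj₁ (≈-pointwise λ n → solve 4 (λ x y u k →
          (y :- x) :* (k :+ u) :+ (x :- y) :* k :+ x :* u := y :* u)
          refl (seq x n) (seq y n) (seq u n) K)))
    where open ℚS

*-comm : ∀ x y → x * y ≈ y * x
*-comm x y = ≈-pointwise λ n → ℚₚ.*-comm (seq x n) (seq y n)

*-cong : ∀ {x y u v} → x ≈ y → u ≈ v → x * u ≈ y * v
*-cong {x} {y} {u} {v} p q = ≈-trans (*-congʳ-≤ u p , *-congʳ-≤ u (≈-sym p))
  (≈-trans (*-comm y u) (≈-trans (*-congʳ-≤ y q , *-congʳ-≤ y (≈-sym q)) (*-comm v y)))

ℝ-commutativeRing : CommutativeRing 0ℓ 0ℓ
ℝ-commutativeRing = record
  { Carrier = ℝ ; _≈_ = _≈_ ; _+_ = _+_ ; _*_ = _*_ ; -_ = -_ ; 0# = 0ℝ ; 1# = 1ℝ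
  ; isCommutativeRing = record
    { isRing = record
      { +-isAbelianGroup = record
        { isGroup = record
          { isMonoid = record
            { isSemigroup = record
              { isMagma = record { isEquivalence = ≈-isEquivalence ; ∙-cong = +-cong }
              ; assoc = λ x y z → ≈-pointwise λ n → ℚₚ.+-assoc (seq x n) (seq y n) (seq z n) }
            ; identity = (λ x → ≈-pointwise λ n → ℚₚ.+-identityˡ (seq x n))
                       , (λ x → ≈-pointwise λ n → ℚₚ.+-identityʳ (seq x n)) }
          ; inverse = (λ x → ≈-pointwise λ n → ℚₚ.+-inverseˡ (seq x n))
                    , (λ x → ≈-pointwise λ n → ℚₚ.+-inverseʳ (seq x n))
          ; ⁻¹-cong = neg-cong }
        ; comm = λ x y → ≈-pointwise λ n → ℚₚ.+-comm (seq x n) (seq y n) }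
      ; *-cong = *-cong
      ; *-assoc = λ x y z → ≈-pointwise λ n → ℚₚ.*-assoc (seq x n) (seq y n) (seq z n)
      ; *-identity = (λ x → ≈-pointwise λ n → ℚₚ.*-identityˡ (seq x n))
                   , (λ x → ≈-pointwise λ n → ℚₚ.*-identityʳ (seq x n))
      ; distrib = (λ x y z → ≈-pointwise λ n → ℚₚ.*-distribˡ-+ (seq x n) (seq y n) (seq z n))
                , (λ x y z → ≈-pointwise λ n → ℚₚ.*-distribʳ-+ (seq x n) (seq y n) (seq z n)) }
    ; *-comm = *-comm } }

-- Rational coefficients let the solver compute with constants such as ½ and 1/64, and their
-- equality is decidable, unlike that of reals.
fromℚ-morphism : CommutativeRing.rawRing ℚₚ.+-*-commutativeRing
                 -Raw-AlmostCommutative⟶ fromCommutativeRing ℝ-commutativeRing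
fromℚ-morphism = record
  { ⟦_⟧ = fromℚ
  ; +-homo = λ p q → ≈-pointwise λ _ → refl
  ; *-homo = λ p q → ≈-pointwise λ _ → refl
  ; -‿homo = λ p → ≈-pointwise λ _ → refl
  ; 0-homo = ≈-refl
  ; 1-homo = ≈-refl }

private
  _≟ᶜ_ : ∀ p q → Maybe (fromℚ p ≈ fromℚ q)
  p ≟ᶜ q with p ℚₚ.≟ q
  ... | yes refl = just ≈-refl
  ... | no _     = nothing

module ℝS = RingSolver (CommutativeRing.rawRing ℚₚ.+-*-commutativeRing)
  (fromCommutativeRing ℝ-commutativeRing) fromℚ-morphism _≟ᶜ_

open ℝS using (solve; con; _:+_; _:*_; _:-_; :-_; _:=_)

κ : ∀ {m} → ℕ → ℝS.Polynomial m
κ n = con (+ n ℚ./ 1)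

abstract
  <⇒≤ : ∀ {x y} → x < y → x ≤ y
  <⇒≤ {x} {y} (mk< (δ , 0<δ , N , h)) = mk≤ λ {ε} 0<ε → N , λ n N≤n →
    Q.≤-cert ((seq y n ℚ.- (seq x n ℚ.+ δ)) ℚ.+ δ ℚ.+ ε)
      (Q.+-nonneg (Q.+-nonneg (Q.gap (h n N≤n)) (ℚₚ.<⇒≤ 0<δ)) (ℚₚ.<⇒≤ 0<ε))
      (ℚS.solve 4 (λ x y d e → x ℚS.:+ ((y ℚS.:- (x ℚS.:+ d)) ℚS.:+ d ℚS.:+ e) ℚS.:= y ℚS.:+ e)
        refl (seq x n) (seq y n) δ ε)

<⇒≱ : ∀ {x y} → x < y → ¬ (y ≤ x)
<⇒≱ {x} {y} (mk< (δ , 0<δ , N , h)) (mk≤ k) =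
  let (M , k′) = k (Q.½-pos 0<δ)
      n = M ℕ.⊔ N
      a = h n (ℕₚ.m≤n⊔m M N)
      b = k′ n (ℕₚ.m≤m⊔n M N)
  in ℚₚ.<-irrefl refl (ℚₚ.<-≤-trans (Q.½-pos 0<δ)
       (Q.≤-cert ((seq y n ℚ.- (seq x n ℚ.+ δ)) ℚ.+ (seq x n ℚ.+ ½ ℚ.* δ ℚ.- seq y n))
         (Q.+-nonneg (Q.gap a) (Q.gap b))
         (ℚS.solve 3 (λ x y d → ℚS.con ½ ℚS.:* d ℚS.:+ ((y ℚS.:- (x ℚS.:+ d)) ℚS.:+ (x ℚS.:+ ℚS.con ½ ℚS.:* d ℚS.:- y)) ℚS.:= ℚS.con 0ℚ)
           refl (seq x n) (seq y n) δ)))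

abstract
  ≤-by : ∀ {x y} e → 0ℝ ≤ e → x + e ≈ y → x ≤ y
  ≤-by {x} e 0≤e eq = ≤-trans (proj₁ (≈-sym (CommutativeRing.+-identityʳ ℝ-commutativeRing x)))
    (≤-trans (+-mono-≤ (≤-refl {x}) 0≤e) (proj₁ eq))

abstract
  ≤-gap : ∀ {x y} → x ≤ y → 0ℝ ≤ y - x
  ≤-gap {x} {y} h = ≤-trans (proj₁ (≈-sym (CommutativeRing.-‿inverseʳ ℝ-commutativeRing x)))
    (+-mono-≤ h (≤-refl { - x}))

abstract
  +-nonneg : ∀ {x y} → 0ℝ ≤ x → 0ℝ ≤ y → 0ℝ ≤ x + y
  +-nonneg {x} {y} p q = ≤-trans (proj₁ (≈-sym (CommutativeRing.+-identityʳ ℝ-commutativeRing 0ℝ)))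
    (+-mono-≤ p q)

abstract
  *-pos : ∀ {x y} → 0ℝ < x → 0ℝ < y → 0ℝ < x * y
  *-pos {x} {y} (mk< (δ , 0<δ , M , h)) (mk< (ε , 0<ε , N , k)) =
    mk< (δ ℚ.* ε , Q.*-pos 0<δ 0<ε , M ℕ.⊔ N , λ n MN →
      let a = h n (ℕₚ.m⊔n≤o⇒m≤o M N MN) ; b = k n (ℕₚ.m⊔n≤o⇒n≤o M N MN) in
      Q.≤-cert ((seq x n ℚ.- (0ℚ ℚ.+ δ)) ℚ.* (seq y n ℚ.- (0ℚ ℚ.+ ε))
                ℚ.+ (δ ℚ.* (seq y n ℚ.- (0ℚ ℚ.+ ε)) ℚ.+ ε ℚ.* (seq x n ℚ.- (0ℚ ℚ.+ δ))))
        (Q.+-nonneg (Q.*-nonneg (Q.gap a) (Q.gap b))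
          (Q.+-nonneg (Q.*-nonneg (ℚₚ.<⇒≤ 0<δ) (Q.gap b)) (Q.*-nonneg (ℚₚ.<⇒≤ 0<ε) (Q.gap a))))
        (ℚS.solve 4 (λ x y d e → (ℚS.con 0ℚ ℚS.:+ d ℚS.:* e) ℚS.:+ ((x ℚS.:- (ℚS.con 0ℚ ℚS.:+ d)) ℚS.:* (y ℚS.:- (ℚS.con 0ℚ ℚS.:+ e))
            ℚS.:+ (d ℚS.:* (y ℚS.:- (ℚS.con 0ℚ ℚS.:+ e)) ℚS.:+ e ℚS.:* (x ℚS.:- (ℚS.con 0ℚ ℚS.:+ d)))) ℚS.:= x ℚS.:* y)
          refl (seq x n) (seq y n) δ ε))

fromℚ-mono-< : ∀ {p q} → p ℚ.< q → fromℚ p < fromℚ q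
fromℚ-mono-< {p} {q} h = mk< (q ℚ.- p
  , subst (ℚ._< q ℚ.- p) (ℚₚ.+-inverseʳ p) (ℚₚ.+-monoˡ-< (ℚ.- p) h)
  , 0 , λ _ _ → ℚₚ.≤-reflexive (ℚS.solve 2 (λ p q → p ℚS.:+ (q ℚS.:- p) ℚS.:= q) refl p q))

fromℚ-cancel-≤ : ∀ {p q} → fromℚ p ≤ fromℚ q → p ℚ.≤ q
fromℚ-cancel-≤ {p} {q} h with p ℚₚ.≤? q
... | yes p≤q = p≤q
... | no p≰q = contradiction h (<⇒≱ (fromℚ-mono-< (ℚₚ.≰⇒> p≰q)))

fromℕ-mono-≤ : ∀ {m n} → m ℕ.≤ n → fromℕ m ≤ fromℕ n
fromℕ-mono-≤ h = fromℚ-mono-≤ (Q./1-mono-≤ h)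

fromℕ-mono-< : ∀ {m n} → m ℕ.< n → fromℕ m < fromℕ n
fromℕ-mono-< h = fromℚ-mono-< (Q./1-mono-< h)

fromℕ-cancel-< : ∀ {m n} → fromℕ m < fromℕ n → m ℕ.< n
fromℕ-cancel-< h = ℕₚ.≰⇒> λ n≤m → <⇒≱ h (fromℕ-mono-≤ n≤m)

fromℕ-nonneg : ∀ n → 0ℝ ≤ fromℕ n
fromℕ-nonneg n = fromℕ-mono-≤ {0} {n} z≤n

fromℕ-+ : ∀ m n → fromℕ (m ℕ.+ n) ≈ fromℕ m + fromℕ n
fromℕ-+ m n = ≈-pointwise λ _ → Q./1-homo-+ m n

fromℕ-* : ∀ m n → fromℕ (m ℕ.* n) ≈ fromℕ m * fromℕ n
fromℕ-* m n = ≈-pointwise λ _ → Q./1-homo-* m n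

fromℕ-suc : ∀ n → fromℕ (suc n) ≈ 1ℝ + fromℕ n
fromℕ-suc = fromℕ-+ 1

≤-up-to-ε : ∀ {x y} → (∀ {ε} → 0ℚ ℚ.< ε → x ≤ y + fromℚ ε) → x ≤ y
≤-up-to-ε {x} {y} h = mk≤ λ {ε} 0<ε →
  let mk≤ k = h (Q.½-pos 0<ε) ; (N , k′) = k (Q.½-pos 0<ε) in
  N , λ n N≤n → ℚₚ.≤-trans (k′ n N≤n) (ℚₚ.≤-reflexive
    (ℚS.solve 2 (λ y e → y ℚS.:+ ℚS.con ½ ℚS.:* e ℚS.:+ ℚS.con ½ ℚS.:* e ℚS.:= y ℚS.:+ e) refl (seq y n) ε))

archimedean : ∀ x → ∃ λ N → x < fromℕ N
archimedean x =
  let (K , _ , xK) = bounded x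
      (N , K≤N) = Q.archimedean K
  in suc N , mk< (1ℚ , ℚₚ.positive⁻¹ 1ℚ , proj₁ xK , λ n h →
       ℚₚ.≤-trans (ℚₚ.+-monoˡ-≤ 1ℚ (ℚₚ.≤-trans (Q.≤∣∣ (seq x n)) (ℚₚ.≤-trans (proj₂ xK n h) K≤N)))
         (ℚₚ.≤-reflexive (trans (ℚₚ.+-comm (+ N ℚ./ 1) 1ℚ) (sym (Q./1-homo-+ 1 N)))))

rational-below : ∀ {x} → 0ℝ < x → ∃ λ q → (0ℚ ℚ.< q) × (fromℚ q ≤ x)
rational-below {x} (mk< (δ , 0<δ , N , h)) = δ , 0<δ , mk≤ λ {ε} 0<ε → N , λ n N≤n →
  Q.≤-cert ((seq x n ℚ.- (0ℚ ℚ.+ δ)) ℚ.+ ε) (Q.+-nonneg (Q.gap (h n N≤n)) (ℚₚ.<⇒≤ 0<ε))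
    (ℚS.solve 3 (λ x d e → d ℚS.:+ ((x ℚS.:- (ℚS.con 0ℚ ℚS.:+ d)) ℚS.:+ e) ℚS.:= x ℚS.:+ e) refl (seq x n) δ ε)

∃-close-rational : ∀ x {ε} → 0ℚ ℚ.< ε → ∃ λ q → (x ≤ fromℚ q + fromℚ ε) × (fromℚ q ≤ x + fromℚ ε)
∃-close-rational x {ε} 0<ε =
  let (N , h) = cauchy x 0<ε in
  seq x N
  , mk≤ (λ {δ} 0<δ → N , λ n N≤n → ℚₚ.≤-trans (Q.close⁺ {seq x n} {seq x N} (h n N N≤n ℕₚ.≤-refl))
      (Q.≤-cert δ (ℚₚ.<⇒≤ 0<δ) refl))
  , mk≤ (λ {δ} 0<δ → N , λ n N≤n → ℚₚ.≤-trans (Q.close⁻ {seq x n} {seq x N} (h n N N≤n ℕₚ.≤-refl))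
      (Q.≤-cert δ (ℚₚ.<⇒≤ 0<δ) refl))

x≤x⊔y : ∀ x y → x ≤ x ⊔ y
x≤x⊔y x y = ≤-pointwise λ n → ℚₚ.p≤p⊔q (seq x n) (seq y n)

y≤x⊔y : ∀ x y → y ≤ x ⊔ y
y≤x⊔y x y = ≤-pointwise λ n → ℚₚ.p≤q⊔p (seq x n) (seq y n)

⊔-lub : ∀ {x y z} → x ≤ z → y ≤ z → x ⊔ y ≤ z
⊔-lub {x} {y} (mk≤ h) (mk≤ k) = mk≤ λ 0<ε →
  let (M , h′) = h 0<ε ; (N , k′) = k 0<ε in
  M ℕ.⊔ N , λ n MN → ℚₚ.⊔-lub (h′ n (ℕₚ.m⊔n≤o⇒m≤o M N MN)) (k′ n (ℕₚ.m⊔n≤o⇒n≤o M N MN))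

neg-involutive : ∀ x → - - x ≈ x
neg-involutive x = solve 1 (λ x → :- :- x := x) ≈-refl x

⊓-glb : ∀ {x y z} → z ≤ x → z ≤ y → z ≤ x ⊓ y
⊓-glb {x} {y} {z} h k = ≤-trans (proj₂ (neg-involutive z)) (neg-mono-≤ (⊔-lub (neg-mono-≤ h) (neg-mono-≤ k)))

∣∣-lub : ∀ {x y} → x ≤ y → - x ≤ y → ∣ x ∣ ≤ y
∣∣-lub = ⊔-lub

x≤∣x∣ : ∀ x → x ≤ ∣ x ∣
x≤∣x∣ x = x≤x⊔y x (- x)

-x≤∣x∣ : ∀ x → - x ≤ ∣ x ∣
-x≤∣x∣ x = y≤x⊔y x (- x)

module Order (lem : ExcludedMiddle 0ℓ) where

  -- Past some index N both sequences move by at most ε/8, so the comparison of the two rationals at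
  -- N settles the matter: either x stays below y + ε from there on, or x exceeds y by ε/8, which
  -- contradicts y ≮ x.
  ≤-or-> : ∀ x y → x ≤ y ⊎ y < x
  ≤-or-> x y with lem {y < x}
  ... | yes y<x = inj₂ y<x
  ... | no y≮x = inj₁ (mk≤ λ {ε} 0<ε → eventually-≤ 0<ε)
    where
    open ℚS using () renaming (solve to solveℚ; con to conℚ; _:+_ to _⊕_; _:*_ to _⊗_; _:-_ to _⊖_; _:=_ to _≐_)
    eventually-≤ : ∀ {ε} → 0ℚ ℚ.< ε → ∃ λ N → ∀ n → N ℕ.≤ n → seq x n ℚ.≤ seq y n ℚ.+ ε
    eventually-≤ {ε} 0<ε = decide (seq x N ℚₚ.≤? seq y N ℚ.+ ½ ℚ.* ε)
      where
      δ = ½ ℚ.* (½ ℚ.* (½ ℚ.* ε))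
      0<δ : 0ℚ ℚ.< δ
      0<δ = Q.½-pos (Q.½-pos (Q.½-pos 0<ε))
      cx = cauchy x 0<δ
      cy = cauchy y 0<δ
      N = proj₁ cx ℕ.⊔ proj₁ cy
      x-close : ∀ n → N ℕ.≤ n → ℚ.∣ seq x n ℚ.- seq x N ∣ ℚ.≤ δ
      x-close n h = proj₂ cx n N (ℕₚ.m⊔n≤o⇒m≤o _ (proj₁ cy) h) (ℕₚ.m≤m⊔n _ _)
      y-close : ∀ n → N ℕ.≤ n → ℚ.∣ seq y n ℚ.- seq y N ∣ ℚ.≤ δ
      y-close n h = proj₂ cy n N (ℕₚ.m⊔n≤o⇒n≤o (proj₁ cx) _ h) (ℕₚ.m≤n⊔m (proj₁ cx) _)
      decide : Dec (seq x N ℚ.≤ seq y N ℚ.+ ½ ℚ.* ε) → ∃ λ N → ∀ n → N ℕ.≤ n → seq x n ℚ.≤ seq y n ℚ.+ ε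
      decide (yes h) = N , λ n N≤n → Q.≤-cert
        ((seq y N ℚ.+ ½ ℚ.* ε ℚ.- seq x N) ℚ.+ (seq x N ℚ.+ δ ℚ.- seq x n) ℚ.+ (seq y n ℚ.+ δ ℚ.- seq y N) ℚ.+ (δ ℚ.+ δ))
        (Q.+-nonneg (Q.+-nonneg (Q.+-nonneg (Q.gap h) (Q.gap (Q.close⁺ {seq x n} {seq x N} (x-close n N≤n))))
          (Q.gap (Q.close⁻ {seq y n} {seq y N} (y-close n N≤n)))) (Q.+-nonneg (ℚₚ.<⇒≤ 0<δ) (ℚₚ.<⇒≤ 0<δ)))
        (solveℚ 5 (λ x y x₀ y₀ e → let d = conℚ ½ ⊗ (conℚ ½ ⊗ (conℚ ½ ⊗ e)) in
            x ⊕ ((y₀ ⊕ conℚ ½ ⊗ e ⊖ x₀) ⊕ (x₀ ⊕ d ⊖ x) ⊕ (y ⊕ d ⊖ y₀) ⊕ (d ⊕ d)) ≐ y ⊕ e)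
          refl (seq x n) (seq y n) (seq x N) (seq y N) ε)
      decide (no h) = contradiction
        (mk< (δ , 0<δ , N , λ n N≤n → Q.≤-cert
          ((seq x N ℚ.- (seq y N ℚ.+ ½ ℚ.* ε)) ℚ.+ (seq x n ℚ.+ δ ℚ.- seq x N) ℚ.+ (seq y N ℚ.+ δ ℚ.- seq y n) ℚ.+ δ)
          (Q.+-nonneg (Q.+-nonneg (Q.+-nonneg (Q.gap (ℚₚ.<⇒≤ (ℚₚ.≰⇒> h)))
            (Q.gap (Q.close⁻ {seq x n} {seq x N} (x-close n N≤n))))
            (Q.gap (Q.close⁺ {seq y n} {seq y N} (y-close n N≤n)))) (ℚₚ.<⇒≤ 0<δ))
          (solveℚ 5 (λ x y x₀ y₀ e → let d = conℚ ½ ⊗ (conℚ ½ ⊗ (conℚ ½ ⊗ e)) in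
              (y ⊕ d) ⊕ ((x₀ ⊖ (y₀ ⊕ conℚ ½ ⊗ e)) ⊕ (x ⊕ d ⊖ x₀) ⊕ (y₀ ⊕ d ⊖ y) ⊕ d) ≐ x)
            refl (seq x n) (seq y n) (seq x N) (seq y N) ε))) y≮x

  ≰⇒> : ∀ {x y} → ¬ (x ≤ y) → y < x
  ≰⇒> {x} {y} h with ≤-or-> x y
  ... | inj₁ x≤y = contradiction x≤y h
  ... | inj₂ y<x = y<x

  ≤-total : ∀ x y → x ≤ y ⊎ y ≤ x
  ≤-total x y with ≤-or-> x y
  ... | inj₁ x≤y = inj₁ x≤y
  ... | inj₂ y<x = inj₂ (<⇒≤ y<x)

  <-≤-trans : ∀ {x y z} → x < y → y ≤ z → x < z
  <-≤-trans x<y y≤z = ≰⇒> λ z≤x → <⇒≱ x<y (≤-trans y≤z z≤x)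

  ≤-<-trans : ∀ {x y z} → x ≤ y → y < z → x < z
  ≤-<-trans x≤y y<z = ≰⇒> λ z≤x → <⇒≱ y<z (≤-trans z≤x x≤y)

  <-trans : ∀ {x y z} → x < y → y < z → x < z
  <-trans x<y y<z = <-≤-trans x<y (<⇒≤ y<z)

  <-asym : ∀ {x y} → x < y → ¬ (y < x)
  <-asym x<y y<x = <⇒≱ x<y (<⇒≤ y<x)

  <-resp-≈ : _<_ Respects₂ _≈_
  <-resp-≈ = (λ y≈z x<y → <-≤-trans x<y (proj₁ y≈z)) , (λ x≈z x<y → ≤-<-trans (proj₂ x≈z) x<y)

  ≤-isPreorder : IsPreorder _≈_ _≤_
  ≤-isPreorder = record { isEquivalence = ≈-isEquivalence ; reflexive = proj₁ ; trans = ≤-trans }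

  module ≤-Reasoning = Triple {A = ℝ} {_≈_ = _≈_} {_≤_ = _≤_} {_<_ = _<_}
    ≤-isPreorder <-asym <-trans <-resp-≈ <⇒≤ <-≤-trans ≤-<-trans

  <-by : ∀ {x y} e → 0ℝ < e → x + e ≈ y → x < y
  <-by {x} {y} e 0<e eq = ≰⇒> λ y≤x → <⇒≱ 0<e
    (≤-by (x - y) (≤-gap y≤x) (≈-trans (+-cong (≈-refl {e}) (+-cong (≈-refl {x}) (neg-cong (≈-sym eq))))
      (solve 2 (λ x e → e :+ (x :- (x :+ e)) := κ 0) ≈-refl x e)))

  <-gap : ∀ {x y} → x < y → 0ℝ < y - x
  <-gap {x} {y} x<y = ≰⇒> λ h → <⇒≱ x<y
    (≤-by (0ℝ - (y - x)) (≤-gap h) (solve 2 (λ x y → y :+ (κ 0 :- (y :- x)) := x) ≈-refl x y))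

  +-pos : ∀ {x y} → 0ℝ < x → 0ℝ ≤ y → 0ℝ < x + y
  +-pos {x} {y} 0<x 0≤y = <-≤-trans 0<x (≤-by y 0≤y ≈-refl)

  *-monoˡ-≤ : ∀ {x y} z → 0ℝ ≤ z → x ≤ y → z * x ≤ z * y
  *-monoˡ-≤ {x} {y} z 0≤z x≤y = ≤-by (z * (y - x)) (*-nonneg 0≤z (≤-gap x≤y))
    (solve 3 (λ x y z → z :* x :+ z :* (y :- x) := z :* y) ≈-refl x y z)

  *-monoʳ-≤ : ∀ {x y} z → 0ℝ ≤ z → x ≤ y → x * z ≤ y * z
  *-monoʳ-≤ {x} {y} z 0≤z x≤y = ≤-by ((y - x) * z) (*-nonneg (≤-gap x≤y) 0≤z)
    (solve 3 (λ x y z → x :* z :+ (y :- x) :* z := y :* z) ≈-refl x y z)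

  *-mono-≤ : ∀ {x y u v} → 0ℝ ≤ u → 0ℝ ≤ y → x ≤ y → u ≤ v → x * u ≤ y * v
  *-mono-≤ {x} {y} {u} {v} 0≤u 0≤y x≤y u≤v = ≤-trans (*-monoʳ-≤ u 0≤u x≤y) (*-monoˡ-≤ y 0≤y u≤v)

  *-cancelˡ-≤ : ∀ {x y} z → 0ℝ < z → z * x ≤ z * y → x ≤ y
  *-cancelˡ-≤ {x} {y} z 0<z h with ≤-or-> x y
  ... | inj₁ x≤y = x≤y
  ... | inj₂ y<x = contradiction h (<⇒≱ (<-by (z * (x - y)) (*-pos 0<z (<-gap y<x))
        (solve 3 (λ x y z → z :* y :+ z :* (x :- y) := z :* x) ≈-refl x y z)))

  *-cancelˡ-≈ : ∀ {x y} z → 0ℝ < z → z * x ≈ z * y → x ≈ y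
  *-cancelˡ-≈ z 0<z (p , q) = *-cancelˡ-≤ z 0<z p , *-cancelˡ-≤ z 0<z q

  0<1 : 0ℝ < 1ℝ
  0<1 = fromℕ-mono-< {0} {1} (s≤s z≤n)

  ∣∣-≤⁺ : ∀ {x y} → ∣ x ∣ ≤ y → x ≤ y
  ∣∣-≤⁺ {x} h = ≤-trans (x≤∣x∣ x) h

  ∣∣-≤⁻ : ∀ {x y} → ∣ x ∣ ≤ y → - x ≤ y
  ∣∣-≤⁻ {x} h = ≤-trans (-x≤∣x∣ x) h

  0≤∣x∣ : ∀ x → 0ℝ ≤ ∣ x ∣
  0≤∣x∣ x with ≤-total 0ℝ x
  ... | inj₁ 0≤x = ≤-trans 0≤x (x≤∣x∣ x)
  ... | inj₂ x≤0 = ≤-trans (≤-trans (proj₁ (solve 0 (κ 0 := :- κ 0) ≈-refl)) (neg-mono-≤ x≤0)) (-x≤∣x∣ x)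

  ∣∣-cong-≤ : ∀ {x y} → x ≈ y → ∣ x ∣ ≤ ∣ y ∣
  ∣∣-cong-≤ {x} {y} (p , q) = ∣∣-lub (≤-trans p (x≤∣x∣ y)) (≤-trans (neg-mono-≤ q) (-x≤∣x∣ y))

  -- The search counts upwards from 0; `d` is the distance from the current candidate to a known
  -- solution, which makes the recursion structural.
  least : (P : ℕ → Set) → ∃ P → ∃ λ n → P n × (∀ m → P m → n ℕ.≤ m)
  least P (n , p) = search n 0 (subst P (sym (ℕₚ.+-identityʳ n)) p) λ _ _ → z≤n
    where
    search : ∀ d n → P (d ℕ.+ n) → (∀ m → P m → n ℕ.≤ m) → ∃ λ n → P n × (∀ m → P m → n ℕ.≤ m)
    search zero n p below = n , p , below
    search (suc d) n p below with lem {P n}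
    ... | yes pn = n , pn , below
    ... | no ¬pn = search d (suc n) (subst P (sym (ℕₚ.+-suc d n)) p)
          λ m pm → ℕₚ.≤∧≢⇒< (below m pm) λ { refl → ¬pn pm }

  floor : ∀ {x} → 0ℝ ≤ x → ∃ λ n → (fromℕ n ≤ x) × (x < fromℕ (suc n))
  floor {x} 0≤x = pred-bound (least (λ n → x < fromℕ n) (archimedean x))
    where
    pred-bound : (∃ λ n → (x < fromℕ n) × (∀ m → x < fromℕ m → n ℕ.≤ m)) → ∃ λ n → (fromℕ n ≤ x) × (x < fromℕ (suc n))
    pred-bound (zero , x<0 , _) = contradiction 0≤x (<⇒≱ x<0)
    pred-bound (suc n , x<1+n , min) = n , below (≤-or-> (fromℕ n) x) , x<1+n
      where
      below : fromℕ n ≤ x ⊎ x < fromℕ n → fromℕ n ≤ x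
      below (inj₁ n≤x) = n≤x
      below (inj₂ x<n) = contradiction (min n x<n) ℕₚ.1+n≰n

-- Sums and limits

∑-cong : ∀ {n} {f g : Fin n → ℝ} → (∀ i → f i ≈ g i) → ∑ f ≈ ∑ g
∑-cong {zero} h = ≈-refl
∑-cong {suc n} h = +-cong (h zero) (∑-cong (h ∘ suc))

∑-mono-≤ : ∀ {n} {f g : Fin n → ℝ} → (∀ i → f i ≤ g i) → ∑ f ≤ ∑ g
∑-mono-≤ {zero} h = ≤-refl
∑-mono-≤ {suc n} h = +-mono-≤ (h zero) (∑-mono-≤ (h ∘ suc))

∑-nonneg : ∀ {n} {f : Fin n → ℝ} → (∀ i → 0ℝ ≤ f i) → 0ℝ ≤ ∑ f
∑-nonneg {zero} h = ≤-refl
∑-nonneg {suc n} h = +-nonneg (h zero) (∑-nonneg (h ∘ suc))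

∑-+ : ∀ {n} (f g : Fin n → ℝ) → ∑ (λ i → f i + g i) ≈ ∑ f + ∑ g
∑-+ {zero} f g = solve 0 (κ 0 := κ 0 :+ κ 0) ≈-refl
∑-+ {suc n} f g = ≈-trans (+-cong ≈-refl (∑-+ (f ∘ suc) (g ∘ suc)))
  (solve 4 (λ a b c d → (a :+ b) :+ (c :+ d) := (a :+ c) :+ (b :+ d)) ≈-refl
    (f zero) (g zero) (∑ (f ∘ suc)) (∑ (g ∘ suc)))

∑-*ˡ : ∀ {n} c (f : Fin n → ℝ) → ∑ (λ i → c * f i) ≈ c * ∑ f
∑-*ˡ {zero} c f = solve 1 (λ c → κ 0 := c :* κ 0) ≈-refl c
∑-*ˡ {suc n} c f = ≈-trans (+-cong ≈-refl (∑-*ˡ c (f ∘ suc)))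
  (solve 3 (λ c a b → c :* a :+ c :* b := c :* (a :+ b)) ≈-refl c (f zero) (∑ (f ∘ suc)))

∑-const : ∀ n c → ∑ {n} (λ _ → c) ≈ fromℕ n * c
∑-const zero c = solve 1 (λ c → κ 0 := κ 0 :* c) ≈-refl c
∑-const (suc n) c = ≈-trans (+-cong ≈-refl (∑-const n c))
  (≈-trans (solve 2 (λ c m → c :+ m :* c := (κ 1 :+ m) :* c) ≈-refl c (fromℕ n))
    (*-cong (≈-sym (fromℕ-suc n)) ≈-refl))

term≤∑ : ∀ {n} {f : Fin n → ℝ} → (∀ i → 0ℝ ≤ f i) → ∀ i → f i ≤ ∑ f
term≤∑ {suc n} {f} h zero = ≤-by (∑ (f ∘ suc)) (∑-nonneg (h ∘ suc)) ≈-refl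
term≤∑ {suc n} {f} h (suc i) = ≤-trans (term≤∑ (h ∘ suc) i)
  (≤-by (f zero) (h zero) (solve 2 (λ a b → b :+ a := a :+ b) ≈-refl (f zero) (∑ (f ∘ suc))))

∑< : (ℕ → ℝ) → ℕ → ℝ
∑< f zero    = 0ℝ
∑< f (suc n) = ∑< f n + f n

∑<-head : ∀ f n → ∑< f (suc n) ≈ f 0 + ∑< (f ∘ suc) n
∑<-head f zero = solve 1 (λ a → κ 0 :+ a := a :+ κ 0) ≈-refl (f 0)
∑<-head f (suc n) = ≈-trans (+-cong (∑<-head f n) ≈-refl)
  (solve 3 (λ a b c → a :+ b :+ c := a :+ (b :+ c)) ≈-refl (f 0) (∑< (f ∘ suc) n) (f (suc n)))

∑≈∑< : ∀ f n → ∑ {n} (λ i → f (toℕ i)) ≈ ∑< f n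
∑≈∑< f zero = ≈-refl
∑≈∑< f (suc n) = ≈-trans (+-cong ≈-refl (∑≈∑< (f ∘ suc) n)) (≈-sym (∑<-head f n))

∑<-cong : ∀ {f g} → (∀ n → f n ≈ g n) → ∀ n → ∑< f n ≈ ∑< g n
∑<-cong h zero = ≈-refl
∑<-cong h (suc n) = +-cong (∑<-cong h n) (h n)

∑<-nonneg : ∀ {f} → (∀ n → 0ℝ ≤ f n) → ∀ n → 0ℝ ≤ ∑< f n
∑<-nonneg h zero = ≤-refl
∑<-nonneg h (suc n) = +-nonneg (∑<-nonneg h n) (h n)

∑<-mono : ∀ {f} → (∀ n → 0ℝ ≤ f n) → ∀ m n → ∑< f n ≤ ∑< f (m ℕ.+ n)
∑<-mono h zero n = ≤-refl
∑<-mono {f} h (suc m) n = ≤-trans (∑<-mono h m n) (≤-by (f (m ℕ.+ n)) (h (m ℕ.+ n)) ≈-refl)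

-- Closeness as two one-sided, non-strict and hence linear inequalities, which the certificates of
-- `≤-by` can combine. `⟶⇒Lim` and `Lim⇒⟶` translate from and to the strict form with absolute
-- values.
record Near (ε x y : ℝ) : Set where
  constructor near
  field
    upper : x ≤ y + ε
    lower : y ≤ x + ε

near-sym : ∀ {ε x y} → Near ε x y → Near ε y x
near-sym (near p q) = near q p

near-trans : ∀ {δ ε x y z} → Near δ x y → Near ε y z → Near (δ + ε) x z
near-trans {δ} {ε} {x} {y} {z} (near p q) (near p′ q′) = near
  (≤-by ((y + δ - x) + (z + ε - y)) (+-nonneg (≤-gap p) (≤-gap p′))
    (solve 5 (λ x y z d e → x :+ ((y :+ d :- x) :+ (z :+ e :- y)) := z :+ (d :+ e)) ≈-refl x y z δ ε))
  (≤-by ((x + δ - y) + (y + ε - z)) (+-nonneg (≤-gap q) (≤-gap q′))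
    (solve 5 (λ x y z d e → z :+ ((x :+ d :- y) :+ (y :+ e :- z)) := x :+ (d :+ e)) ≈-refl x y z δ ε))

near-mono : ∀ {δ ε x y} → δ ≤ ε → Near δ x y → Near ε x y
near-mono {x = x} {y} h (near p q) = near (≤-trans p (+-mono-≤ (≤-refl {y}) h)) (≤-trans q (+-mono-≤ (≤-refl {x}) h))

near-cong : ∀ {ε x x′ y y′} → x ≈ x′ → y ≈ y′ → Near ε x y → Near ε x′ y′
near-cong {ε} (p , p′) (q , q′) (near h k) = near
  (≤-trans p′ (≤-trans h (+-mono-≤ q (≤-refl {ε})))) (≤-trans q′ (≤-trans k (+-mono-≤ p (≤-refl {ε}))))

near⇒∣∣ : ∀ {ε x y} → Near ε x y → ∣ x - y ∣ ≤ ε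
near⇒∣∣ {ε} {x} {y} (near p q) = ∣∣-lub
  (≤-by (y + ε - x) (≤-gap p) (solve 3 (λ x y e → x :- y :+ (y :+ e :- x) := e) ≈-refl x y ε))
  (≤-by (x + ε - y) (≤-gap q) (solve 3 (λ x y e → :- (x :- y) :+ (x :+ e :- y) := e) ≈-refl x y ε))

∣∣⇒near : ∀ {ε x y} → ∣ x - y ∣ ≤ ε → Near ε x y
∣∣⇒near {ε} {x} {y} h = near
  (≤-by (ε - (x - y)) (≤-gap (≤-trans (x≤∣x∣ (x - y)) h))
    (solve 3 (λ x y e → x :+ (e :- (x :- y)) := y :+ e) ≈-refl x y ε))
  (≤-by (ε - - (x - y)) (≤-gap (≤-trans (-x≤∣x∣ (x - y)) h))
    (solve 3 (λ x y e → y :+ (e :- :- (x :- y)) := x :+ e) ≈-refl x y ε))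

seq-near : ∀ x {p δ N} → (∀ n → N ℕ.≤ n → ℚ.∣ seq x n ℚ.- p ∣ ℚ.≤ δ) → Near (fromℚ δ) x (fromℚ p)
seq-near x {p} {δ} {N} h = near
  (mk≤ λ {ε} 0<ε → N , λ n N≤n → ℚₚ.≤-trans (Q.close⁺ {seq x n} {p} (h n N≤n)) (Q.≤-cert ε (ℚₚ.<⇒≤ 0<ε) refl))
  (mk≤ λ {ε} 0<ε → N , λ n N≤n → ℚₚ.≤-trans (Q.close⁻ {seq x n} {p} (h n N≤n)) (Q.≤-cert ε (ℚₚ.<⇒≤ 0<ε) refl))

Lim : (ℕ → ℝ) → ℝ → Set
Lim s y = ∀ {ε} → 0ℝ < ε → ∃ λ N → ∀ n → N ℕ.≤ n → Near ε (s n) y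

½ʳ : ℝ
½ʳ = fromℚ ½

0≤½ : 0ℝ ≤ ½ʳ
0≤½ = fromℚ-mono-≤ (ℚₚ.nonNegative⁻¹ ½)

0<½ : 0ℝ < ½ʳ
0<½ = fromℚ-mono-< (ℚₚ.positive⁻¹ ½)

½-halves : ∀ ε → ½ʳ * ε + ½ʳ * ε ≈ ε
½-halves ε = solve 1 (λ e → con ½ :* e :+ con ½ :* e := e) ≈-refl ε

module Limits (lem : ExcludedMiddle 0ℓ) where
  open Order lem

  ½-pos : ∀ {ε} → 0ℝ < ε → 0ℝ < ½ʳ * ε
  ½-pos = *-pos 0<½

  ½ε<ε : ∀ {ε} → 0ℝ < ε → ½ʳ * ε < ε
  ½ε<ε {ε} 0<ε = <-by (½ʳ * ε) (½-pos 0<ε) (½-halves ε)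

  ⟶⇒Lim : ∀ {s y} → s ⟶ y → Lim s y
  ⟶⇒Lim h 0<ε = let (N , h′) = h 0<ε in N , λ n N≤n → ∣∣⇒near (<⇒≤ (h′ n N≤n))

  Lim⇒⟶ : ∀ {s y} → Lim s y → s ⟶ y
  Lim⇒⟶ h 0<ε = let (N , h′) = h (½-pos 0<ε) in N , λ n N≤n → ≤-<-trans (near⇒∣∣ (h′ n N≤n)) (½ε<ε 0<ε)

  ≤-up-to-εʳ : ∀ {x y} → (∀ {ε} → 0ℝ < ε → x ≤ y + ε) → x ≤ y
  ≤-up-to-εʳ h = ≤-up-to-ε λ 0<ε → h (fromℚ-mono-< 0<ε)

  Lim-≤ : ∀ {s t x y} K → (∀ n → K ℕ.≤ n → s n ≤ t n) → Lim s x → Lim t y → x ≤ y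
  Lim-≤ {s} {t} {x} {y} K s≤t sx ty = ≤-up-to-εʳ λ {ε} 0<ε →
    let (M , h) = sx (½-pos 0<ε) ; (N , k) = ty (½-pos 0<ε)
        n = M ℕ.⊔ N ℕ.⊔ K
        near _ p = h n (ℕₚ.≤-trans (ℕₚ.m≤m⊔n M N) (ℕₚ.m≤m⊔n (M ℕ.⊔ N) K))
        near q _ = k n (ℕₚ.≤-trans (ℕₚ.m≤n⊔m M N) (ℕₚ.m≤m⊔n (M ℕ.⊔ N) K))
        r = s≤t n (ℕₚ.m≤n⊔m (M ℕ.⊔ N) K)
    in ≤-by ((s n + ½ʳ * ε - x) + (t n - s n) + (y + ½ʳ * ε - t n))
         (+-nonneg (+-nonneg (≤-gap p) (≤-gap r)) (≤-gap q))
         (solve 5 (λ x y s t e → x :+ ((s :+ con ½ :* e :- x) :+ (t :- s) :+ (y :+ con ½ :* e :- t)) := y :+ e)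
           ≈-refl x y (s n) (t n) ε)

  Lim-unique : ∀ {s t x y} → (∀ n → s n ≈ t n) → Lim s x → Lim t y → x ≈ y
  Lim-unique h sx ty = Lim-≤ 0 (λ n _ → proj₁ (h n)) sx ty , Lim-≤ 0 (λ n _ → proj₂ (h n)) ty sx

  Lim-const : ∀ c → Lim (λ _ → c) c
  Lim-const c {ε} 0<ε = 0 , λ _ _ → near (≤-by ε (<⇒≤ 0<ε) ≈-refl) (≤-by ε (<⇒≤ 0<ε) ≈-refl)

  -- Each `s n` is replaced by a rational within 1/(n + 1). These rationals inherit the Cauchy
  -- property, with three errors of ε/4, and are themselves the representing sequence of the limit.
  complete : ∀ s → (∀ {ε} → 0ℝ < ε → ∃ λ N → ∀ m n → N ℕ.≤ m → N ℕ.≤ n → Near ε (s m) (s n)) → ∃ (Lim s)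
  complete s s-cauchy = y , s-lim
    where
    r : ℕ → ℚ
    r n = proj₁ (Q.recip-suc n)
    0<r : ∀ n → 0ℚ ℚ.< r n
    0<r n = proj₁ (proj₂ (Q.recip-suc n))
    q : ℕ → ℚ
    q n = proj₁ (∃-close-rational (s n) (0<r n))
    s-near-q : ∀ n → Near (fromℚ (r n)) (s n) (fromℚ (q n))
    s-near-q n = let (_ , h , k) = ∃-close-rational (s n) (0<r n) in near h k
    s-near-q′ : ∀ {δ} → 0ℚ ℚ.< δ → ∃ λ N → ∀ n → N ℕ.≤ n → Near (fromℚ δ) (s n) (fromℚ (q n))
    s-near-q′ 0<δ = let (N , h) = Q.recip-suc-small 0<δ in
      N , λ n N≤n → near-mono (fromℚ-mono-≤ (h n N≤n)) (s-near-q n)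
    near-fromℚ : ∀ {δ a b} → Near (fromℚ δ) (fromℚ a) (fromℚ b) → ℚ.∣ a ℚ.- b ∣ ℚ.≤ δ
    near-fromℚ {δ} {a} {b} (near h k) = Q.≤⇒close
      (fromℚ-cancel-≤ (≤-trans h (≤-pointwise λ _ → ℚₚ.≤-refl)))
      (fromℚ-cancel-≤ (≤-trans k (≤-pointwise λ _ → ℚₚ.≤-refl)))
    q-cauchy : IsCauchy q
    q-cauchy {ε} 0<ε =
      let 0<δ = Q.½-pos (Q.½-pos 0<ε)
          (M , h) = s-cauchy (fromℚ-mono-< 0<δ)
          (N , k) = s-near-q′ 0<δ
      in M ℕ.⊔ N , λ m n hm hn → near-fromℚ (near-mono
           (fromℚ-mono-≤ {½ ℚ.* (½ ℚ.* ε) ℚ.+ ½ ℚ.* (½ ℚ.* ε) ℚ.+ ½ ℚ.* (½ ℚ.* ε)}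
             (Q.≤-cert (½ ℚ.* (½ ℚ.* ε)) (ℚₚ.<⇒≤ 0<δ)
             (ℚS.solve 1 (λ e → let d = ℚS.con ½ ℚS.:* (ℚS.con ½ ℚS.:* e) in d ℚS.:+ d ℚS.:+ d ℚS.:+ d ℚS.:= e) refl ε)))
           (near-mono (≤-pointwise λ _ → ℚₚ.≤-refl)
             (near-trans (near-trans (near-sym (k m (ℕₚ.m⊔n≤o⇒n≤o M N hm)))
               (h m n (ℕₚ.m⊔n≤o⇒m≤o M N hm) (ℕₚ.m⊔n≤o⇒m≤o M N hn))) (k n (ℕₚ.m⊔n≤o⇒n≤o M N hn)))))
    y : ℝ
    y = mkℝ q q-cauchy
    s-lim : Lim s y
    s-lim {ε} 0<ε =
      let (δ , 0<δ , δ≤ε) = rational-below 0<ε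
          (M , h) = q-cauchy (Q.½-pos 0<δ)
          (N , k) = s-near-q′ (Q.½-pos 0<δ)
      in M ℕ.⊔ N , λ n hn → near-mono δ≤ε (near-mono
           (≤-pointwise λ _ → ℚₚ.≤-reflexive (Q.halves δ))
           (near-trans (k n (ℕₚ.m⊔n≤o⇒n≤o M N hn))
             (near-sym (seq-near y λ m hm → h m n hm (ℕₚ.m⊔n≤o⇒m≤o M N hn)))))

-- The exponential series

≈⇒≤ : ∀ {x y} → x ≈ y → x ≤ y
≈⇒≤ = proj₁

-- The index is shifted: this is 1/(n + 1). It is rational, so no appeal to the classical `÷` is
-- made.
recip : ℕ → ℝ
recip n = fromℚ (proj₁ (Q.recip-suc n))

recip-inverse : ∀ n → fromℕ (suc n) * recip n ≈ 1ℝ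
recip-inverse n = ≈-pointwise λ _ → proj₂ (proj₂ (Q.recip-suc n))

recip-pos : ∀ n → 0ℝ < recip n
recip-pos n = fromℚ-mono-< (proj₁ (proj₂ (Q.recip-suc n)))

-- The term xⁿ/n!, in recursive form so that the differential equation of exp becomes the recurrence
-- `expTerm-suc`.
expTerm : ℝ → ℕ → ℝ
expTerm x zero    = 1ℝ
expTerm x (suc n) = x * expTerm x n * recip n

expTerm-suc : ∀ x n → fromℕ (suc n) * expTerm x (suc n) ≈ x * expTerm x n
expTerm-suc x n = ≈-trans
  (solve 4 (λ m x a r → m :* (x :* a :* r) := (m :* r) :* (x :* a)) ≈-refl (fromℕ (suc n)) x (expTerm x n) (recip n))
  (≈-trans (*-cong (recip-inverse n) ≈-refl) (solve 1 (λ a → κ 1 :* a := a) ≈-refl (x * expTerm x n)))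

expTerm-cong : ∀ {x y} → x ≈ y → ∀ n → expTerm x n ≈ expTerm y n
expTerm-cong h zero = ≈-refl
expTerm-cong h (suc n) = *-cong (*-cong h (expTerm-cong h n)) ≈-refl

expTerm-nonneg : ∀ {x} → 0ℝ ≤ x → ∀ n → 0ℝ ≤ expTerm x n
expTerm-nonneg h zero = fromℕ-nonneg 1
expTerm-nonneg h (suc n) = *-nonneg (*-nonneg h (expTerm-nonneg h n)) (<⇒≤ (recip-pos n))

-- Coefficients of the product of the power series Σ aₙtⁿ and Σ bₙtⁿ.
conv : (ℕ → ℝ) → (ℕ → ℝ) → ℕ → ℝ
conv a b zero    = a 0 * b 0
conv a b (suc n) = a 0 * b (suc n) + conv (a ∘ suc) b n

conv-cong : ∀ {a a′ b b′} → (∀ n → a n ≈ a′ n) → (∀ n → b n ≈ b′ n) → ∀ n → conv a b n ≈ conv a′ b′ n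
conv-cong h k zero = *-cong (h 0) (k 0)
conv-cong h k (suc n) = +-cong (*-cong (h 0) (k (suc n))) (conv-cong (h ∘ suc) k n)

conv-+ˡ : ∀ a a′ b n → conv (λ i → a i + a′ i) b n ≈ conv a b n + conv a′ b n
conv-+ˡ a a′ b zero = solve 3 (λ a a′ b → (a :+ a′) :* b := a :* b :+ a′ :* b) ≈-refl (a 0) (a′ 0) (b 0)
conv-+ˡ a a′ b (suc n) = ≈-trans (+-cong ≈-refl (conv-+ˡ (a ∘ suc) (a′ ∘ suc) b n))
  (solve 5 (λ a a′ b c d → (a :+ a′) :* b :+ (c :+ d) := (a :* b :+ c) :+ (a′ :* b :+ d)) ≈-refl
    (a 0) (a′ 0) (b (suc n)) (conv (a ∘ suc) b n) (conv (a′ ∘ suc) b n))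

conv-*ˡ : ∀ c a b n → conv (λ i → c * a i) b n ≈ c * conv a b n
conv-*ˡ c a b zero = solve 3 (λ a b c → c :* a :* b := c :* (a :* b)) ≈-refl (a 0) (b 0) c
conv-*ˡ c a b (suc n) = ≈-trans (+-cong ≈-refl (conv-*ˡ c (a ∘ suc) b n))
  (solve 4 (λ a b c d → c :* a :* b :+ c :* d := c :* (a :* b :+ d)) ≈-refl (a 0) (b (suc n)) c (conv (a ∘ suc) b n))

conv-*ʳ : ∀ c a b n → conv a (λ i → c * b i) n ≈ c * conv a b n
conv-*ʳ c a b zero = solve 3 (λ a b c → a :* (c :* b) := c :* (a :* b)) ≈-refl (a 0) (b 0) c
conv-*ʳ c a b (suc n) = ≈-trans (+-cong ≈-refl (conv-*ʳ c (a ∘ suc) b n))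
  (solve 4 (λ a b c d → a :* (c :* b) :+ c :* d := c :* (a :* b :+ d)) ≈-refl (a 0) (b (suc n)) c (conv (a ∘ suc) b n))

conv-snoc : ∀ a b n → conv a b (suc n) ≈ conv a (b ∘ suc) n + a (suc n) * b 0
conv-snoc a b zero = ≈-refl
conv-snoc a b (suc n) = ≈-trans (+-cong ≈-refl (conv-snoc (a ∘ suc) b n))
  (solve 3 (λ x y z → x :+ (y :+ z) := x :+ y :+ z) ≈-refl
    (a 0 * b (suc (suc n))) (conv (a ∘ suc) (b ∘ suc) n) (a (suc (suc n)) * b 0))

-- The Euler operator t d/dt on power series; it is a derivation, which is what `conv-leibniz`
-- records.
deriv : (ℕ → ℝ) → ℕ → ℝ
deriv a n = fromℕ n * a n

conv-leibniz : ∀ a b n → fromℕ n * conv a b n ≈ conv (deriv a) b n + conv a (deriv b) n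
conv-leibniz a b zero = solve 2 (λ a b → κ 0 :* (a :* b) := (κ 0 :* a) :* b :+ a :* (κ 0 :* b)) ≈-refl (a 0) (b 0)
conv-leibniz a b (suc n) = ≈-trans (*-cong (fromℕ-suc n) ≈-refl) (≈-trans
  (solve 4 (λ m a b c → (κ 1 :+ m) :* (a :* b :+ c) := (κ 1 :+ m) :* (a :* b) :+ (c :+ m :* c)) ≈-refl
    (fromℕ n) (a 0) (b (suc n)) (conv (a ∘ suc) b n))
  (≈-trans (+-cong (*-cong (≈-sym (fromℕ-suc n)) ≈-refl) (+-cong ≈-refl (conv-leibniz (a ∘ suc) b n)))
  (≈-trans (solve 6 (λ m a b c d e → m :* (a :* b) :+ (c :+ (d :+ e)) := (κ 0 :* a :* b :+ (c :+ d)) :+ (a :* (m :* b) :+ e)) ≈-refl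
    (fromℕ (suc n)) (a 0) (b (suc n)) (conv (a ∘ suc) b n) (conv (deriv (a ∘ suc)) b n) (conv (a ∘ suc) (deriv b) n))
  (+-cong (+-cong ≈-refl (≈-trans (≈-sym (conv-+ˡ (a ∘ suc) (deriv (a ∘ suc)) b n)) (conv-cong shift (λ _ → ≈-refl) n))) ≈-refl))))
  where
  shift : ∀ i → a (suc i) + deriv (a ∘ suc) i ≈ deriv a (suc i)
  shift i = ≈-trans (solve 2 (λ a m → a :+ m :* a := (κ 1 :+ m) :* a) ≈-refl (a (suc i)) (fromℕ i))
    (*-cong (≈-sym (fromℕ-suc i)) ≈-refl)

fromℕ-suc-cancel : ∀ n {x y} → fromℕ (suc n) * x ≈ fromℕ (suc n) * y → x ≈ y
fromℕ-suc-cancel n {x} {y} h = ≈-trans (≈-sym (undo x)) (≈-trans (*-cong ≈-refl h) (undo y))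
  where
  undo : ∀ z → recip n * (fromℕ (suc n) * z) ≈ z
  undo z = ≈-trans (solve 3 (λ r m z → r :* (m :* z) := (m :* r) :* z) ≈-refl (recip n) (fromℕ (suc n)) z)
    (≈-trans (*-cong (recip-inverse n) ≈-refl) (solve 1 (λ z → κ 1 :* z := z) ≈-refl z))

-- The binomial theorem without binomial coefficients: by the Leibniz rule the convolution satisfies
-- (n + 1)cₙ₊₁ = (x + y)cₙ, the recurrence that determines the right-hand side.
conv-expTerm : ∀ x y n → conv (expTerm x) (expTerm y) n ≈ expTerm (x + y) n
conv-expTerm x y zero = solve 0 (κ 1 :* κ 1 := κ 1) ≈-refl
conv-expTerm x y (suc n) = fromℕ-suc-cancel n
  (≈-trans (conv-leibniz a b (suc n))
  (≈-trans (+-cong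
    (≈-trans (+-cong ≈-refl (≈-trans (conv-cong (expTerm-suc x) (λ _ → ≈-refl) n) (conv-*ˡ x a b n)))
      (solve 3 (λ c p q → κ 0 :* c :* p :+ q := q) ≈-refl (a 0) (b (suc n)) (x * conv a b n)))
    (≈-trans (conv-snoc a (deriv b) n)
    (≈-trans (+-cong (≈-trans (conv-cong (λ _ → ≈-refl) (expTerm-suc y) n) (conv-*ʳ y a b n)) ≈-refl)
      (solve 3 (λ c p q → q :+ p :* (κ 0 :* c) := q) ≈-refl (b 0) (a (suc n)) (y * conv a b n)))))
  (≈-trans (solve 3 (λ x y c → x :* c :+ y :* c := (x :+ y) :* c) ≈-refl x y (conv a b n))
  (≈-trans (*-cong ≈-refl (conv-expTerm x y n)) (≈-sym (expTerm-suc (x + y) n))))))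
  where
  a = expTerm x
  b = expTerm y

∑<-conv-suc : ∀ a b n → ∑< (conv a b) (suc n) ≈ a 0 * ∑< b (suc n) + ∑< (conv (a ∘ suc) b) n
∑<-conv-suc a b zero = solve 2 (λ a b → κ 0 :+ a :* b := a :* (κ 0 :+ b) :+ κ 0) ≈-refl (a 0) (b 0)
∑<-conv-suc a b (suc n) = ≈-trans (+-cong (∑<-conv-suc a b n) ≈-refl)
  (solve 5 (λ a s b c d → a :* s :+ c :+ (a :* b :+ d) := a :* (s :+ b) :+ (c :+ d)) ≈-refl
    (a 0) (∑< b (suc n)) (b (suc n)) (∑< (conv (a ∘ suc) b) n) (conv (a ∘ suc) b n))

-- The sum of aᵢbⱼ over i, j < n with i + j ≥ n.
corner : (ℕ → ℝ) → (ℕ → ℝ) → ℕ → ℝ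
corner a b zero    = 0ℝ
corner a b (suc n) = ∑< (a ∘ suc) n * b n + corner (a ∘ suc) b n

∑<-*-∑< : ∀ a b n → ∑< a n * ∑< b n ≈ ∑< (conv a b) n + corner a b n
∑<-*-∑< a b zero = solve 0 (κ 0 :* κ 0 := κ 0 :+ κ 0) ≈-refl
∑<-*-∑< a b (suc n) = ≈-trans (*-cong (∑<-head a n) ≈-refl) (≈-trans
  (solve 4 (λ a s b c → (a :+ s) :* (b :+ c) := a :* (b :+ c) :+ (s :* c :+ s :* b)) ≈-refl
    (a 0) (∑< (a ∘ suc) n) (∑< b n) (b n))
  (≈-trans (+-cong ≈-refl (+-cong ≈-refl (∑<-*-∑< (a ∘ suc) b n)))
  (≈-trans (solve 4 (λ p q r s → p :+ (q :+ (r :+ s)) := (p :+ r) :+ (q :+ s)) ≈-refl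
    (a 0 * ∑< b (suc n)) (∑< (a ∘ suc) n * b n) (∑< (conv (a ∘ suc) b) n) (corner (a ∘ suc) b n))
  (+-cong (≈-sym (∑<-conv-suc a b n)) ≈-refl))))

-- A case distinction on signs is avoided by XY - xy = ½((X - x)(Y + y) + (X + x)(Y - y)) and the
-- analogous identity for XY + xy.
∣∣-* : ∀ {x y X Y} → ∣ x ∣ ≤ X → ∣ y ∣ ≤ Y → ∣ x * y ∣ ≤ X * Y
∣∣-* {x} {y} {X} {Y} p q = ∣∣-lub
  (≤-by (½ʳ * ((X - x) * (Y - - y) + (X - - x) * (Y - y)))
    (*-nonneg 0≤½ (+-nonneg (*-nonneg X-x Y+y) (*-nonneg X+x Y-y)))
    (solve 4 (λ x y X Y → x :* y :+ con ½ :* ((X :- x) :* (Y :- :- y) :+ (X :- :- x) :* (Y :- y)) := X :* Y) ≈-refl x y X Y))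
  (≤-by (½ʳ * ((X - x) * (Y - y) + (X - - x) * (Y - - y)))
    (*-nonneg 0≤½ (+-nonneg (*-nonneg X-x Y-y) (*-nonneg X+x Y+y)))
    (solve 4 (λ x y X Y → :- (x :* y) :+ con ½ :* ((X :- x) :* (Y :- y) :+ (X :- :- x) :* (Y :- :- y)) := X :* Y) ≈-refl x y X Y))
  where
  X-x = ≤-gap (≤-trans (x≤∣x∣ x) p)
  X+x = ≤-gap (≤-trans (-x≤∣x∣ x) p)
  Y-y = ≤-gap (≤-trans (x≤∣x∣ y) q)
  Y+y = ≤-gap (≤-trans (-x≤∣x∣ y) q)

∣∣-+ : ∀ {x y X Y} → ∣ x ∣ ≤ X → ∣ y ∣ ≤ Y → ∣ x + y ∣ ≤ X + Y
∣∣-+ {x} {y} p q = ∣∣-lub (+-mono-≤ (≤-trans (x≤∣x∣ x) p) (≤-trans (x≤∣x∣ y) q))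
  (≤-trans (≈⇒≤ (solve 2 (λ x y → :- (x :+ y) := :- x :+ :- y) ≈-refl x y))
    (+-mono-≤ (≤-trans (-x≤∣x∣ x) p) (≤-trans (-x≤∣x∣ y) q)))

∣0∣≤0 : ∣ 0ℝ ∣ ≤ 0ℝ
∣0∣≤0 = ∣∣-lub ≤-refl (≈⇒≤ (solve 0 (:- κ 0 := κ 0) ≈-refl))

∣∣-nonneg : ∀ {x} → 0ℝ ≤ x → ∣ x ∣ ≤ x
∣∣-nonneg {x} h = ∣∣-lub ≤-refl (≤-by (x + x) (+-nonneg h h) (solve 1 (λ x → :- x :+ (x :+ x) := x) ≈-refl x))

∑<-∣∣ : ∀ {a α} → (∀ n → ∣ a n ∣ ≤ α n) → ∀ n → ∣ ∑< a n ∣ ≤ ∑< α n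
∑<-∣∣ h zero = ∣0∣≤0
∑<-∣∣ h (suc n) = ∣∣-+ (∑<-∣∣ h n) (h n)

corner-∣∣ : ∀ {a α b β} → (∀ n → ∣ a n ∣ ≤ α n) → (∀ n → ∣ b n ∣ ≤ β n) → ∀ n → ∣ corner a b n ∣ ≤ corner α β n
corner-∣∣ h k zero = ∣0∣≤0
corner-∣∣ h k (suc n) = ∣∣-+ (∣∣-* (∑<-∣∣ (h ∘ suc) n) (k n)) (corner-∣∣ (h ∘ suc) k n)

expTerm-∣∣ : ∀ {x X} → ∣ x ∣ ≤ X → ∀ n → ∣ expTerm x n ∣ ≤ expTerm X n
expTerm-∣∣ h zero = ∣∣-nonneg (fromℕ-nonneg 1)
expTerm-∣∣ h (suc n) = ∣∣-* (∣∣-* h (expTerm-∣∣ h n)) (∣∣-nonneg (<⇒≤ (recip-pos n)))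

module Exponential (lem : ExcludedMiddle 0ℓ) where
  open Order lem
  open Limits lem

  -- For nonnegative terms the m by n rectangle of products lies inside the triangle i + j < m + n.
  -- With m = n this bounds the `corner` by a tail of the Cauchy product.
  ∑<-product-≤ : ∀ {a b} → (∀ n → 0ℝ ≤ a n) → (∀ n → 0ℝ ≤ b n) →
                 ∀ m n → ∑< a m * ∑< b n ≤ ∑< (conv a b) (m ℕ.+ n)
  ∑<-product-≤ {a} {b} 0≤a 0≤b zero n = ≤-trans (≈⇒≤ (solve 1 (λ s → κ 0 :* s := κ 0) ≈-refl (∑< b n)))
    (∑<-nonneg (conv-nonneg 0≤a) n)
    where
    conv-nonneg : ∀ {a} → (∀ n → 0ℝ ≤ a n) → ∀ n → 0ℝ ≤ conv a b n
    conv-nonneg h zero = *-nonneg (h 0) (0≤b 0)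
    conv-nonneg h (suc n) = +-nonneg (*-nonneg (h 0) (0≤b (suc n))) (conv-nonneg (h ∘ suc) n)
  ∑<-product-≤ {a} {b} 0≤a 0≤b (suc m) n = ≤-trans (≈⇒≤ (*-cong (∑<-head a m) ≈-refl))
    (≤-trans (≈⇒≤ (solve 3 (λ a s t → (a :+ s) :* t := a :* t :+ s :* t) ≈-refl (a 0) (∑< (a ∘ suc) m) (∑< b n)))
    (≤-trans (+-mono-≤ (*-monoˡ-≤ (a 0) (0≤a 0) (∑<-mono 0≤b (suc m) n)) (∑<-product-≤ (0≤a ∘ suc) 0≤b m n))
      (≈⇒≤ (≈-sym (∑<-conv-suc a b (m ℕ.+ n))))))

  archimedean-* : ∀ x {ε} → 0ℝ < ε → ∃ λ n → x ≤ fromℕ n * ε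
  archimedean-* x {ε} 0<ε =
    let (δ , 0<δ , δ≤ε) = rational-below 0<ε
        (r , 0<r , δr≡1) = Q.divide 0<δ (ℚₚ.positive⁻¹ 1ℚ)
        (A , x<A) = archimedean x
        (B , r≤B) = Q.archimedean r
    in A ℕ.* B , ≤-trans (<⇒≤ x<A) (≤-trans (≈⇒≤ (solve 1 (λ a → a := a :* κ 1) ≈-refl (fromℕ A)))
      (≤-trans (*-monoˡ-≤ (fromℕ A) (fromℕ-nonneg A)
        (≤-trans (≈⇒≤ (≈-pointwise λ _ → trans (sym δr≡1) (ℚₚ.*-comm δ r)))
          (*-mono-≤ {fromℚ r} {fromℕ B} {fromℚ δ} {ε} (fromℚ-mono-≤ (ℚₚ.<⇒≤ 0<δ)) (fromℕ-nonneg B) (fromℚ-mono-≤ r≤B) δ≤ε)))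
        (≈⇒≤ (≈-trans (solve 3 (λ a b e → a :* (b :* e) := a :* b :* e) ≈-refl (fromℕ A) (fromℕ B) ε)
          (*-cong (≈-sym (fromℕ-* A B)) ≈-refl)))))

  fromℕ-suc-pos : ∀ n → 0ℝ < fromℕ (suc n)
  fromℕ-suc-pos n = fromℕ-mono-< {0} {suc n} (s≤s z≤n)

  recip≤1 : ∀ n → recip n ≤ 1ℝ
  recip≤1 n = ≤-by (fromℕ n * recip n) (*-nonneg (fromℕ-nonneg n) (<⇒≤ (recip-pos n)))
    (≈-trans (solve 2 (λ m r → r :+ m :* r := (κ 1 :+ m) :* r) ≈-refl (fromℕ n) (recip n))
      (≈-trans (*-cong (≈-sym (fromℕ-suc n)) ≈-refl) (recip-inverse n)))

  recip-≤ : ∀ {x ε} n → x ≤ fromℕ (suc n) * ε → recip n * x ≤ ε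
  recip-≤ {x} {ε} n h = ≤-trans (*-monoˡ-≤ (recip n) (<⇒≤ (recip-pos n)) h)
    (≈⇒≤ (≈-trans (solve 3 (λ r m e → r :* (m :* e) := m :* r :* e) ≈-refl (recip n) (fromℕ (suc n)) ε)
      (≈-trans (*-cong (recip-inverse n) ≈-refl) (solve 1 (λ e → κ 1 :* e := e) ≈-refl ε))))

  Lim-* : ∀ {s t x y} → Lim s x → Lim t y → Lim (λ n → s n * t n) (x * y)
  Lim-* {s} {t} {x} {y} sx ty {ε} 0<ε = M ℕ.⊔ N , λ n hn →
    let sn = near⇒∣∣ (proj₂ (sx (recip-pos p)) n (ℕₚ.m⊔n≤o⇒m≤o M N hn))
        tn = near⇒∣∣ (proj₂ (ty (recip-pos p)) n (ℕₚ.m⊔n≤o⇒n≤o M N hn))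
    in ∣∣⇒near (≤-trans (∣∣-cong-≤
         (solve 4 (λ s t x y → s :* t :- x :* y := (s :- x) :* (t :- y :+ y) :+ x :* (t :- y)) ≈-refl (s n) (t n) x y))
       (≤-trans (∣∣-+ (∣∣-* sn (∣∣-+ (≤-trans tn (recip≤1 p)) (≤-refl {∣ y ∣}))) (∣∣-* (≤-refl {∣ x ∣}) tn))
       (≤-trans (≈⇒≤ (solve 3 (λ r x y → r :* (κ 1 :+ y) :+ x :* r := r :* (κ 1 :+ y :+ x)) ≈-refl (recip p) ∣ x ∣ ∣ y ∣))
         (recip-≤ p (≤-trans C≤pε (*-monoʳ-≤ ε (<⇒≤ 0<ε) (fromℕ-mono-≤ (ℕₚ.n≤1+n p))))))))
    where
    C = 1ℝ + ∣ y ∣ + ∣ x ∣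
    p = proj₁ (archimedean-* C 0<ε)
    C≤pε : C ≤ fromℕ p * ε
    C≤pε = proj₂ (archimedean-* C 0<ε)
    M = proj₁ (sx (recip-pos p))
    N = proj₁ (ty (recip-pos p))

  expTerm-halves : ∀ {X K} → 0ℝ ≤ X → fromℕ 2 * X ≤ fromℕ K → ∀ n → K ℕ.≤ n →
                   fromℕ 2 * expTerm X (suc n) ≤ expTerm X n
  expTerm-halves {X} {K} 0≤X 2X≤K n K≤n = ≤-trans
    (≈⇒≤ (solve 3 (λ x e r → κ 2 :* (x :* e :* r) := r :* (κ 2 :* x) :* e) ≈-refl X (expTerm X n) (recip n)))
    (≤-trans (*-monoʳ-≤ (expTerm X n) (expTerm-nonneg 0≤X n)
      (recip-≤ n (≤-trans 2X≤K (≤-trans (fromℕ-mono-≤ (ℕₚ.≤-trans K≤n (ℕₚ.n≤1+n n)))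
        (≈⇒≤ (solve 1 (λ m → m := m :* κ 1) ≈-refl (fromℕ (suc n))))))))
      (≈⇒≤ (solve 1 (λ e → κ 1 :* e := e) ≈-refl (expTerm X n))))

  expTerm-small : ∀ {X} → 0ℝ ≤ X → ∀ {ε} → 0ℝ < ε → ∃ λ N → ∀ n → N ℕ.≤ n → fromℕ 2 * expTerm X n ≤ ε
  expTerm-small {X} 0≤X {ε} 0<ε = suc (K ℕ.+ J) , λ where
      (suc n) (s≤s h) → let j = n ℕ.∸ K ; K≤n = ℕₚ.m+n≤o⇒m≤o K h in
        ≤-trans (expTerm-halves 0≤X 2X≤K n K≤n)
          (subst (λ i → expTerm X i ≤ ε) (ℕₚ.m∸n+n≡m K≤n)
            (*-cancelˡ-≤ (fromℕ (suc j)) (fromℕ-suc-pos j)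
              (≤-trans (decay j) (≤-trans eK≤Jε (*-monoʳ-≤ ε (<⇒≤ 0<ε)
                (fromℕ-mono-≤ (ℕₚ.≤-trans (ℕₚ.m+n≤o⇒m≤o∸n J (subst (ℕ._≤ n) (ℕₚ.+-comm K J) h)) (ℕₚ.n≤1+n j))))))))
    where
    K = proj₁ (archimedean (fromℕ 2 * X))
    2X≤K = <⇒≤ (proj₂ (archimedean (fromℕ 2 * X)))
    J = proj₁ (archimedean-* (expTerm X K) 0<ε)
    eK≤Jε = proj₂ (archimedean-* (expTerm X K) 0<ε)
    -- Halving would give a factor 2⁻ʲ; the weaker 1/(j + 1) is enough and follows by induction from
    -- j + 2 ≤ 2(j + 1).
    decay : ∀ j → fromℕ (suc j) * expTerm X (j ℕ.+ K) ≤ expTerm X K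
    decay zero = ≈⇒≤ (solve 1 (λ e → κ 1 :* e := e) ≈-refl (expTerm X K))
    decay (suc j) = ≤-trans
      (≤-by (fromℕ j * expTerm X (suc (j ℕ.+ K))) (*-nonneg (fromℕ-nonneg j) (expTerm-nonneg 0≤X (suc (j ℕ.+ K))))
        (≈-trans (+-cong (*-cong (≈-trans (fromℕ-suc (suc j)) (+-cong ≈-refl (fromℕ-suc j))) ≈-refl) ≈-refl)
        (≈-trans (solve 2 (λ m e → (κ 1 :+ (κ 1 :+ m)) :* e :+ m :* e := (κ 1 :+ m) :* (κ 2 :* e)) ≈-refl (fromℕ j) (expTerm X (suc (j ℕ.+ K))))
          (*-cong (≈-sym (fromℕ-suc j)) ≈-refl))))
      (≤-trans (*-monoˡ-≤ (fromℕ (suc j)) (fromℕ-nonneg (suc j)) (expTerm-halves 0≤X 2X≤K (j ℕ.+ K) (ℕₚ.m≤n+m K j)))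
        (decay j))

  -- Past K the majorant E at least halves, so each further term is bounded by the telescoping
  -- difference 2Eᵢ - 2Eᵢ₊₁. The induction `go` therefore keeps the subtracted term, which is
  -- dropped only at the end.
  expSum-tail : ∀ {x X K} → ∣ x ∣ ≤ X → 0ℝ ≤ X → fromℕ 2 * X ≤ fromℕ K → ∀ n → K ℕ.≤ n →
                ∀ d → Near (fromℕ 2 * expTerm X n) (∑< (expTerm x) (d ℕ.+ n)) (∑< (expTerm x) n)
  expSum-tail {x} {X} {K} x≤X 0≤X 2X≤K n K≤n d = near-mono
    (≤-by (fromℕ 2 * expTerm X (d ℕ.+ n)) (*-nonneg (fromℕ-nonneg 2) (expTerm-nonneg 0≤X (d ℕ.+ n)))
      (solve 2 (λ a b → a :- b :+ b := a) ≈-refl (fromℕ 2 * expTerm X n) (fromℕ 2 * expTerm X (d ℕ.+ n))))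
    (go d)
    where
    go : ∀ d → Near (fromℕ 2 * expTerm X n - fromℕ 2 * expTerm X (d ℕ.+ n)) (∑< (expTerm x) (d ℕ.+ n)) (∑< (expTerm x) n)
    go zero = let h = ≈⇒≤ (solve 2 (λ s e → s := s :+ (κ 2 :* e :- κ 2 :* e)) ≈-refl (∑< (expTerm x) n) (expTerm X n)) in near h h
    go (suc d) = near-mono
      (≤-by (E - fromℕ 2 * E′) (≤-gap (expTerm-halves 0≤X 2X≤K (d ℕ.+ n) (ℕₚ.≤-trans K≤n (ℕₚ.m≤n+m n d))))
        (solve 3 (λ a e e′ → e :+ (κ 2 :* a :- κ 2 :* e) :+ (e :- κ 2 :* e′) := κ 2 :* a :- κ 2 :* e′) ≈-refl (expTerm X n) E E′))
      (near-trans (∣∣⇒near (≤-trans (∣∣-cong-≤ (solve 2 (λ s e → s :+ e :- s := e) ≈-refl (∑< (expTerm x) (d ℕ.+ n)) (expTerm x (d ℕ.+ n))))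
        (expTerm-∣∣ x≤X (d ℕ.+ n)))) (go d))
      where
      E = expTerm X (d ℕ.+ n)
      E′ = expTerm X (suc d ℕ.+ n)

module ExpProperties (lem : ExcludedMiddle 0ℓ) where
  open Order lem
  open Limits lem
  open Classical lem
  open Exponential lem

  the-spec : ∀ P → ∃ P → P (the P)
  the-spec P h with lem {∃ P}
  ... | yes (_ , p) = p
  ... | no ¬h       = contradiction h ¬h

  expSum-Lim : ∀ x → ∃ (Lim (∑< (expTerm x)))
  expSum-Lim x = complete _ λ {ε} 0<ε →
    let (N , small) = expTerm-small (0≤∣x∣ x) 0<ε in
    N ℕ.⊔ K , λ m n hm hn → by-cases small m n hm hn (ℕₚ.≤-total m n)
    where
    K = proj₁ (archimedean (fromℕ 2 * ∣ x ∣))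
    tail = expSum-tail {x} ≤-refl (0≤∣x∣ x) (<⇒≤ (proj₂ (archimedean (fromℕ 2 * ∣ x ∣))))
    S = ∑< (expTerm x)
    ordered : ∀ {ε N} → (∀ n → N ℕ.≤ n → fromℕ 2 * expTerm ∣ x ∣ n ≤ ε) →
              ∀ m n → N ℕ.⊔ K ℕ.≤ m → m ℕ.≤ n → Near ε (S n) (S m)
    ordered {ε} {N} small m n hm m≤n = subst (λ n → Near ε (S n) (S m)) (ℕₚ.m∸n+n≡m m≤n)
      (near-mono (small m (ℕₚ.m⊔n≤o⇒m≤o N K hm)) (tail m (ℕₚ.m⊔n≤o⇒n≤o N K hm) (n ℕ.∸ m)))
    by-cases : ∀ {ε N} → (∀ n → N ℕ.≤ n → fromℕ 2 * expTerm ∣ x ∣ n ≤ ε) →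
               ∀ m n → N ℕ.⊔ K ℕ.≤ m → N ℕ.⊔ K ℕ.≤ n → m ℕ.≤ n ⊎ n ℕ.≤ m → Near ε (S m) (S n)
    by-cases small m n hm hn (inj₁ m≤n) = near-sym (ordered small m n hm m≤n)
    by-cases small m n hm hn (inj₂ n≤m) = ordered small n m hn n≤m

  !-pos : ∀ n → 0ℝ < fromℕ (n !)
  !-pos n = fromℕ-mono-< {0} {n !} (ℕₚ.1≤n! n)

  expTerm-! : ∀ x n → expTerm x n * fromℕ (n !) ≈ x ^ n
  expTerm-! x zero = solve 0 (κ 1 :* κ 1 := κ 1) ≈-refl
  expTerm-! x (suc n) = ≈-trans (*-cong ≈-refl (fromℕ-* (suc n) (n !)))
    (≈-trans (solve 5 (λ x e r m f → x :* e :* r :* (m :* f) := m :* r :* (x :* (e :* f))) ≈-refl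
      x (expTerm x n) (recip n) (fromℕ (suc n)) (fromℕ (n !)))
    (≈-trans (*-cong (recip-inverse n) (*-cong ≈-refl (expTerm-! x n)))
      (solve 1 (λ a → κ 1 :* a := a) ≈-refl (x * x ^ n))))

  ÷-≈ : ∀ {x y z} → 0ℝ < y → z * y ≈ x → x ÷ y ≈ z
  ÷-≈ {x} {y} {z} 0<y h = *-cancelˡ-≈ y 0<y (≈-trans (*-comm y (x ÷ y))
    (≈-trans (the-spec (λ z → z * y ≈ x) (z , h)) (≈-trans (≈-sym h) (*-comm z y))))

  exp-Lim : ∀ x → Lim (∑< (expTerm x)) (exp x)
  exp-Lim x = λ 0<ε → let (N , h) = ⟶⇒Lim (the-spec _ series-converges) 0<ε in
    N , λ n N≤n → near-cong (partial-≈ n) ≈-refl (h n N≤n)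
    where
    partial-≈ : ∀ N → ∑ {N} (λ i → x ^ toℕ i ÷ fromℕ (toℕ i !)) ≈ ∑< (expTerm x) N
    partial-≈ N = ≈-trans (∑-cong {N} λ i → ÷-≈ (!-pos (toℕ i)) (expTerm-! x (toℕ i))) (∑≈∑< (expTerm x) N)
    series-converges : ∃ λ y → (λ N → ∑ {N} λ i → x ^ toℕ i ÷ fromℕ (toℕ i !)) ⟶ y
    series-converges = let (y , h) = expSum-Lim x in
      y , Lim⇒⟶ λ 0<ε → let (N , h′) = h 0<ε in N , λ n N≤n → near-cong (≈-sym (partial-≈ n)) ≈-refl (h′ n N≤n)

  exp-cong : ∀ {x y} → x ≈ y → exp x ≈ exp y
  exp-cong {x} {y} h = Lim-unique (∑<-cong (expTerm-cong h)) (exp-Lim x) (exp-Lim y)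

  -- The product of the partial sums differs from the partial sum for x + y by the `corner`. Its
  -- absolute value is at most the corner for ∣x∣ and ∣y∣, which lies between the n-th and the 2n-th
  -- partial sums of the series at ∣x∣ + ∣y∣ and hence vanishes in the limit.
  exp-+ : ∀ x y → exp (x + y) ≈ exp x * exp y
  exp-+ x y = Lim-unique (λ _ → ≈-refl) product-Lim (Lim-* (exp-Lim x) (exp-Lim y))
    where
    X = ∣ x ∣ + ∣ y ∣
    0≤X : 0ℝ ≤ X
    0≤X = +-nonneg (0≤∣x∣ x) (0≤∣x∣ y)
    K = proj₁ (archimedean (fromℕ 2 * X))
    corner-small : ∀ n → K ℕ.≤ n → ∣ corner (expTerm x) (expTerm y) n ∣ ≤ fromℕ 2 * expTerm X n
    corner-small n K≤n = ≤-trans (corner-∣∣ (expTerm-∣∣ (≤-refl {∣ x ∣})) (expTerm-∣∣ (≤-refl {∣ y ∣})) n)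
      (≤-by ((∑< (expTerm X) n + fromℕ 2 * expTerm X n - ∑< (expTerm X) (n ℕ.+ n)) + (∑< (expTerm X) (n ℕ.+ n) - A * B))
        (+-nonneg (≤-gap (Near.upper (expSum-tail (∣∣-nonneg 0≤X) 0≤X (<⇒≤ (proj₂ (archimedean (fromℕ 2 * X)))) n K≤n n)))
          (≤-gap (≤-trans (∑<-product-≤ (expTerm-nonneg (0≤∣x∣ x)) (expTerm-nonneg (0≤∣x∣ y)) n n)
            (≈⇒≤ (∑<-cong (conv-expTerm ∣ x ∣ ∣ y ∣) (n ℕ.+ n))))))
        (≈-trans (+-cong ≈-refl (+-cong ≈-refl (+-cong ≈-refl (neg-cong
            (≈-trans (∑<-*-∑< (expTerm ∣ x ∣) (expTerm ∣ y ∣) n) (+-cong (∑<-cong (conv-expTerm ∣ x ∣ ∣ y ∣) n) ≈-refl))))))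
          (solve 4 (λ r s e t → r :+ ((s :+ e :- t) :+ (t :- (s :+ r))) := e) ≈-refl
            (corner (expTerm ∣ x ∣) (expTerm ∣ y ∣) n) (∑< (expTerm X) n) (fromℕ 2 * expTerm X n) (∑< (expTerm X) (n ℕ.+ n)))))
      where
      A = ∑< (expTerm ∣ x ∣) n
      B = ∑< (expTerm ∣ y ∣) n
    product-Lim : Lim (λ n → ∑< (expTerm x) n * ∑< (expTerm y) n) (exp (x + y))
    product-Lim {ε} 0<ε =
      let (M , small) = expTerm-small 0≤X (½-pos 0<ε)
          (N , h) = exp-Lim (x + y) (½-pos 0<ε)
      in (K ℕ.⊔ M) ℕ.⊔ N , λ n hn →
        let KM = ℕₚ.m⊔n≤o⇒m≤o (K ℕ.⊔ M) N hn in
        near-mono (≈⇒≤ (½-halves ε)) (near-trans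
          (∣∣⇒near (≤-trans (∣∣-cong-≤ (≈-trans
              (+-cong (≈-trans (∑<-*-∑< (expTerm x) (expTerm y) n) (+-cong (∑<-cong (conv-expTerm x y) n) ≈-refl)) ≈-refl)
              (solve 2 (λ s r → s :+ r :- s := r) ≈-refl (∑< (expTerm (x + y)) n) (corner (expTerm x) (expTerm y) n))))
            (≤-trans (corner-small n (ℕₚ.m⊔n≤o⇒m≤o K M KM)) (small n (ℕₚ.m⊔n≤o⇒n≤o K M KM)))))
          (h n (ℕₚ.m⊔n≤o⇒n≤o (K ℕ.⊔ M) N hn)))

  private
    1+x≤exp-nonneg : ∀ {x} → 0ℝ ≤ x → 1ℝ + x ≤ exp x
    1+x≤exp-nonneg {x} 0≤x = Lim-≤ 2 (λ where
        (suc (suc n)) (s≤s (s≤s _)) → ≤-trans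
          (≈⇒≤ (≈-trans (+-cong ≈-refl (≈-trans (solve 1 (λ x → x := κ 1 :* x) ≈-refl x)
                (*-cong (≈-sym (recip-inverse 0)) ≈-refl)))
            (solve 2 (λ x r → κ 1 :+ κ 1 :* r :* x := κ 0 :+ κ 1 :+ x :* κ 1 :* r) ≈-refl x (recip 0))))
          (subst (λ i → ∑< (expTerm x) 2 ≤ ∑< (expTerm x) i) (ℕₚ.+-comm n 2) (∑<-mono (expTerm-nonneg 0≤x) n 2)))
      (Lim-const (1ℝ + x)) (exp-Lim x)

    0≤x⇒1≤exp : ∀ {x} → 0ℝ ≤ x → 1ℝ ≤ exp x
    0≤x⇒1≤exp {x} 0≤x = ≤-trans (≤-by x 0≤x ≈-refl) (1+x≤exp-nonneg 0≤x)

    -- Multiplication of the partial sums by 1 - x telescopes: `partial-bound` passes from n to n +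
    -- 1 because 1/(n + 1) ≤ 1. Applied at -x and multiplied by exp x, this gives `1+x≤exp` for
    -- negative arguments.
    [1-x]exp≤1 : ∀ {x} → 0ℝ ≤ x → (1ℝ - x) * exp x ≤ 1ℝ
    [1-x]exp≤1 {x} 0≤x = Lim-≤ 0 (λ n _ → ≤-trans (partial-bound n)
        (≤-by (expTerm x n) (expTerm-nonneg 0≤x n) (solve 1 (λ e → κ 1 :- e :+ e := κ 1) ≈-refl (expTerm x n))))
      (Lim-* (Lim-const (1ℝ - x)) (exp-Lim x)) (Lim-const 1ℝ)
      where
      partial-bound : ∀ n → (1ℝ - x) * ∑< (expTerm x) n ≤ 1ℝ - expTerm x n
      partial-bound zero = ≈⇒≤ (solve 1 (λ x → (κ 1 :- x) :* κ 0 := κ 1 :- κ 1) ≈-refl x)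
      partial-bound (suc n) = ≤-by
        ((1ℝ - expTerm x n - (1ℝ - x) * ∑< (expTerm x) n) + x * expTerm x n * (1ℝ - recip n))
        (+-nonneg (≤-gap (partial-bound n)) (*-nonneg (*-nonneg 0≤x (expTerm-nonneg 0≤x n)) (≤-gap (recip≤1 n))))
        (solve 4 (λ x s e r → (κ 1 :- x) :* (s :+ e) :+ ((κ 1 :- e :- (κ 1 :- x) :* s) :+ x :* e :* (κ 1 :- r)) := κ 1 :- x :* e :* r)
          ≈-refl x (∑< (expTerm x) n) (expTerm x n) (recip n))

  exp-0 : exp 0ℝ ≈ 1ℝ
  exp-0 = *-cancelˡ-≈ (exp 0ℝ) (<-≤-trans 0<1 (0≤x⇒1≤exp ≤-refl))
    (≈-trans (≈-sym (exp-+ 0ℝ 0ℝ)) (≈-trans (exp-cong (solve 0 (κ 0 :+ κ 0 := κ 0) ≈-refl))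
      (solve 1 (λ a → a := a :* κ 1) ≈-refl (exp 0ℝ))))

  exp-neg : ∀ x → exp x * exp (- x) ≈ 1ℝ
  exp-neg x = ≈-trans (≈-sym (exp-+ x (- x)))
    (≈-trans (exp-cong (solve 1 (λ x → x :- x := κ 0) ≈-refl x)) exp-0)

  neg-nonneg : ∀ {x} → x ≤ 0ℝ → 0ℝ ≤ - x
  neg-nonneg {x} h = ≤-by (0ℝ - x) (≤-gap h) (solve 1 (λ x → κ 0 :+ (κ 0 :- x) := :- x) ≈-refl x)

  exp-pos : ∀ x → 0ℝ < exp x
  exp-pos x = by-sign (≤-total 0ℝ x)
    where
    by-sign : 0ℝ ≤ x ⊎ x ≤ 0ℝ → 0ℝ < exp x
    by-sign (inj₁ 0≤x) = <-≤-trans 0<1 (0≤x⇒1≤exp 0≤x)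
    by-sign (inj₂ x≤0) = ≰⇒> λ exp≤0 → <⇒≱ 0<1
      (≤-trans (proj₂ (exp-neg x)) (≤-by (- exp x * exp (- x))
        (*-nonneg (neg-nonneg exp≤0) (≤-trans (fromℕ-nonneg 1) (0≤x⇒1≤exp (neg-nonneg x≤0))))
        (solve 2 (λ a b → a :* b :+ :- a :* b := κ 0) ≈-refl (exp x) (exp (- x)))))

  exp-nonneg : ∀ x → 0ℝ ≤ exp x
  exp-nonneg x = <⇒≤ (exp-pos x)

  1+x≤exp : ∀ x → 1ℝ + x ≤ exp x
  1+x≤exp x = by-sign (≤-total 0ℝ x)
    where
    by-sign : 0ℝ ≤ x ⊎ x ≤ 0ℝ → 1ℝ + x ≤ exp x
    by-sign (inj₁ 0≤x) = 1+x≤exp-nonneg 0≤x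
    by-sign (inj₂ x≤0) = ≤-trans (≈⇒≤ (≈-trans (solve 1 (λ x → κ 1 :+ x := (κ 1 :- :- x) :* κ 1) ≈-refl x)
        (*-cong ≈-refl (≈-sym (exp-neg x)))))
      (≤-trans (≈⇒≤ (solve 3 (λ x a b → (κ 1 :- :- x) :* (a :* b) := a :* ((κ 1 :- :- x) :* b)) ≈-refl x (exp x) (exp (- x))))
        (≤-trans (*-monoˡ-≤ (exp x) (exp-nonneg x) ([1-x]exp≤1 (neg-nonneg x≤0)))
          (≈⇒≤ (solve 1 (λ a → a :* κ 1 := a) ≈-refl (exp x)))))

  exp-split : ∀ x y → exp y ≈ exp x * exp (y - x)
  exp-split x y = ≈-trans (exp-cong (solve 2 (λ x y → y := x :+ (y :- x)) ≈-refl x y)) (exp-+ x (y - x))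

  exp-mono-≤ : ∀ {x y} → x ≤ y → exp x ≤ exp y
  exp-mono-≤ {x} {y} h = ≤-trans (≈⇒≤ (solve 1 (λ a → a := a :* κ 1) ≈-refl (exp x)))
    (≤-trans (*-monoˡ-≤ (exp x) (exp-nonneg x) (0≤x⇒1≤exp (≤-gap h))) (proj₂ (exp-split x y)))

  exp-mono-< : ∀ {x y} → x < y → exp x < exp y
  exp-mono-< {x} {y} h = <-≤-trans
    (<-by (exp x * (y - x)) (*-pos (exp-pos x) (<-gap h))
      (solve 2 (λ a d → a :+ a :* d := a :* (κ 1 :+ d)) ≈-refl (exp x) (y - x)))
    (≤-trans (*-monoˡ-≤ (exp x) (exp-nonneg x) (1+x≤exp (y - x))) (proj₂ (exp-split x y)))

  exp-cancel-≤ : ∀ {x y} → exp x ≤ exp y → x ≤ y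
  exp-cancel-≤ {x} {y} h = by-order (≤-or-> x y)
    where
    by-order : x ≤ y ⊎ y < x → x ≤ y
    by-order (inj₁ x≤y) = x≤y
    by-order (inj₂ y<x) = contradiction h (<⇒≱ (exp-mono-< y<x))

  exp*[1-x]≤1 : ∀ x → exp x * (1ℝ - x) ≤ 1ℝ
  exp*[1-x]≤1 x = ≤-trans (*-monoˡ-≤ (exp x) (exp-nonneg x) (1+x≤exp (- x))) (≈⇒≤ (exp-neg x))

-- Logarithms, inverses and square roots

module Logarithm (lem : ExcludedMiddle 0ℓ) where
  open Order lem
  open Limits lem
  open Classical lem
  open Exponential lem
  open ExpProperties lem

  -- Solves exp y = z on the interval from -A to B, where 1 ≤ A z and z < B; the bound 1 + x ≤ exp x
  -- shows that z is bracketed. Continuity of exp enters only through `absorb`.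
  module Bisection {z : ℝ} (0<z : 0ℝ < z) where
    A = proj₁ (archimedean-* 1ℝ 0<z)
    B = proj₁ (archimedean z)

    width : ℕ → ℝ
    width zero    = fromℕ A + fromℕ B
    width (suc n) = ½ʳ * width n

    0≤width : ∀ n → 0ℝ ≤ width n
    0≤width zero = +-nonneg (fromℕ-nonneg A) (fromℕ-nonneg B)
    0≤width (suc n) = *-nonneg 0≤½ (0≤width n)

    record Bracket (n : ℕ) : Set where
      field
        left    : ℝ
        below   : exp left ≤ z
        above   : z < exp (left + width n)
    open Bracket

    initial : Bracket 0
    initial = record
      { left = - fromℕ A
      ; below = ≤-trans (≈⇒≤ (solve 1 (λ e → e := e :* κ 1) ≈-refl (exp (- fromℕ A))))
          (≤-trans (*-monoˡ-≤ (exp (- fromℕ A)) (exp-nonneg _) (proj₂ (archimedean-* 1ℝ 0<z)))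
          (≤-trans (*-monoˡ-≤ (exp (- fromℕ A)) (exp-nonneg _) (*-monoʳ-≤ z (<⇒≤ 0<z)
              (≤-trans (≤-by 1ℝ (fromℕ-nonneg 1) (CommutativeRing.+-comm ℝ-commutativeRing (fromℕ A) 1ℝ)) (1+x≤exp (fromℕ A)))))
          (≈⇒≤ (≈-trans (solve 3 (λ a b z → a :* (b :* z) := b :* a :* z) ≈-refl (exp (- fromℕ A)) (exp (fromℕ A)) z)
            (≈-trans (*-cong (exp-neg (fromℕ A)) ≈-refl) (solve 1 (λ z → κ 1 :* z := z) ≈-refl z))))))
      ; above = <-≤-trans (proj₂ (archimedean z))
          (≤-trans (≤-by 1ℝ (fromℕ-nonneg 1) (CommutativeRing.+-comm ℝ-commutativeRing (fromℕ B) 1ℝ))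
          (≤-trans (1+x≤exp (fromℕ B))
            (≈⇒≤ (exp-cong (solve 2 (λ a b → b := :- a :+ (a :+ b)) ≈-refl (fromℕ A) (fromℕ B))))))
      }

    refine : ∀ {n} (b : Bracket n) → ∃ λ (b′ : Bracket (suc n)) →
             (left b ≤ left b′) × (left b′ + width (suc n) ≤ left b + width n)
    refine {n} b = by-midpoint (≤-or-> (exp (left b + width (suc n))) z)
      where
      by-midpoint : exp (left b + width (suc n)) ≤ z ⊎ z < exp (left b + width (suc n)) →
                    ∃ λ (b′ : Bracket (suc n)) → (left b ≤ left b′) × (left b′ + width (suc n) ≤ left b + width n)
      by-midpoint (inj₁ h) = record
        { left = left b + width (suc n) ; below = h
        ; above = <-≤-trans (above b) (≈⇒≤ (exp-cong (≈-sym end))) }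
        , ≤-by (width (suc n)) (0≤width (suc n)) ≈-refl , ≈⇒≤ end
        where
        end : left b + width (suc n) + width (suc n) ≈ left b + width n
        end = solve 2 (λ a w → a :+ con ½ :* w :+ con ½ :* w := a :+ w) ≈-refl (left b) (width n)
      by-midpoint (inj₂ h) = record { left = left b ; below = below b ; above = h }
        , ≤-refl , ≤-by (width (suc n)) (0≤width (suc n))
            (solve 2 (λ a w → a :+ con ½ :* w :+ con ½ :* w := a :+ w) ≈-refl (left b) (width n))

    bracket : ∀ n → Bracket n
    bracket zero    = initial
    bracket (suc n) = proj₁ (refine (bracket n))

    a : ℕ → ℝ
    a n = left (bracket n)

    nested : ∀ n d → (a n ≤ a (d ℕ.+ n)) × (a (d ℕ.+ n) + width (d ℕ.+ n) ≤ a n + width n)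
    nested n zero = ≤-refl , ≤-refl
    nested n (suc d) = let (p , q) = nested n d ; (_ , p′ , q′) = refine (bracket (d ℕ.+ n)) in
      ≤-trans p p′ , ≤-trans q′ q

    inside : ∀ n m → n ℕ.≤ m → (a n ≤ a m) × (a m ≤ a n + width n)
    inside n m n≤m = subst (λ m → (a n ≤ a m) × (a m ≤ a n + width n)) (ℕₚ.m∸n+n≡m n≤m)
      (let (p , q) = nested n (m ℕ.∸ n) in p , ≤-trans (≤-by (width (m ℕ.∸ n ℕ.+ n)) (0≤width _) ≈-refl) q)

    width-decay : ∀ n → fromℕ (suc n) * width n ≤ width 0
    width-decay zero = ≈⇒≤ (solve 1 (λ e → κ 1 :* e := e) ≈-refl (width 0))
    width-decay (suc n) = ≤-trans
      (≤-by (½ʳ * (fromℕ n * width n)) (*-nonneg 0≤½ (*-nonneg (fromℕ-nonneg n) (0≤width n)))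
        (≈-trans (+-cong (*-cong (≈-trans (fromℕ-suc (suc n)) (+-cong ≈-refl (fromℕ-suc n))) ≈-refl) ≈-refl)
        (≈-trans (solve 2 (λ m w → (κ 1 :+ (κ 1 :+ m)) :* (con ½ :* w) :+ con ½ :* (m :* w) := (κ 1 :+ m) :* w) ≈-refl (fromℕ n) (width n))
          (*-cong (≈-sym (fromℕ-suc n)) ≈-refl))))
      (width-decay n)

    width-small : ∀ {C} → 0ℝ ≤ C → ∀ {ε} → 0ℝ < ε → ∃ λ N → ∀ n → N ℕ.≤ n → C * width n ≤ ε
    width-small {C} 0≤C {ε} 0<ε = let (J , h) = archimedean-* (C * width 0) 0<ε in J , λ n J≤n →
      *-cancelˡ-≤ (fromℕ (suc n)) (fromℕ-suc-pos n)
        (≤-trans (≈⇒≤ (solve 3 (λ m c w → m :* (c :* w) := c :* (m :* w)) ≈-refl (fromℕ (suc n)) C (width n)))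
        (≤-trans (*-monoˡ-≤ C 0≤C (width-decay n))
        (≤-trans h (*-monoʳ-≤ ε (<⇒≤ 0<ε) (fromℕ-mono-≤ (ℕₚ.≤-trans J≤n (ℕₚ.n≤1+n n)))))))

    a-near : ∀ n m → n ℕ.≤ m → Near (width n) (a m) (a n)
    a-near n m n≤m = let (p , q) = inside n m n≤m in near q (≤-trans p (≤-by (width n) (0≤width n) ≈-refl))

    limit : ∃ (Lim a)
    limit = complete a λ {ε} 0<ε → let (N , small) = width-small {1ℝ} (fromℕ-nonneg 1) (½-pos 0<ε)
                                       w≤ = ≤-trans (≈⇒≤ (solve 1 (λ w → w := κ 1 :* w) ≈-refl (width N))) (small N ℕₚ.≤-refl) in
      N , λ m n hm hn → near-mono (≈⇒≤ (½-halves ε))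
        (near-trans (near-mono w≤ (a-near N m hm)) (near-sym (near-mono w≤ (a-near N n hn))))

    y = proj₁ limit

    a≤y : ∀ n → a n ≤ y
    a≤y n = Lim-≤ n (λ m n≤m → proj₁ (inside n m n≤m)) (Lim-const (a n)) (proj₂ limit)

    y≤a+width : ∀ n → y ≤ a n + width n
    y≤a+width n = Lim-≤ n (λ m n≤m → proj₂ (inside n m n≤m)) (proj₂ limit) (Lim-const (a n + width n))

    -- The bound exp w · (1 − w) ≤ 1 turns an additive error w in the exponent into a multiplicative one.
    absorb : ∀ {u v} → 0ℝ ≤ u → 0ℝ ≤ v → (∀ n → u ≤ v * exp (width n)) → u ≤ v
    absorb {u} {v} 0≤u 0≤v h = ≤-up-to-εʳ λ {ε} 0<ε →
      let (N , small) = width-small 0≤u (½-pos 0<ε)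
          (M , small′) = width-small {1ℝ} (fromℕ-nonneg 1) 0<1
          n = N ℕ.⊔ M
          w = width n
          w≤1 = ≤-trans (≈⇒≤ (solve 1 (λ w → w := κ 1 :* w) ≈-refl w)) (small′ n (ℕₚ.m≤n⊔m N M))
      in ≤-by ((½ʳ * ε - u * w) + (1ℝ - w) * (v * exp w - u) + v * (1ℝ - exp w * (1ℝ - w)) + ½ʳ * ε)
           (+-nonneg (+-nonneg (+-nonneg (≤-gap (small n (ℕₚ.m≤m⊔n N M)))
             (*-nonneg (≤-gap w≤1) (≤-gap (h n)))) (*-nonneg 0≤v (≤-gap (exp*[1-x]≤1 w)))) (<⇒≤ (½-pos 0<ε)))
           (solve 5 (λ u v w x e → u :+ ((con ½ :* e :- u :* w) :+ (κ 1 :- w) :* (v :* x :- u) :+ v :* (κ 1 :- x :* (κ 1 :- w)) :+ con ½ :* e) := v :+ e)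
             ≈-refl u v w (exp w) ε)

    exp-y≤z : exp y ≤ z
    exp-y≤z = absorb {exp y} {z} (exp-nonneg y) (<⇒≤ 0<z) (λ n → ≤-trans (exp-mono-≤ (y≤a+width n))
      (≤-trans (≈⇒≤ (exp-+ (a n) (width n))) (*-monoʳ-≤ (exp (width n)) (exp-nonneg (width n)) (below (bracket n)))))

    z≤exp-y : z ≤ exp y
    z≤exp-y = absorb {z} {exp y} (<⇒≤ 0<z) (exp-nonneg y) (λ n → ≤-trans (<⇒≤ (above (bracket n)))
      (≤-trans (exp-mono-≤ (+-mono-≤ (a≤y n) (≤-refl {width n}))) (≈⇒≤ (exp-+ y (width n)))))

    exp-y : exp y ≈ z
    exp-y = exp-y≤z , z≤exp-y

  exp-log : ∀ {z} → 0ℝ < z → exp (log z) ≈ z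
  exp-log {z} 0<z = the-spec (λ y → exp y ≈ z) (Bisection.y 0<z , Bisection.exp-y 0<z)

  -- Opaque: unfolding the series inside inverses makes conversion checking explode.
  abstract
    inv : ℝ → ℝ
    inv z = exp (- log z)

    inv-pos : ∀ z → 0ℝ < inv z
    inv-pos z = exp-pos (- log z)

    *-inv : ∀ {z} → 0ℝ < z → z * inv z ≈ 1ℝ
    *-inv {z} 0<z = ≈-trans (*-cong (≈-sym (exp-log 0<z)) ≈-refl) (exp-neg (log z))

  ÷-inv : ∀ {x y} → 0ℝ < y → x ÷ y ≈ x * inv y
  ÷-inv {x} {y} 0<y = ÷-≈ 0<y (≈-trans (solve 3 (λ x i y → x :* i :* y := y :* i :* x) ≈-refl x (inv y) y)
    (≈-trans (*-cong (*-inv 0<y) ≈-refl) (solve 1 (λ x → κ 1 :* x := x) ≈-refl x)))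

  sqrt-spec : ∀ {z} → 0ℝ < z → (0ℝ ≤ sqrt z) × (sqrt z * sqrt z ≈ z)
  sqrt-spec {z} 0<z = the-spec (λ y → (0ℝ ≤ y) × (y * y ≈ z)) (exp (½ʳ * log z) , exp-nonneg _
    , ≈-trans (≈-sym (exp-+ _ _)) (≈-trans (exp-cong (½-halves (log z))) (exp-log 0<z)))

  exp-½≤2 : exp ½ʳ ≤ fromℕ 2
  exp-½≤2 = ≤-by (fromℕ 2 * (1ℝ - exp ½ʳ * (1ℝ - ½ʳ)))
    (*-nonneg (fromℕ-nonneg 2) (≤-gap (exp*[1-x]≤1 ½ʳ)))
    (solve 1 (λ e → e :+ κ 2 :* (κ 1 :- e :* (κ 1 :- con ½)) := κ 2) ≈-refl (exp ½ʳ))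

  -- A crude numerical bound on log 2. In the schedule it makes every sample size at least 2 and
  -- bounds 1/(εN) by 4a².
  ½≤log : ∀ {z} → fromℕ 2 ≤ z → ½ʳ ≤ log z
  ½≤log {z} 2≤z = exp-cancel-≤ (≤-trans exp-½≤2 (≤-trans 2≤z (proj₂ (exp-log (<-≤-trans (fromℕ-suc-pos 1) 2≤z)))))

  2≤exp-1 : fromℕ 2 ≤ exp 1ℝ
  2≤exp-1 = ≤-trans (≈⇒≤ (solve 0 (κ 2 := κ 1 :+ κ 1) ≈-refl)) (1+x≤exp 1ℝ)

-- Sparse approximation by sampling

∑-swap : ∀ {m n} (f : Fin m → Fin n → ℝ) → ∑ (λ i → ∑ (f i)) ≈ ∑ (λ j → ∑ (λ i → f i j))
∑-swap {zero} {n} f = ≈-sym (≈-trans (∑-const n 0ℝ) (solve 1 (λ m → m :* κ 0 := κ 0) ≈-refl (fromℕ n)))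
∑-swap {suc m} f = ≈-trans (+-cong ≈-refl (∑-swap (f ∘ suc)))
  (≈-sym (∑-+ (f zero) (λ j → ∑ (λ i → f (suc i) j))))

module Sampling (lem : ExcludedMiddle 0ℓ) where
  open Order lem
  open Limits lem
  open Classical lem
  open ExpProperties lem

  ∑-mono-< : ∀ {n} {f g : Fin (suc n) → ℝ} → (∀ i → f i < g i) → ∑ f < ∑ g
  ∑-mono-< {n} {f} {g} h = <-by ((g zero - f zero) + (∑ (g ∘ suc) - ∑ (f ∘ suc)))
    (+-pos (<-gap (h zero)) (≤-gap (∑-mono-≤ λ i → <⇒≤ (h (suc i)))))
    (solve 4 (λ a b c d → a :+ b :+ ((c :- a) :+ (d :- b)) := c :+ d) ≈-refl (f zero) (∑ (f ∘ suc)) (g zero) (∑ (g ∘ suc)))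

  ∃≤average : ∀ n (f : Fin (suc n) → ℝ) c → ∑ f ≤ fromℕ (suc n) * c → ∃ λ i → f i ≤ c
  ∃≤average n f c h with lem {∃ λ i → f i ≤ c}
  ... | yes p = p
  ... | no ¬p = contradiction h (<⇒≱ (≤-<-trans (proj₂ (∑-const (suc n) c))
        (∑-mono-< {n} {λ _ → c} {f} λ i → ≰⇒> λ fi≤c → ¬p (i , fi≤c))))

  -- Follows from exp w · (1 − w) ≤ 1 at w = y − 2y², since (1 + y)(1 − w) = 1 + y²(1 + 2y) ≥ 1.
  exp[y-2y²]≤1+y : ∀ {y} → - ½ʳ ≤ y → y ≤ ½ʳ → exp (y - fromℕ 2 * (y * y)) ≤ 1ℝ + y
  exp[y-2y²]≤1+y {y} lo hi = ≤-by
    ((1ℝ + y) * (1ℝ - E * (1ℝ - w)) + E * (y * y * (1ℝ + fromℕ 2 * y)))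
    (+-nonneg (*-nonneg 0≤1+y (≤-gap (exp*[1-x]≤1 w)))
      (*-nonneg (exp-nonneg w) (*-nonneg (square-nonneg y)
        (≤-by (fromℕ 2 * (y - - ½ʳ)) (*-nonneg (fromℕ-nonneg 2) (≤-gap lo))
          (solve 1 (λ y → κ 0 :+ κ 2 :* (y :- :- con ½) := κ 1 :+ κ 2 :* y) ≈-refl y)))))
    (solve 2 (λ y e → let w = y :- κ 2 :* (y :* y) in
        e :+ ((κ 1 :+ y) :* (κ 1 :- e :* (κ 1 :- w)) :+ e :* (y :* y :* (κ 1 :+ κ 2 :* y))) := κ 1 :+ y) ≈-refl y E)
    where
    w = y - fromℕ 2 * (y * y)
    E = exp w
    0≤1+y : 0ℝ ≤ 1ℝ + y
    0≤1+y = ≤-by (½ʳ + (y - - ½ʳ)) (+-nonneg 0≤½ (≤-gap lo))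
      (solve 1 (λ y → κ 0 :+ (con ½ :+ (y :- :- con ½)) := κ 1 :+ y) ≈-refl y)
    square-nonneg : ∀ y → 0ℝ ≤ y * y
    square-nonneg y = by-sign (≤-total 0ℝ y)
      where
      by-sign : 0ℝ ≤ y ⊎ y ≤ 0ℝ → 0ℝ ≤ y * y
      by-sign (inj₁ 0≤y) = *-nonneg 0≤y 0≤y
      by-sign (inj₂ y≤0) = ≤-trans (*-nonneg (≤-gap y≤0) (≤-gap y≤0))
        (≈⇒≤ (solve 1 (λ y → (κ 0 :- y) :* (κ 0 :- y) := y :* y) ≈-refl y))

  sampleSum : ∀ {N K m} → (Fin N → Fin K → ℝ) → Vec (Fin N) m → Fin K → ℝ
  sampleSum u []      j = 0ℝ
  sampleSum u (i ∷ s) j = u i j + sampleSum u s j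

  module _ {N K : ℕ} (u : Fin (suc N) → Fin K → ℝ) (ū : Fin K → ℝ) (θ : ℝ)
           (∣u∣≤1 : ∀ i j → ∣ u i j ∣ ≤ 1ℝ) (mean : ∀ j → fromℕ (suc N) * ū j ≈ ∑ (λ i → u i j))
           (0≤θ : 0ℝ ≤ θ) (θ≤½ : θ ≤ ½ʳ) where

    -- The compensator 2θ² pays for the second-order term of the exponential, so that exp of the
    -- increment has average at most 1 over the records.
    increment : Fin (suc N) → Fin K → ℝ
    increment i j = θ * (u i j - ū j) - fromℕ 2 * (θ * θ)

    exponent : ∀ {m} → Vec (Fin (suc N)) m → Fin K → ℝ
    exponent []      j = 0ℝ
    exponent (i ∷ s) j = exponent s j + increment i j

    exponent-≈ : ∀ {m} (s : Vec (Fin (suc N)) m) j →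
      exponent s j ≈ θ * (sampleSum u s j - fromℕ m * ū j) - fromℕ m * (fromℕ 2 * (θ * θ))
    exponent-≈ [] j = solve 2 (λ t u → κ 0 := t :* (κ 0 :- κ 0 :* u) :- κ 0 :* (κ 2 :* (t :* t))) ≈-refl θ (ū j)
    exponent-≈ {suc m} (i ∷ s) j = ≈-trans (+-cong (exponent-≈ s j) ≈-refl) (≈-trans
      (solve 5 (λ t m u ū s → (t :* (s :- m :* ū) :- m :* (κ 2 :* (t :* t))) :+ (t :* (u :- ū) :- κ 2 :* (t :* t))
          := t :* (u :+ s :- (κ 1 :+ m) :* ū) :- (κ 1 :+ m) :* (κ 2 :* (t :* t)))
        ≈-refl θ (fromℕ m) (u i j) (ū j) (sampleSum u s j))
      (+-cong (*-cong ≈-refl (+-cong ≈-refl (neg-cong (*-cong (≈-sym (fromℕ-suc m)) ≈-refl))))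
        (neg-cong (*-cong (≈-sym (fromℕ-suc m)) ≈-refl))))

    -- Since u² ≤ 1, replacing 2θ² by 2(θu)² only enlarges the exponent; then `exp[y-2y²]≤1+y`
    -- applies with y = θu, which lies in its range because θ ≤ ½.
    increment-bound : ∀ i j → exp (increment i j) ≤ exp (- (θ * ū j)) * (1ℝ + θ * u i j)
    increment-bound i j = ≤-trans (exp-mono-≤ {increment i j} { - (θ * ū j) + (y - fromℕ 2 * (y * y))}
        (≤-by (fromℕ 2 * (θ * (θ * ((1ℝ - u i j) * (1ℝ - - u i j)))))
          (*-nonneg (fromℕ-nonneg 2) (*-nonneg 0≤θ (*-nonneg 0≤θ (*-nonneg 0≤1-u 0≤1+u))))
          (solve 3 (λ t u ū → (t :* (u :- ū) :- κ 2 :* (t :* t)) :+ κ 2 :* (t :* (t :* ((κ 1 :- u) :* (κ 1 :- :- u))))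
              := :- (t :* ū) :+ (t :* u :- κ 2 :* (t :* u :* (t :* u)))) ≈-refl θ (u i j) (ū j))))
      (≤-trans (≈⇒≤ (exp-+ (- (θ * ū j)) (y - fromℕ 2 * (y * y))))
        (*-monoˡ-≤ (exp (- (θ * ū j))) (exp-nonneg (- (θ * ū j))) (exp[y-2y²]≤1+y
          (≤-by (θ * (1ℝ - - u i j) + (½ʳ - θ)) (+-nonneg (*-nonneg 0≤θ 0≤1+u) (≤-gap θ≤½))
            (solve 2 (λ t u → :- con ½ :+ (t :* (κ 1 :- :- u) :+ (con ½ :- t)) := t :* u) ≈-refl θ (u i j)))
          (≤-by (θ * (1ℝ - u i j) + (½ʳ - θ)) (+-nonneg (*-nonneg 0≤θ 0≤1-u) (≤-gap θ≤½))
            (solve 2 (λ t u → t :* u :+ (t :* (κ 1 :- u) :+ (con ½ :- t)) := con ½) ≈-refl θ (u i j))))))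
      where
      y = θ * u i j
      0≤1-u = ≤-gap (∣∣-≤⁺ (∣u∣≤1 i j))
      0≤1+u = ≤-gap (∣∣-≤⁻ (∣u∣≤1 i j))

    -- Averaging turns 1 + θu into 1 + θū ≤ exp(θū), and this cancels the factor exp(-θū).
    ∑-increment-bound : ∀ j → ∑ (λ i → exp (increment i j)) ≤ fromℕ (suc N)
    ∑-increment-bound j = ≤-trans (∑-mono-≤ λ i → increment-bound i j)
      (≤-trans (≈⇒≤ (≈-trans (∑-*ˡ (exp (- (θ * ū j))) (λ i → 1ℝ + θ * u i j))
          (*-cong ≈-refl (≈-trans (∑-+ (λ _ → 1ℝ) (λ i → θ * u i j))
            (+-cong (∑-const (suc N) 1ℝ) (≈-trans (∑-*ˡ θ (λ i → u i j)) (*-cong ≈-refl (≈-sym (mean j)))))))))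
      (≤-trans (≈⇒≤ (solve 4 (λ e n t ū → e :* (n :* κ 1 :+ t :* (n :* ū)) := n :* (e :* (κ 1 :+ t :* ū))) ≈-refl
          (exp (- (θ * ū j))) (fromℕ (suc N)) θ (ū j)))
      (≤-trans (*-monoˡ-≤ (fromℕ (suc N)) (fromℕ-nonneg (suc N))
          (≤-trans (*-monoˡ-≤ (exp (- (θ * ū j))) (exp-nonneg (- (θ * ū j))) (1+x≤exp (θ * ū j)))
            (≈⇒≤ (≈-trans (*-comm (exp (- (θ * ū j))) (exp (θ * ū j))) (exp-neg (θ * ū j))))))
        (≈⇒≤ (solve 1 (λ n → n :* κ 1 := n) ≈-refl (fromℕ (suc N)))))))

    -- The exponential moment used in the method of conditional expectations. On average over the
    -- next record it does not grow, so some record does not increase it; a good sample is built one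
    -- record at a time, without probability on samples.
    potential : ∀ {m} → Vec (Fin (suc N)) m → ℝ
    potential s = ∑ λ j → exp (exponent s j)

    ∑-potential : ∀ {m} (s : Vec (Fin (suc N)) m) → ∑ (λ i → potential (i ∷ s)) ≤ fromℕ (suc N) * potential s
    ∑-potential s = ≤-trans (≈⇒≤ (∑-swap (λ i j → exp (exponent (i ∷ s) j))))
      (≤-trans (∑-mono-≤ λ j → ≤-trans
          (≈⇒≤ (≈-trans (∑-cong λ i → exp-+ (exponent s j) (increment i j)) (∑-*ˡ (exp (exponent s j)) (λ i → exp (increment i j)))))
          (≤-trans (*-monoˡ-≤ (exp (exponent s j)) (exp-nonneg (exponent s j)) (∑-increment-bound j))
            (≈⇒≤ (*-comm (exp (exponent s j)) (fromℕ (suc N))))))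
        (≈⇒≤ (∑-*ˡ (fromℕ (suc N)) (λ j → exp (exponent s j)))))

    lowPotential : ∀ m → ∃ λ (s : Vec (Fin (suc N)) m) → potential s ≤ fromℕ K
    lowPotential zero = [] , ≈⇒≤ (≈-trans (∑-const K (exp 0ℝ)) (≈-trans (*-cong ≈-refl exp-0)
      (solve 1 (λ n → n :* κ 1 := n) ≈-refl (fromℕ K))))
    lowPotential (suc m) =
      let (s , h) = lowPotential m
          (i , h′) = ∃≤average N (λ i → potential (i ∷ s)) (potential s) (∑-potential s)
      in i ∷ s , ≤-trans h′ h

    -- Each exponential is at most the potential and hence at most exp L, which bounds all K
    -- exponents at once, as a union bound would.
    sampling : ∀ m L → fromℕ K ≤ exp L → ∃ λ (s : Vec (Fin (suc N)) m) →
               ∀ j → θ * (sampleSum u s j - fromℕ m * ū j) ≤ L + fromℕ m * (fromℕ 2 * (θ * θ))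
    sampling m L K≤expL = s , λ j → ≤-by (L - exponent s j)
      (≤-gap (exp-cancel-≤ (≤-trans (term≤∑ (λ j → exp-nonneg (exponent s j)) j) (≤-trans low K≤expL))))
      (≈-trans (+-cong ≈-refl (+-cong ≈-refl (neg-cong (exponent-≈ s j))))
        (solve 3 (λ d e l → d :+ (l :- (d :- e)) := l :+ e) ≈-refl
          (θ * (sampleSum u s j - fromℕ m * ū j)) (fromℕ m * (fromℕ 2 * (θ * θ))) L))
      where
      s = proj₁ (lowPotential m)
      low = proj₂ (lowPotential m)

-- Paths between databases

-- Path h x y holds iff x and y have Hamming distance at most h (updates may be trivial);
-- splitting and telescoping along a path replace computations with the distance.
data Path {D : Set} {n : ℕ} : ℕ → Vec D n → Vec D n → Set where
  done : ∀ {x} → Path 0 x x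
  step : ∀ {h x y} i d → Path h (x [ i ]≔ d) y → Path (suc h) x y

splitPath : ∀ {D : Set} {n} a {b} {x y : Vec D n} → Path (a ℕ.+ b) x y → ∃ λ z → Path a x z × Path b z y
splitPath zero    p            = _ , done , p
splitPath (suc a) (step i d p) = let (z , p₁ , p₂) = splitPath a p in z , step i d p₁ , p₂

padPath : ∀ {D : Set} {n h} {x y : Vec D n} → Fin n → ∀ e → Path h x y → Path (e ℕ.+ h) x y
padPath i zero    p = p
padPath {x = x} {y} i (suc e) p =
  step i (lookup x i) (subst (λ z → Path _ z y) (sym (Vecₚ.[]≔-lookup x i)) (padPath i e p))

fullPath : ∀ {D : Set} {n} (x y : Vec D n) → Path n x y
fullPath {n = zero} [] [] = done
fullPath {n = suc n} (_ ∷ xs) (d ∷ ys) = step zero d (lift (fullPath xs ys))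
  where
  lift : ∀ {h} {xs ys : Vec _ n} {d} → Path h xs ys → Path h (d ∷ xs) (d ∷ ys)
  lift done = done
  lift (step i d p) = step (suc i) d (lift p)

neighborPath : ∀ {D : Set} {n h} {x x′ y : Vec D n} → Neighboring x x′ → Path h x′ y → Path (suc h) x y
neighborPath {x = x} {x′} {y} (i , _ , same) p = step i (lookup x′ i) (subst (λ z → Path _ z y) (sym eq) p)
  where
  agree : ∀ j → lookup (x [ i ]≔ lookup x′ i) j ≡ lookup x′ j
  agree j with j Finₚ.≟ i
  ... | yes refl = Vecₚ.lookup∘updateAt i x
  ... | no j≢i = trans (Vecₚ.lookup∘updateAt′ j i j≢i x) (same j j≢i)
  eq : x [ i ]≔ lookup x′ i ≡ x′
  eq = trans (sym (Vecₚ.tabulate∘lookup _)) (trans (Vecₚ.tabulate-cong agree) (Vecₚ.tabulate∘lookup x′))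

neighboring-sym : ∀ {D : Set} {n} {x x′ : Vec D n} → Neighboring x x′ → Neighboring x′ x
neighboring-sym (i , x≢x′ , same) = i , (λ eq → x≢x′ (sym eq)) , λ j j≢i → sym (same j j≢i)

module Queries {D : Set} {n k : ℕ} (q : Fin k → D → ℝ) where

  total-answer : Vec D n → Fin k → ℝ
  total-answer x j = ∑ λ i → q j (lookup x i)

  update-total : ∀ {n} (x : Vec D n) i d j →
    ∑ (λ t → q j (lookup (x [ i ]≔ d) t)) + q j (lookup x i) ≈ ∑ (λ t → q j (lookup x t)) + q j d
  update-total (x ∷ xs) zero d j = solve 3 (λ a b s → a :+ s :+ b := b :+ s :+ a) ≈-refl (q j d) (q j x) (∑ (λ t → q j (lookup xs t)))
  update-total (x ∷ xs) (suc i) d j = ≈-trans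
    (solve 3 (λ a s b → a :+ s :+ b := a :+ (s :+ b)) ≈-refl (q j x) (∑ (λ t → q j (lookup (xs [ i ]≔ d) t))) (q j (lookup xs i)))
    (≈-trans (+-cong ≈-refl (update-total xs i d j))
      (solve 3 (λ a s b → a :+ (s :+ b) := a :+ s :+ b) ≈-refl (q j x) (∑ (λ t → q j (lookup xs t))) (q j d)))

  Signed : Set
  Signed = Bool × D

  signed : Signed → Fin k → ℝ
  signed (true  , d) j = q j d
  signed (false , d) j = - q j d

  -- An update contributes the old record with sign + and the new one with sign -; this is the
  -- origin of the length `h * 2`.
  edits : ∀ {h} {x y : Vec D n} → Path h x y → Vec Signed (h ℕ.* 2)
  edits done = []
  edits {x = x} (step i d p) = (true , lookup x i) ∷ (false , d) ∷ edits p

  path-difference : ∀ {h} {x y : Vec D n} (p : Path h x y) j →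
    total-answer x j ≈ total-answer y j + ∑ (λ t → signed (lookup (edits p) t) j)
  path-difference {x = x} done j = solve 1 (λ a → a := a :+ κ 0) ≈-refl (total-answer x j)
  path-difference {x = x} {y} (step i d p) j = ≈-trans
    (≈-trans (solve 2 (λ a b → a := (a :+ b) :- b) ≈-refl (total-answer x j) (q j d))
      (≈-trans (+-cong (≈-sym (update-total x i d j)) ≈-refl) (+-cong (+-cong (path-difference p j) ≈-refl) ≈-refl)))
    (solve 4 (λ a s b c → a :+ s :+ b :- c := a :+ (b :+ (:- c :+ s))) ≈-refl
      (total-answer y j) (∑ (λ t → signed (lookup (edits p) t) j)) (q j (lookup x i)) (q j d))

  signedSum : ∀ {m} → Vec Signed m → Fin k → ℝ
  signedSum []      j = 0ℝ
  signedSum (s ∷ v) j = signed s j + signedSum v j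

  module Cover (lem : ExcludedMiddle 0ℓ) (∣q∣≤1 : ∀ j d → ∣ q j d ∣ ≤ 1ℝ) where
    open Order lem
    open Classical lem
    open Sampling lem

    ∣signed∣≤1 : ∀ s j → ∣ signed s j ∣ ≤ 1ℝ
    ∣signed∣≤1 (true  , d) j = ∣q∣≤1 j d
    ∣signed∣≤1 (false , d) j = ∣∣-lub (∣∣-≤⁻ (∣q∣≤1 j d))
      (≤-trans (≈⇒≤ (neg-involutive (q j d))) (∣∣-≤⁺ (∣q∣≤1 j d)))

    -- Both signs of every query appear, so that one-sided bounds suffice.
    module _ {N} (es : Vec Signed (suc N)) where
      Δ : Fin k → ℝ
      Δ j = ∑ λ t → signed (lookup es t) j

      u : Fin (suc N) → Fin (k ℕ.+ k) → ℝ
      u t j = [ signed (lookup es t) , (λ j → - signed (lookup es t) j) ]′ (Fin.splitAt k j)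

      ū : Fin (k ℕ.+ k) → ℝ
      ū j = recip N * ∑ (λ t → u t j)

      mean : ∀ j → fromℕ (suc N) * ū j ≈ ∑ (λ t → u t j)
      mean j = ≈-trans (solve 3 (λ m r s → m :* (r :* s) := m :* r :* s) ≈-refl (fromℕ (suc N)) (recip N) (∑ (λ t → u t j)))
        (≈-trans (*-cong (recip-inverse N) ≈-refl) (solve 1 (λ s → κ 1 :* s := s) ≈-refl (∑ (λ t → u t j))))

      ∣u∣≤1 : ∀ t j → ∣ u t j ∣ ≤ 1ℝ
      ∣u∣≤1 t j = by-side (Fin.splitAt k j)
        where
        by-side : ∀ s → ∣ [ signed (lookup es t) , (λ j → - signed (lookup es t) j) ]′ s ∣ ≤ 1ℝ
        by-side (inj₁ j) = ∣signed∣≤1 (lookup es t) j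
        by-side (inj₂ j) = ∣∣-lub (∣∣-≤⁻ (∣signed∣≤1 (lookup es t) j))
          (≤-trans (≈⇒≤ (neg-involutive (signed (lookup es t) j))) (∣∣-≤⁺ (∣signed∣≤1 (lookup es t) j)))

      u-left : ∀ t j → u t (j Fin.↑ˡ k) ≈ signed (lookup es t) j
      u-left t j rewrite Finₚ.splitAt-↑ˡ k j k = ≈-refl

      u-right : ∀ t j → u t (k Fin.↑ʳ j) ≈ - signed (lookup es t) j
      u-right t j rewrite Finₚ.splitAt-↑ʳ k k j = ≈-refl

      mean-left : ∀ j → fromℕ (suc N) * ū (j Fin.↑ˡ k) ≈ Δ j
      mean-left j = ≈-trans (mean (j Fin.↑ˡ k)) (∑-cong λ t → u-left t j)

      neg-≈ : ∀ x → - x ≈ - 1ℝ * x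
      neg-≈ = solve 1 (λ x → :- x := :- κ 1 :* x) ≈-refl

      mean-right : ∀ j → fromℕ (suc N) * ū (k Fin.↑ʳ j) ≈ - Δ j
      mean-right j = ≈-trans (mean (k Fin.↑ʳ j)) (≈-trans (∑-cong λ t → ≈-trans (u-right t j) (neg-≈ (signed (lookup es t) j)))
        (≈-trans (∑-*ˡ (- 1ℝ) (λ t → signed (lookup es t) j)) (≈-sym (neg-≈ (Δ j)))))

      sum-left : ∀ {m} (s : Vec (Fin (suc N)) m) j → sampleSum u s (j Fin.↑ˡ k) ≈ signedSum (Vec.map (lookup es) s) j
      sum-left [] j = ≈-refl
      sum-left (t ∷ s) j = +-cong (u-left t j) (sum-left s j)

      sum-right : ∀ {m} (s : Vec (Fin (suc N)) m) j → sampleSum u s (k Fin.↑ʳ j) ≈ - signedSum (Vec.map (lookup es) s) j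
      sum-right [] j = solve 0 (κ 0 := :- κ 0) ≈-refl
      sum-right (t ∷ s) j = ≈-trans (+-cong (u-right t j) (sum-right s j))
        (solve 2 (λ a b → :- a :+ :- b := :- (a :+ b)) ≈-refl (signed (lookup es t) j) (signedSum (Vec.map (lookup es) s) j))

      -- By the choice of L both terms on the right of `sampling` are at most 2Mθ², M being the
      -- sample size; division by θ and scaling by (number of records)/M leave 4θ per record.
      -- Coordinate j and its mirror image k + j give the two signs of the absolute value.
      sparse-approximation : ∀ {θ L} m → 0ℝ < θ → θ ≤ ½ʳ → fromℕ (k ℕ.+ k) ≤ exp L →
        L ≤ fromℕ (suc m) * (fromℕ 2 * (θ * θ)) →
        ∃ λ (v : Vec Signed (suc m)) → ∀ j →
          ∣ Δ j - fromℕ (suc N) * recip m * signedSum v j ∣ ≤ fromℕ 4 * θ * fromℕ (suc N)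
      sparse-approximation {θ} {L} m 0<θ θ≤½ 2k≤expL L≤ = v , λ j → ∣∣-lub
          (≤-trans (≈⇒≤ (≈-trans
              (+-cong (≈-trans (solve 1 (λ d → d := :- :- d) ≈-refl (Δ j)) (neg-cong (≈-sym (mean-right j)))) ≈-refl)
              (solve 4 (λ N u r s → :- (N :* u) :- N :* r :* s := N :* r :* :- s :- N :* u) ≈-refl
                N′ (ū (k Fin.↑ʳ j)) (recip m) (signedSum v j))))
            (≤-trans (≈⇒≤ (+-cong (*-cong ≈-refl (≈-sym (sum-right s j))) ≈-refl)) (one-sided (k Fin.↑ʳ j))))
          (≤-trans (≈⇒≤ (≈-trans (neg-cong (+-cong (≈-sym (mean-left j)) ≈-refl))
              (solve 4 (λ N u r s → :- (N :* u :- N :* r :* s) := N :* r :* s :- N :* u) ≈-refl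
                N′ (ū (j Fin.↑ˡ k)) (recip m) (signedSum v j))))
            (≤-trans (≈⇒≤ (+-cong (*-cong ≈-refl (≈-sym (sum-left s j))) ≈-refl)) (one-sided (j Fin.↑ˡ k))))
        where
        N′ = fromℕ (suc N)
        M = fromℕ (suc m)
        sampled = sampling u ū θ ∣u∣≤1 mean (<⇒≤ 0<θ) θ≤½ (suc m) L 2k≤expL
        s = proj₁ sampled
        v = Vec.map (lookup es) s
        one-sided : ∀ j → N′ * recip m * sampleSum u s j - N′ * ū j ≤ fromℕ 4 * θ * N′
        one-sided j = ≤-trans
          (≈⇒≤ (≈-trans (solve 4 (λ N u r S → N :* r :* S :- N :* u := N :* r :* S :- κ 1 :* (N :* u)) ≈-refl N′ (ū j) (recip m) S)
            (≈-trans (+-cong ≈-refl (neg-cong (*-cong (≈-sym (recip-inverse m)) ≈-refl)))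
              (solve 5 (λ N u r S M → N :* r :* S :- M :* r :* (N :* u) := N :* r :* (S :- M :* u)) ≈-refl N′ (ū j) (recip m) S M))))
          (≤-trans (*-monoˡ-≤ (N′ * recip m) (*-nonneg (fromℕ-nonneg (suc N)) (<⇒≤ (recip-pos m)))
            (*-cancelˡ-≤ θ 0<θ (≤-trans (proj₂ sampled j)
              (≤-trans (+-mono-≤ L≤ (≤-refl {M * (fromℕ 2 * (θ * θ))}))
                (≈⇒≤ (solve 2 (λ M t → M :* (κ 2 :* (t :* t)) :+ M :* (κ 2 :* (t :* t)) := t :* (κ 4 :* M :* t)) ≈-refl M θ))))))
            (≈⇒≤ (≈-trans (solve 4 (λ N r M t → N :* r :* (κ 4 :* M :* t) := M :* r :* (κ 4 :* t :* N)) ≈-refl N′ (recip m) M θ)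
              (≈-trans (*-cong (recip-inverse m) ≈-refl) (solve 1 (λ a → κ 1 :* a := a) ≈-refl (fromℕ 4 * θ * N′))))))
          where
          S = sampleSum u s j

    path-approximation : ∀ {θ L h h′ x y} m → Fin n → 0ℝ < θ → θ ≤ ½ʳ → fromℕ (k ℕ.+ k) ≤ exp L →
      L ≤ fromℕ (suc m) * (fromℕ 2 * (θ * θ)) → Path h′ x y → h′ ℕ.≤ h →
      ∃ λ (v : Vec Signed (suc m)) → ∀ j →
        ∣ (total-answer x j - total-answer y j) - fromℕ (h ℕ.* 2) * recip m * signedSum v j ∣ ≤ fromℕ 4 * θ * fromℕ (h ℕ.* 2)
    path-approximation {θ} {h = zero} {x = x} m i₀ 0<θ θ≤½ 2k≤expL L≤ done z≤n =
      -- For h = 0 the sample is multiplied by 0, so an arbitrary one serves.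
      Vec.replicate (suc m) (true , lookup x i₀) , λ j → ≤-trans
        (∣∣-cong-≤ (solve 3 (λ a r s → (a :- a) :- κ 0 :* r :* s := κ 0) ≈-refl (total-answer x j) (recip m) _))
        (≤-trans ∣0∣≤0 (≈⇒≤ (solve 1 (λ t → κ 0 := κ 4 :* t :* κ 0) ≈-refl θ)))
    path-approximation {h = suc h} {h′} {x} {y} m i₀ 0<θ θ≤½ 2k≤expL L≤ p h′≤h =
      let (v , close) = sparse-approximation (edits p⁺) m 0<θ θ≤½ 2k≤expL L≤ in
      v , λ j → ≤-trans (∣∣-cong-≤ (+-cong (≈-trans (+-cong (path-difference p⁺ j) ≈-refl)
        (solve 2 (λ a s → a :+ s :- a := s) ≈-refl (total-answer y j) (Δ (edits p⁺) j))) ≈-refl)) (close j)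
      where
      -- Padding to length exactly h makes the coefficient of the sample depend on h alone. The
      -- candidates are thus the same for all inputs, as privacy requires.
      p⁺ : Path (suc h) x y
      p⁺ = subst (λ e → Path e x y) (ℕₚ.m∸n+n≡m h′≤h) (padPath i₀ (suc h ℕ.∸ h′) p)

-- Finite measures and the exponential mechanism

∑ₗ : ∀ {A : Set} → List A → (A → ℝ) → ℝ
∑ₗ []       f = 0ℝ
∑ₗ (x ∷ xs) f = f x + ∑ₗ xs f

∑ₗ-cong : ∀ {A : Set} {f g : A → ℝ} → (∀ a → f a ≈ g a) → ∀ xs → ∑ₗ xs f ≈ ∑ₗ xs g
∑ₗ-cong h []       = ≈-refl
∑ₗ-cong h (x ∷ xs) = +-cong (h x) (∑ₗ-cong h xs)

∑ₗ-mono-≤ : ∀ {A : Set} {f g : A → ℝ} → (∀ a → f a ≤ g a) → ∀ xs → ∑ₗ xs f ≤ ∑ₗ xs g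
∑ₗ-mono-≤ h []       = ≤-refl
∑ₗ-mono-≤ h (x ∷ xs) = +-mono-≤ (h x) (∑ₗ-mono-≤ h xs)

∑ₗ-+ : ∀ {A : Set} (f g : A → ℝ) xs → ∑ₗ xs (λ a → f a + g a) ≈ ∑ₗ xs f + ∑ₗ xs g
∑ₗ-+ f g [] = solve 0 (κ 0 := κ 0 :+ κ 0) ≈-refl
∑ₗ-+ f g (x ∷ xs) = ≈-trans (+-cong ≈-refl (∑ₗ-+ f g xs))
  (solve 4 (λ a b c d → (a :+ b) :+ (c :+ d) := (a :+ c) :+ (b :+ d)) ≈-refl (f x) (g x) (∑ₗ xs f) (∑ₗ xs g))

∑ₗ-*ʳ : ∀ {A : Set} (f : A → ℝ) c xs → ∑ₗ xs (λ a → f a * c) ≈ ∑ₗ xs f * c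
∑ₗ-*ʳ f c [] = solve 1 (λ c → κ 0 := κ 0 :* c) ≈-refl c
∑ₗ-*ʳ f c (x ∷ xs) = ≈-trans (+-cong ≈-refl (∑ₗ-*ʳ f c xs))
  (solve 3 (λ a b c → a :* c :+ b :* c := (a :+ b) :* c) ≈-refl (f x) (∑ₗ xs f) c)

∑ₗ-const : ∀ {A : Set} c (xs : List A) → ∑ₗ xs (λ _ → c) ≈ fromℕ (length xs) * c
∑ₗ-const c [] = solve 1 (λ c → κ 0 := κ 0 :* c) ≈-refl c
∑ₗ-const c (x ∷ xs) = ≈-trans (+-cong ≈-refl (∑ₗ-const c xs))
  (≈-trans (solve 2 (λ c m → c :+ m :* c := (κ 1 :+ m) :* c) ≈-refl c (fromℕ (length xs)))
    (*-cong (≈-sym (fromℕ-suc (length xs))) ≈-refl))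

∑ₗ-nonneg : ∀ {A : Set} {f : A → ℝ} → (∀ a → 0ℝ ≤ f a) → ∀ xs → 0ℝ ≤ ∑ₗ xs f
∑ₗ-nonneg h []       = ≤-refl
∑ₗ-nonneg h (x ∷ xs) = +-nonneg (h x) (∑ₗ-nonneg h xs)

∑ₗ-++ : ∀ {A : Set} (f : A → ℝ) xs ys → ∑ₗ (xs ++ ys) f ≈ ∑ₗ xs f + ∑ₗ ys f
∑ₗ-++ f [] ys = solve 1 (λ s → s := κ 0 :+ s) ≈-refl (∑ₗ ys f)
∑ₗ-++ f (x ∷ xs) ys = ≈-trans (+-cong ≈-refl (∑ₗ-++ f xs ys))
  (solve 3 (λ a b c → a :+ (b :+ c) := a :+ b :+ c) ≈-refl (f x) (∑ₗ xs f) (∑ₗ ys f))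

∑ₗ-map : ∀ {A B : Set} (g : A → B) (f : B → ℝ) xs → ∑ₗ (List.map g xs) f ≡ ∑ₗ xs (f ∘ g)
∑ₗ-map g f [] = refl
∑ₗ-map g f (x ∷ xs) = cong (λ s → f (g x) + s) (∑ₗ-map g f xs)

∈⇒≤∑ₗ : ∀ {A : Set} {f : A → ℝ} → (∀ a → 0ℝ ≤ f a) → ∀ {x xs} → x ∈ xs → f x ≤ ∑ₗ xs f
∈⇒≤∑ₗ {f = f} h {x} {_ ∷ xs} (here refl) = ≤-by (∑ₗ xs f) (∑ₗ-nonneg h xs) ≈-refl
∈⇒≤∑ₗ {f = f} h {x} {y ∷ xs} (there x∈xs) = ≤-trans (∈⇒≤∑ₗ h x∈xs)
  (≤-by (f y) (h y) (solve 2 (λ a b → b :+ a := a :+ b) ≈-refl (f y) (∑ₗ xs f)))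

record Weighted (A : Set) : Set where
  constructor weighted
  field
    mass   : ℝ
    point  : A
    0≤mass : 0ℝ ≤ mass
open Weighted

-- Lists make integration and `>>=` structural recursions. Total mass 1 is tracked separately, and
-- `toLaw` converts only the final measure.
Measure : Set → Set
Measure A = List (Weighted A)

∫ : ∀ {A} → Measure A → (A → ℝ) → ℝ
∫ μ f = ∑ₗ μ λ w → mass w * f (point w)

scale : ∀ {A} (c : ℝ) → 0ℝ ≤ c → Measure A → Measure A
scale c 0≤c = List.map λ w → weighted (c * mass w) (point w) (*-nonneg 0≤c (0≤mass w))

infixl 1 _>>=_
_>>=_ : ∀ {A B} → Measure A → (A → Measure B) → Measure B
[]      >>= K = []
(w ∷ μ) >>= K = scale (mass w) (0≤mass w) (K (point w)) ++ (μ >>= K)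

∫-cong : ∀ {A} {f g : A → ℝ} → (∀ a → f a ≈ g a) → ∀ μ → ∫ μ f ≈ ∫ μ g
∫-cong h = ∑ₗ-cong λ w → *-cong ≈-refl (h (point w))

∫-+ : ∀ {A} (f g : A → ℝ) μ → ∫ μ (λ a → f a + g a) ≈ ∫ μ f + ∫ μ g
∫-+ f g μ = ≈-trans (∑ₗ-cong (λ w → solve 3 (λ m a b → m :* (a :+ b) := m :* a :+ m :* b) ≈-refl (mass w) (f (point w)) (g (point w))) μ)
  (∑ₗ-+ (λ w → mass w * f (point w)) (λ w → mass w * g (point w)) μ)

∫-*ʳ : ∀ {A} (f : A → ℝ) c μ → ∫ μ (λ a → f a * c) ≈ ∫ μ f * c
∫-*ʳ f c μ = ≈-trans (∑ₗ-cong (λ w → solve 3 (λ m a c → m :* (a :* c) := m :* a :* c) ≈-refl (mass w) (f (point w)) c) μ)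
  (∑ₗ-*ʳ (λ w → mass w * f (point w)) c μ)

∫->>= : ∀ {A B} (μ : Measure A) (K : A → Measure B) f → ∫ (μ >>= K) f ≈ ∫ μ (λ a → ∫ (K a) f)
∫->>= [] K f = ≈-refl
∫->>= (w ∷ μ) K f = ≈-trans (∑ₗ-++ (λ v → mass v * f (point v)) (scale (mass w) (0≤mass w) (K (point w))) (μ >>= K))
  (+-cong (∫-scale (K (point w))) (∫->>= μ K f))
  where
  ∫-scale : ∀ ν → ∫ (scale (mass w) (0≤mass w) ν) f ≈ mass w * ∫ ν f
  ∫-scale [] = solve 1 (λ m → κ 0 := m :* κ 0) ≈-refl (mass w)
  ∫-scale (v ∷ ν) = ≈-trans (+-cong ≈-refl (∫-scale ν))
    (solve 4 (λ m v a s → m :* v :* a :+ m :* s := m :* (v :* a :+ s)) ≈-refl (mass w) (mass v) (f (point v)) (∫ ν f))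

withMass : ∀ {A : Set} (m : A → ℝ) → (∀ a → 0ℝ ≤ m a) → List A → Measure A
withMass m 0≤m = List.map λ c → weighted (m c) c (0≤m c)

∫-withMass : ∀ {A : Set} (m : A → ℝ) 0≤m f (cs : List A) → ∫ (withMass m 0≤m cs) f ≈ ∑ₗ cs (λ c → m c * f c)
∫-withMass m 0≤m f [] = ≈-refl
∫-withMass m 0≤m f (c ∷ cs) = +-cong (≈-refl {m c * f c}) (∫-withMass m 0≤m f cs)

toLaw : ∀ {A} (μ : Measure A) → ∫ μ (λ _ → 1ℝ) ≈ 1ℝ → Law A
toLaw μ total = record
  { size = length μ
  ; outcome = λ ω → point (List.lookup μ ω)
  ; weight = λ ω → mass (List.lookup μ ω)
  ; nonneg = λ ω → 0≤mass (List.lookup μ ω)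
  ; total = ≈-trans (masses μ) total
  }
  where
  masses : ∀ μ → ∑ (λ ω → mass (List.lookup μ ω)) ≈ ∫ μ (λ _ → 1ℝ)
  masses [] = ≈-refl
  masses (w ∷ μ) = +-cong (solve 1 (λ m → m := m :* κ 1) ≈-refl (mass w)) (masses μ)

𝔼-toLaw : ∀ {A} (μ : Measure A) total f → 𝔼 (toLaw μ total) f ≡ ∫ μ f
𝔼-toLaw μ _ f = go μ
  where
  go : ∀ μ → ∑ (λ ω → mass (List.lookup μ ω) * f (point (List.lookup μ ω))) ≡ ∫ μ f
  go [] = refl
  go (w ∷ μ) = cong (λ s → mass w * f (point w) + s) (go μ)

module ExponentialMechanism (lem : ExcludedMiddle 0ℓ) where
  open Order lem
  open Classical lem
  open ExpProperties lem
  open Logarithm lem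

  ∫-mono-≤ : ∀ {A} {f g : A → ℝ} → (∀ a → f a ≤ g a) → ∀ μ → ∫ μ f ≤ ∫ μ g
  ∫-mono-≤ h = ∑ₗ-mono-≤ λ w → *-monoˡ-≤ (mass w) (0≤mass w) (h (point w))

  normalise : ∀ {A} (w : A → ℝ) → (∀ a → 0ℝ ≤ w a) → List A → Measure A
  normalise w 0≤w cs = withMass (λ c → w c * inv (∑ₗ cs w)) (λ c → *-nonneg (0≤w c) (<⇒≤ (inv-pos (∑ₗ cs w)))) cs

  ∫-normalise : ∀ {A} (w : A → ℝ) 0≤w cs f → ∫ (normalise w 0≤w cs) f ≈ ∑ₗ cs (λ c → w c * f c) * inv (∑ₗ cs w)
  ∫-normalise w 0≤w cs f = ≈-trans (∫-withMass (λ c → w c * i) (λ c → *-nonneg (0≤w c) (<⇒≤ (inv-pos (∑ₗ cs w)))) f cs)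
    (≈-trans (∑ₗ-cong {f = λ c → w c * i * f c} {g = λ c → w c * f c * i}
        (λ c → solve 3 (λ b i f → b :* i :* f := b :* f :* i) ≈-refl (w c) i (f c)) cs)
      (∑ₗ-*ʳ (λ c → w c * f c) i cs))
    where
    i = inv (∑ₗ cs w)

  ∑ₗ-dominated : ∀ {A : Set} {w w′ f : A → ℝ} C → (∀ a → w a ≤ C * w′ a) → (∀ a → 0ℝ ≤ f a) → ∀ cs →
    ∑ₗ cs (λ a → w a * f a) ≤ C * ∑ₗ cs (λ a → w′ a * f a)
  ∑ₗ-dominated {w = w} {w′} {f} C h 0≤f cs = ≤-trans
    (∑ₗ-mono-≤ {f = λ a → w a * f a} {g = λ a → w′ a * f a * C} (λ a → ≤-trans (*-monoʳ-≤ (f a) (0≤f a) (h a))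
      (≈⇒≤ (solve 3 (λ e b f → e :* b :* f := b :* f :* e) ≈-refl C (w′ a) (f a)))) cs)
    (≈⇒≤ (≈-trans (∑ₗ-*ʳ (λ a → w′ a * f a) C cs) (*-comm (∑ₗ cs (λ a → w′ a * f a)) C)))

  module _ {A : Set} {cs : List A} {w : A → ℝ} {0≤w : ∀ a → 0ℝ ≤ w a} (Z-pos : 0ℝ < ∑ₗ cs w) where

    normalise-total : ∫ (normalise w 0≤w cs) (λ _ → 1ℝ) ≈ 1ℝ
    normalise-total = ≈-trans (∫-normalise w 0≤w cs (λ _ → 1ℝ))
      (≈-trans (*-cong (∑ₗ-cong (λ c → solve 1 (λ b → b :* κ 1 := b) ≈-refl (w c)) cs) ≈-refl) (*-inv Z-pos))

    normalise-≤ : ∀ {f c} → ∑ₗ cs (λ a → w a * f a) ≤ ∑ₗ cs w * c → ∫ (normalise w 0≤w cs) f ≤ c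
    normalise-≤ {f} {c} h = begin
      ∫ (normalise w 0≤w cs) f                      ≈⟨ ∫-normalise w 0≤w cs f ⟩
      ∑ₗ cs (λ a → w a * f a) * inv (∑ₗ cs w)       ≤⟨ *-monoʳ-≤ (inv (∑ₗ cs w)) (<⇒≤ (inv-pos (∑ₗ cs w))) h ⟩
      ∑ₗ cs w * c * inv (∑ₗ cs w)                   ≈⟨ solve 3 (λ z a i → z :* a :* i := z :* i :* a) ≈-refl (∑ₗ cs w) c (inv (∑ₗ cs w)) ⟩
      ∑ₗ cs w * inv (∑ₗ cs w) * c                   ≈⟨ *-cong (*-inv Z-pos) ≈-refl ⟩
      1ℝ * c                                        ≈⟨ solve 1 (λ a → κ 1 :* a := a) ≈-refl c ⟩
      c ∎
      where open ≤-Reasoning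

    -- One factor C comes from the weights and the other from the normalising constants; both
    -- measures use the same list of points.
    normalise-private : ∀ {w′ : A → ℝ} {0≤w′ : ∀ a → 0ℝ ≤ w′ a} {C} → 0ℝ < ∑ₗ cs w′ → 0ℝ ≤ C →
      (∀ a → w a ≤ C * w′ a) → (∀ a → w′ a ≤ C * w a) → ∀ {f} → (∀ a → 0ℝ ≤ f a) →
      ∫ (normalise w 0≤w cs) f ≤ C * C * ∫ (normalise w′ 0≤w′ cs) f
    normalise-private {w′} {0≤w′} {C} Z′-pos 0≤C h h′ {f} 0≤f = begin
      ∫ (normalise w 0≤w cs) f    ≈⟨ ∫-normalise w 0≤w cs f ⟩
      S * i                       ≤⟨ *-mono-≤ (<⇒≤ (inv-pos Z)) (*-nonneg 0≤C 0≤S′) (∑ₗ-dominated C h 0≤f cs) i≤Ci′ ⟩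
      C * S′ * (C * i′)           ≈⟨ solve 3 (λ e s i → e :* s :* (e :* i) := e :* e :* (s :* i)) ≈-refl C S′ i′ ⟩
      C * C * (S′ * i′)           ≈⟨ *-cong ≈-refl (∫-normalise w′ 0≤w′ cs f) ⟨
      C * C * ∫ (normalise w′ 0≤w′ cs) f ∎
      where
      open ≤-Reasoning
      Z = ∑ₗ cs w
      Z′ = ∑ₗ cs w′
      i = inv Z
      i′ = inv Z′
      S = ∑ₗ cs (λ a → w a * f a)
      S′ = ∑ₗ cs (λ a → w′ a * f a)
      0≤S′ : 0ℝ ≤ S′
      0≤S′ = ∑ₗ-nonneg (λ a → *-nonneg (0≤w′ a) (0≤f a)) cs
      Z′≤ : Z′ ≤ C * Z
      Z′≤ = ≤-trans (≈⇒≤ (∑ₗ-cong (λ c → solve 1 (λ b → b := b :* κ 1) ≈-refl (w′ c)) cs))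
        (≤-trans (∑ₗ-dominated {w = w′} {w} {λ _ → 1ℝ} C h′ (λ _ → fromℕ-nonneg 1) cs)
          (≈⇒≤ (*-cong (≈-refl {C}) (∑ₗ-cong (λ c → solve 1 (λ b → b :* κ 1 := b) ≈-refl (w c)) cs))))
      i≤Ci′ : i ≤ C * i′
      i≤Ci′ = begin
        i                    ≈⟨ solve 1 (λ i → i := i :* κ 1) ≈-refl i ⟩
        i * 1ℝ               ≈⟨ *-cong ≈-refl (*-inv Z′-pos) ⟨
        i * (Z′ * i′)        ≤⟨ *-monoˡ-≤ i (<⇒≤ (inv-pos Z)) (*-monoʳ-≤ i′ (<⇒≤ (inv-pos Z′)) Z′≤) ⟩
        i * (C * Z * i′)     ≈⟨ solve 4 (λ i e z j → i :* (e :* z :* j) := z :* i :* (e :* j)) ≈-refl i C Z i′ ⟩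
        Z * i * (C * i′)     ≈⟨ *-cong (*-inv Z-pos) ≈-refl ⟩
        1ℝ * (C * i′)        ≈⟨ solve 1 (λ i → κ 1 :* i := i) ≈-refl (C * i′) ⟩
        C * i′ ∎

  x*exp[-x]≤1 : ∀ x → x * exp (- x) ≤ 1ℝ
  x*exp[-x]≤1 x = ≤-trans (*-monoʳ-≤ (exp (- x)) (exp-nonneg (- x))
      (≤-trans (≤-by 1ℝ (fromℕ-nonneg 1) (solve 1 (λ x → x :+ κ 1 := κ 1 :+ x) ≈-refl x)) (1+x≤exp x)))
    (≈⇒≤ (exp-neg x))

  -- Half of the exponent V pays for exp B, the other half for the factor V.
  exp-tail : ∀ P {B V} → fromℕ 2 * B ≤ V → 0ℝ ≤ V → exp (- (P + V)) * V ≤ exp (- P) * (exp (- B) * fromℕ 2)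
  exp-tail P {B} {V} 2B≤V 0≤V = combine (exp (- (P + V))) (exp (- P)) (exp (- B)) (exp (- w))
    (exp-nonneg (- P)) (exp-nonneg (- B)) split (x*exp[-x]≤1 w)
    where
    w : ℝ
    w = ½ʳ * V
    split : exp (- (P + V)) ≤ exp (- P) * (exp (- B) * exp (- w))
    split = ≤-trans
      (exp-mono-≤ (≤-by (½ʳ * (V - fromℕ 2 * B)) (*-nonneg 0≤½ (≤-gap 2B≤V))
        (solve 3 (λ p v b → :- (p :+ v) :+ con ½ :* (v :- κ 2 :* b) := :- p :+ (:- b :+ :- (con ½ :* v))) ≈-refl P V B)))
      (≈⇒≤ (≈-trans (exp-+ (- P) (- B + - w)) (*-cong (≈-refl {exp (- P)}) (exp-+ (- B) (- w)))))
    combine : ∀ a p b c → 0ℝ ≤ p → 0ℝ ≤ b → a ≤ p * (b * c) → w * c ≤ 1ℝ → a * V ≤ p * (b * fromℕ 2)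
    combine a p b c 0≤p 0≤b a≤ wc≤1 = ≤-by ((p * (b * c) - a) * V + p * b * (fromℕ 2 * (1ℝ - w * c)))
      (+-nonneg (*-nonneg (≤-gap a≤) 0≤V) (*-nonneg (*-nonneg 0≤p 0≤b) (*-nonneg (fromℕ-nonneg 2) (≤-gap wc≤1))))
      (solve 5 (λ a p b c v → a :* v :+ ((p :* (b :* c) :- a) :* v :+ p :* b :* (κ 2 :* (κ 1 :- con ½ :* v :* c))) := p :* (b :* κ 2))
        ≈-refl a p b c V)

  module _ {lam : ℝ} (0≤lam : 0ℝ ≤ lam) where
    abstract
      boltzmann : ℕ → ℝ
      boltzmann e = exp (- (lam * fromℕ e))

      boltzmann-pos : ∀ e → 0ℝ < boltzmann e
      boltzmann-pos e = exp-pos (- (lam * fromℕ e))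

      boltzmann-step : ∀ {e e′} → e′ ℕ.≤ suc e → boltzmann e ≤ exp lam * boltzmann e′
      boltzmann-step {e} {e′} h = ≤-trans
        (exp-mono-≤ (≤-by (lam * (1ℝ + fromℕ e - fromℕ e′))
          (*-nonneg 0≤lam (≤-gap (≤-trans (fromℕ-mono-≤ h) (≈⇒≤ (fromℕ-suc e)))))
          (solve 3 (λ l a b → :- (l :* a) :+ l :* (κ 1 :+ a :- b) := l :+ :- (l :* b)) ≈-refl lam (fromℕ e) (fromℕ e′))))
        (≈⇒≤ (exp-+ lam (- (lam * fromℕ e′))))

      boltzmann-antitone : ∀ {e e′} → e ℕ.≤ e′ → boltzmann e′ ≤ boltzmann e
      boltzmann-antitone h = exp-mono-≤ (neg-mono-≤ (*-monoˡ-≤ lam 0≤lam (fromℕ-mono-≤ h)))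

      -- This is `exp-tail` with P = λp and V = λu; division by λ turns its constant 2 into `κ₀`.
      boltzmann-tail : ∀ p u {B κ₀} → 0ℝ ≤ κ₀ → lam * κ₀ ≈ fromℕ 2 → fromℕ 2 * B ≤ lam * fromℕ u →
        boltzmann (p ℕ.+ u) * fromℕ u ≤ boltzmann p * (exp (- B) * κ₀)
      boltzmann-tail p u {B} {κ₀} 0≤κ₀ λκ≈2 2B≤λu = ≤-trans
        (*-monoʳ-≤ (fromℕ u) (fromℕ-nonneg u) (exp-mono-≤ (≈⇒≤ (neg-cong (≈-trans (*-cong (≈-refl {lam}) (fromℕ-+ p u))
          (solve 3 (λ l p u → l :* (p :+ u) := l :* p :+ l :* u) ≈-refl lam (fromℕ p) (fromℕ u)))))))
        (rescale (exp (- (lam * fromℕ p + lam * fromℕ u))) (exp (- (lam * fromℕ p))) (exp (- B)) (fromℕ u)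
          (exp-tail (lam * fromℕ p) 2B≤λu (*-nonneg 0≤lam (fromℕ-nonneg u))))
        where
        rescale : ∀ a b c u → a * (lam * u) ≤ b * (c * fromℕ 2) → a * u ≤ b * (c * κ₀)
        rescale a b c u h = ≤-trans (≈⇒≤ (≈-trans (solve 2 (λ a u → a :* u := con ½ :* (κ 2 :* (a :* u))) ≈-refl a u)
            (≈-trans (*-cong (≈-refl {½ʳ}) (*-cong (≈-sym λκ≈2) (≈-refl {a * u})))
              (solve 4 (λ a u l k → con ½ :* (l :* k :* (a :* u)) := con ½ :* k :* (a :* (l :* u))) ≈-refl a u lam κ₀))))
          (≤-trans (*-monoˡ-≤ (½ʳ * κ₀) (*-nonneg 0≤½ 0≤κ₀) h)
            (≈⇒≤ (solve 3 (λ b c k → con ½ :* k :* (b :* (c :* κ 2)) := b :* (c :* k)) ≈-refl b c κ₀)))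

    boltzmann-nonneg : ∀ e → 0ℝ ≤ boltzmann e
    boltzmann-nonneg e = <⇒≤ (boltzmann-pos e)

    -- Write e = p + u. If u ≤ h, the excess is at most p. Otherwise the excess is at most p + u,
    -- and the part u is so unlikely that its weighted contribution is at most exp(-B) times `κ₀`
    -- times the weight of score p. The factor exp(-B) is reserved for summation over at most exp B
    -- candidates.
    boltzmann-excess : ∀ p h e {B κ₀} → 0ℝ ≤ κ₀ → lam * κ₀ ≈ fromℕ 2 →
      (∀ u → h ℕ.< u → fromℕ 2 * B ≤ lam * fromℕ u) →
      boltzmann e * fromℕ (e ℕ.∸ h) ≤ boltzmann e * fromℕ p + boltzmann p * (exp (- B) * κ₀)
    boltzmann-excess p h e {B} {κ₀} 0≤κ₀ λκ≈2 large = by-excess (ℕₚ.<-≤-connex h (e ℕ.∸ p))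
      where
      tail = boltzmann p * (exp (- B) * κ₀)
      far : ∀ u → h ℕ.< u → boltzmann (p ℕ.+ u) * fromℕ (p ℕ.+ u ℕ.∸ h) ≤ boltzmann (p ℕ.+ u) * fromℕ p + tail
      far u h<u = ≤-trans
        (*-monoˡ-≤ (boltzmann (p ℕ.+ u)) (boltzmann-nonneg (p ℕ.+ u))
          (≤-trans (fromℕ-mono-≤ (ℕₚ.m∸n≤m (p ℕ.+ u) h)) (≈⇒≤ (fromℕ-+ p u))))
        (≤-trans (≈⇒≤ (solve 3 (λ e p u → e :* (p :+ u) := e :* p :+ e :* u) ≈-refl (boltzmann (p ℕ.+ u)) (fromℕ p) (fromℕ u)))
          (+-mono-≤ (≤-refl {boltzmann (p ℕ.+ u) * fromℕ p}) (boltzmann-tail p u {B} {κ₀} 0≤κ₀ λκ≈2 (large u h<u))))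
      by-excess : h ℕ.< e ℕ.∸ p ⊎ e ℕ.∸ p ℕ.≤ h → boltzmann e * fromℕ (e ℕ.∸ h) ≤ boltzmann e * fromℕ p + tail
      by-excess (inj₁ h<u) = subst (λ e → boltzmann e * fromℕ (e ℕ.∸ h) ≤ boltzmann e * fromℕ p + tail)
        (ℕₚ.m+[n∸m]≡n {p} {e} (ℕₚ.<⇒≤ (ℕₚ.m∸n≢0⇒n<m {e} {p} λ u≡0 → ℕₚ.n≮0 (subst (h ℕ.<_) u≡0 h<u))))
        (far (e ℕ.∸ p) h<u)
      by-excess (inj₂ u≤h) = ≤-trans
        (*-monoˡ-≤ (boltzmann e) (boltzmann-nonneg e) (fromℕ-mono-≤ (ℕₚ.m≤n+o⇒m∸n≤o e h
          (subst (e ℕ.≤_) (ℕₚ.+-comm p h) (ℕₚ.≤-trans (ℕₚ.m≤n+m∸n e p) (ℕₚ.+-monoʳ-≤ p u≤h))))))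
        (≤-by tail (*-nonneg (boltzmann-nonneg p) (*-nonneg (exp-nonneg (- B)) 0≤κ₀)) ≈-refl)

    expMechanism : ∀ {A : Set} → (A → ℕ) → List A → Measure A
    expMechanism s = normalise (λ c → boltzmann (s c)) (λ c → boltzmann-nonneg (s c))

    module _ {A : Set} {cs : List A} {c₀ : A} (c₀∈cs : c₀ ∈ cs) where

      Z-pos : ∀ (s : A → ℕ) → 0ℝ < ∑ₗ cs (λ c → boltzmann (s c))
      Z-pos s = <-≤-trans (boltzmann-pos (s c₀)) (∈⇒≤∑ₗ {f = λ c → boltzmann (s c)} (λ c → boltzmann-nonneg (s c)) c₀∈cs)

      expMechanism-total : ∀ (s : A → ℕ) → ∫ (expMechanism s cs) (λ _ → 1ℝ) ≈ 1ℝ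
      expMechanism-total s = normalise-total {cs = cs} {w = λ c → boltzmann (s c)} {λ c → boltzmann-nonneg (s c)} (Z-pos s)

      expMechanism-private : ∀ {s s′ : A → ℕ} → (∀ c → s c ℕ.≤ suc (s′ c)) → (∀ c → s′ c ℕ.≤ suc (s c)) →
        ∀ {f} → (∀ c → 0ℝ ≤ f c) → ∫ (expMechanism s cs) f ≤ exp (lam + lam) * ∫ (expMechanism s′ cs) f
      expMechanism-private {s} {s′} h h′ {f} 0≤f = ≤-trans
        (normalise-private (Z-pos s) (Z-pos s′) (exp-nonneg lam) (λ c → boltzmann-step {s c} {s′ c} (h′ c)) (λ c → boltzmann-step {s′ c} {s c} (h c)) 0≤f)
        (≈⇒≤ (*-cong (≈-sym (exp-+ lam lam)) (≈-refl {∫ (expMechanism s′ cs) f})))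

      -- The usual loss, the logarithm of the number of candidates over λ, is absorbed by the
      -- threshold h; beyond it only the score p of the good candidate and `κ₀` = 2/λ remain.
      -- Keeping the score of `c₀` in the sum over candidates replaces the weight of score p by the
      -- normalising constant.
      expMechanism-excess : ∀ s p h {B κ₀} → s c₀ ℕ.≤ p → fromℕ (length cs) ≤ exp B → 0ℝ ≤ κ₀ → lam * κ₀ ≈ fromℕ 2 →
        (∀ u → h ℕ.< u → fromℕ 2 * B ≤ lam * fromℕ u) →
        ∫ (expMechanism s cs) (λ c → fromℕ (s c ℕ.∸ h)) ≤ fromℕ p + κ₀
      expMechanism-excess s p h {B} {κ₀} s₀≤p cs≤ 0≤κ₀ λκ≈2 large = normalise-≤ (Z-pos s) (begin
          ∑ₗ cs (λ c → b c * fromℕ (s c ℕ.∸ h))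
            ≤⟨ ∑ₗ-mono-≤ {f = λ c → b c * fromℕ (s c ℕ.∸ h)} {g = λ c → b c * fromℕ p + tail}
                 (λ c → boltzmann-excess p h (s c) {B} {κ₀} 0≤κ₀ λκ≈2 large) cs ⟩
          ∑ₗ cs (λ c → b c * fromℕ p + tail)
            ≈⟨ ≈-trans (∑ₗ-+ (λ c → b c * fromℕ p) (λ _ → tail) cs)
                 (+-cong (∑ₗ-*ʳ b (fromℕ p) cs) (∑ₗ-const tail cs)) ⟩
          ∑ₗ cs b * fromℕ p + fromℕ (length cs) * tail
            ≤⟨ +-mono-≤ (≤-refl {∑ₗ cs b * fromℕ p}) (*-mono-≤ 0≤tail (exp-nonneg B) cs≤
                 (*-monoʳ-≤ (exp (- B) * κ₀) 0≤rest b[p]≤Z)) ⟩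
          ∑ₗ cs b * fromℕ p + exp B * (∑ₗ cs b * (exp (- B) * κ₀))
            ≈⟨ solve 5 (λ z p e e′ k → z :* p :+ e :* (z :* (e′ :* k)) := z :* (p :+ e :* e′ :* k)) ≈-refl (∑ₗ cs b) (fromℕ p) (exp B) (exp (- B)) κ₀ ⟩
          ∑ₗ cs b * (fromℕ p + exp B * exp (- B) * κ₀)
            ≈⟨ *-cong ≈-refl (+-cong ≈-refl (≈-trans (*-cong (exp-neg B) ≈-refl) (solve 1 (λ k → κ 1 :* k := k) ≈-refl κ₀))) ⟩
          ∑ₗ cs b * (fromℕ p + κ₀) ∎)
        where
        open ≤-Reasoning
        b : A → ℝ
        b c = boltzmann (s c)
        tail = boltzmann p * (exp (- B) * κ₀)
        0≤rest : 0ℝ ≤ exp (- B) * κ₀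
        0≤rest = *-nonneg (exp-nonneg (- B)) 0≤κ₀
        0≤tail : 0ℝ ≤ tail
        0≤tail = *-nonneg (boltzmann-nonneg p) 0≤rest
        b[p]≤Z : boltzmann p ≤ ∑ₗ cs b
        b[p]≤Z = ≤-trans (boltzmann-antitone s₀≤p) (∈⇒≤∑ₗ {f = b} (λ c → boltzmann-nonneg (s c)) c₀∈cs)

-- The multi-scale mechanism

sequences : ∀ {A : Set} → List A → ∀ m → List (Vec A m)
sequences xs zero    = [] ∷ []
sequences xs (suc m) = List.cartesianProductWith _∷_ xs (sequences xs m)

∈-sequences : ∀ {A : Set} {xs : List A} → (∀ a → a ∈ xs) → ∀ {m} (v : Vec A m) → v ∈ sequences xs m
∈-sequences all []      = here refl
∈-sequences all (a ∷ v) = ∈ₚ.∈-cartesianProductWith⁺ _∷_ (all a) (∈-sequences all v)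

length-sequences : ∀ {A : Set} (xs : List A) m → length (sequences xs m) ≡ length xs ℕ.^ m
length-sequences xs zero    = refl
length-sequences xs (suc m) = trans (length-product xs) (cong (length xs ℕ.*_) (length-sequences xs m))
  where
  length-product : ∀ ys → length (List.cartesianProductWith _∷_ ys (sequences xs m)) ≡ length ys ℕ.* length (sequences xs m)
  length-product []       = refl
  length-product (y ∷ ys) = trans (Listₚ.length-++ (List.map (y ∷_) (sequences xs m)))
    (cong₂ ℕ._+_ (Listₚ.length-map (y ∷_) (sequences xs m)) (length-product ys))

∈-mapMaybe : ∀ {A B : Set} (f : A → Maybe B) {a b} → f a ≡ just b → ∀ {xs} → a ∈ xs → b ∈ List.mapMaybe f xs
∈-mapMaybe f {a} eq (here refl) rewrite eq = here refl
∈-mapMaybe f eq {x ∷ xs} (there a∈xs) with f x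
... | just _  = there (∈-mapMaybe f eq a∈xs)
... | nothing = ∈-mapMaybe f eq a∈xs

push : ∀ {A B} → (A → B) → Measure A → Measure B
push g = List.map λ w → weighted (mass w) (g (point w)) (0≤mass w)

∫-push : ∀ {A B} (g : A → B) μ f → ∫ (push g μ) f ≡ ∫ μ (f ∘ g)
∫-push g μ f = ∑ₗ-map (λ w → weighted (mass w) (g (point w)) (0≤mass w)) (λ w → mass w * f (point w)) μ

dirac : ∀ {A : Set} → A → Measure A
dirac a = weighted 1ℝ a (fromℕ-nonneg 1) ∷ []

∫-dirac : ∀ {A : Set} (a : A) f → ∫ (dirac a) f ≈ f a
∫-dirac a f = solve 1 (λ s → κ 1 :* s :+ κ 0 := s) ≈-refl (f a)

∫-nonneg : ∀ {A} (μ : Measure A) {f : A → ℝ} → (∀ a → 0ℝ ≤ f a) → 0ℝ ≤ ∫ μ f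
∫-nonneg μ h = ∑ₗ-nonneg (λ w → *-nonneg (0≤mass w) (h (point w))) μ

∥∥∞-lub : ∀ {k c} {z : Fin k → ℝ} → 0ℝ ≤ c → (∀ j → ∣ z j ∣ ≤ c) → ∥ z ∥∞ ≤ c
∥∥∞-lub {zero} 0≤c h = 0≤c
∥∥∞-lub {suc k} 0≤c h = ⊔-lub (h zero) (∥∥∞-lub 0≤c (h ∘ suc))

∸-vanishes : ∀ {d n} → d ℕ.≤ n → fromℕ (d ℕ.∸ n) ≤ 0ℝ
∸-vanishes {d} {n} d≤n = fromℕ-mono-≤ {d ℕ.∸ n} {0} (ℕₚ.≤-reflexive (ℕₚ.m≤n⇒m∸n≡0 d≤n))

∣s-s∣≤0 : ∀ s → ∣ s - s ∣ ≤ 0ℝ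
∣s-s∣≤0 s = ∣∣-lub (≈⇒≤ (solve 1 (λ s → s :- s := κ 0) ≈-refl s)) (≈⇒≤ (solve 1 (λ s → :- (s :- s) := κ 0) ≈-refl s))

module Stages (lem : ExcludedMiddle 0ℓ) {D : Set} {n₀ k : ℕ} (q : Fin k → D → ℝ) (∣q∣≤1 : ∀ j d → ∣ q j d ∣ ≤ 1ℝ)
              (alphabet : List (Bool × D)) (∈-alphabet : ∀ s → s ∈ alphabet) where
  open Order lem
  open Limits lem
  open Classical lem
  open Exponential lem
  open ExpProperties lem
  open ExponentialMechanism lem

  n : ℕ
  n = suc n₀

  open Queries {D} {n} {k} q
  open Cover lem ∣q∣≤1

  Good : ℝ → (Fin k → ℝ) → Vec D n → Set
  Good H Y a = ∀ j → ∣ total-answer a j - Y j ∣ ≤ H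

  -- The witness makes the distance to the described databases a natural number, at most n. The
  -- accuracy is an index because it is the same deterministic number for all states of a stage.
  record State (H : ℝ) : Set where
    constructor state
    field
      answers  : Fin k → ℝ
      witness  : Vec D n
      accurate : Good H answers witness
  open State

  distance : ∀ {H} (x : Vec D n) (st : State H) →
             ∃ λ h → (∃ λ a → Path h x a × Good H (answers st) a) × (∀ h′ → (∃ λ a → Path h′ x a × Good H (answers st) a) → h ℕ.≤ h′)
  distance {H} x st = least (λ h → ∃ λ a → Path h x a × Good H (answers st) a)
    (n , witness st , fullPath x (witness st) , accurate st)

  dist : ∀ {H} → Vec D n → State H → ℕ
  dist x st = proj₁ (distance x st)

  dist-min : ∀ {H} x (st : State H) {h a} → Path h x a → Good H (answers st) a → dist x st ℕ.≤ h
  dist-min x st {h} p g = proj₂ (proj₂ (distance x st)) h (_ , p , g)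

  dist≤n : ∀ {H} x (st : State H) → dist x st ℕ.≤ n
  dist≤n x st = dist-min x st (fullPath x (witness st)) (accurate st)

  dist-neighbor : ∀ {H x x′} → Neighboring x x′ → (st : State H) → dist x st ℕ.≤ suc (dist x′ st)
  dist-neighbor {x = x} {x′} nb st =
    let (_ , (a , p , g) , _) = distance x′ st in dist-min x st (neighborPath nb p) g

  ∣path∣ : ∀ {h x y} → Path h x y → ∀ j → ∣ total-answer x j - total-answer y j ∣ ≤ fromℕ (h ℕ.* 2)
  ∣path∣ {h} {x} {y} p j = ≤-trans
    (∣∣-cong-≤ (≈-trans (+-cong (path-difference p j) (≈-refl { - total-answer y j}))
      (solve 2 (λ a s → a :+ s :- a := s) ≈-refl (total-answer y j) (∑ (λ t → signed (lookup (edits p) t) j)))))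
    (∑-∣∣ λ t → ∣signed∣≤1 (lookup (edits p) t) j)
    where
    ∑-∣∣ : ∀ {m} {f : Fin m → ℝ} → (∀ t → ∣ f t ∣ ≤ 1ℝ) → ∣ ∑ f ∣ ≤ fromℕ m
    ∑-∣∣ {zero} h = ∣0∣≤0
    ∑-∣∣ {suc m} h = ≤-trans (∣∣-+ (h zero) (∑-∣∣ (h ∘ suc))) (proj₂ (fromℕ-suc m))

  answers-error : ∀ {H} x (st : State H) j → ∣ total-answer x j - answers st j ∣ ≤ fromℕ (dist x st ℕ.* 2) + H
  answers-error x st j =
    let (_ , (a , p , g) , _) = distance x st in
    ≤-trans (∣∣-cong-≤ (solve 3 (λ x a y → x :- y := (x :- a) :+ (a :- y)) ≈-refl (total-answer x j) (total-answer a j) (answers st j)))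
      (∣∣-+ (∣path∣ p j) (g j))

  module _ {H : ℝ} (st : State H) (c : ℝ) (H′ : ℝ) (m : ℕ) where
    shifted : Vec Signed m → Fin k → ℝ
    shifted v j = answers st j + c * signedSum v j

    -- Samples that describe no database are dropped, so that every candidate has a witness. The
    -- test looks only at the previous state and the sample, never at the private input.
    candidate : Vec Signed m → Maybe (State H′)
    candidate v with lem {∃ λ a → Good H′ (shifted v) a}
    ... | yes (a , g) = just (state (shifted v) a g)
    ... | no _        = nothing

    candidates : List (State H′)
    candidates = List.mapMaybe candidate (sequences alphabet m)

    candidate-just : ∀ v {a} → Good H′ (shifted v) a → ∃ λ st′ → (candidate v ≡ just st′) × (answers st′ ≡ shifted v)
    candidate-just v {a} g with lem {∃ λ a → Good H′ (shifted v) a}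
    ... | yes _ = _ , refl , refl
    ... | no ¬p = contradiction (a , g) ¬p

    ∈-candidates : ∀ v {a} → Good H′ (shifted v) a → ∃ λ st′ → (st′ ∈ candidates) × Good H′ (answers st′) a
    ∈-candidates v {a} g = let (st′ , eq , eq′) = candidate-just v {a} g in
      st′ , ∈-mapMaybe candidate eq (∈-sequences ∈-alphabet v) , subst (λ Y → Good H′ Y a) (sym eq′) g

    length-candidates : length candidates ℕ.≤ length alphabet ℕ.^ m
    length-candidates = ℕₚ.≤-trans (Listₚ.length-mapMaybe candidate (sequences alphabet m)) (ℕₚ.≤-reflexive (length-sequences alphabet m))

  Kernel : ℝ → Set
  Kernel H = Vec D n → Measure (State H)

  Total : ∀ {H} → Kernel H → Set
  Total K = ∀ x → ∫ (K x) (λ _ → 1ℝ) ≈ 1ℝ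

  -- Nonnegative test functions replace events: the integral of such a function over the next kernel
  -- is again one, so composition is immediate.
  Private : ∀ {H} → ℝ → Kernel H → Set
  Private C K = ∀ x x′ → Neighboring x x′ → ∀ f → (∀ st → 0ℝ ≤ f st) → ∫ (K x) f ≤ C * ∫ (K x′) f

  Excess : ∀ {H} → ℕ → ℝ → Kernel H → Set
  Excess h τ K = ∀ x → ∫ (K x) (λ st → fromℕ (dist x st ℕ.∸ h)) ≤ τ

  ≤-exp0* : ∀ s → s ≤ exp 0ℝ * s
  ≤-exp0* s = ≤-trans (≈⇒≤ (solve 1 (λ s → s := κ 1 :* s) ≈-refl s)) (≈⇒≤ (*-cong (≈-sym exp-0) (≈-refl {s})))

  -- The exact answers of a fixed database. The input is ignored, so the start costs no privacy and
  -- has distance at most n.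
  module Initial (a : Vec D n) where
    st : State 0ℝ
    st = state (total-answer a) a λ j → ∣s-s∣≤0 (total-answer a j)

    initial : Kernel 0ℝ
    initial _ = dirac st

    initial-total : Total initial
    initial-total _ = ∫-dirac st (λ _ → 1ℝ)

    initial-private : Private (exp 0ℝ) initial
    initial-private _ _ _ f _ = ≤-exp0* (∫ (dirac st) f)

    initial-excess : ∀ {h} → n ℕ.≤ h → Excess h 0ℝ initial
    initial-excess {h} n≤h x = ≤-trans (≈⇒≤ (∫-dirac st (λ st → fromℕ (dist x st ℕ.∸ h))))
      (∸-vanishes (ℕₚ.≤-trans (dist≤n x st) n≤h))

  module Advance {H : ℝ} (K : Kernel H) {h : ℕ} {lam κ₀ θ L B : ℝ} (m h′ : ℕ)
    (0≤lam : 0ℝ ≤ lam) (0<θ : 0ℝ < θ) (θ≤½ : θ ≤ ½ʳ)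
    (2k≤expL : fromℕ (k ℕ.+ k) ≤ exp L) (L≤ : L ≤ fromℕ (suc m) * (fromℕ 2 * (θ * θ)))
    (count : fromℕ (length alphabet ℕ.^ suc m) ≤ exp B) (0≤κ₀ : 0ℝ ≤ κ₀) (λκ≈2 : lam * κ₀ ≈ fromℕ 2)
    (large : ∀ u → h′ ℕ.< u → fromℕ 2 * B ≤ lam * fromℕ u) where

    c : ℝ
    c = fromℕ (h ℕ.* 2) * recip m

    H′ : ℝ
    H′ = H + fromℕ 4 * θ * fromℕ (h ℕ.* 2)

    refinements : State H → List (State H′)
    refinements st = candidates st c H′ (suc m)

    -- A shortest path from x to a described database is cut so that at most h updates remain at its
    -- far end. These are replaced by a sample, and the cut point is described by the new candidate.
    -- The earlier part of the path stays as distance, so the excess over h is passed on unchanged.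
    cover : ∀ x st → ∃ λ st′ → (st′ ∈ refinements st) × (dist x st′ ℕ.≤ dist x st ℕ.∸ h)
    cover x st =
      let (_ , (a , p , g) , _) = distance x st
          (x′ , p₁ , p₂) = splitPath (e ℕ.∸ h) (subst (λ e → Path e x a) (sym (ℕₚ.m+[n∸m]≡n (ℕₚ.m∸n≤m e h))) p)
          (v , close) = path-approximation {θ} {L} {h} m zero 0<θ θ≤½ 2k≤expL L≤ p₂
            (ℕₚ.m≤n+o⇒m∸n≤o e (e ℕ.∸ h) (subst (e ℕ.≤_) (ℕₚ.+-comm h (e ℕ.∸ h)) (ℕₚ.m≤n+m∸n e h)))
          (st′ , st′∈ , g′) = ∈-candidates st c H′ (suc m) v {x′} λ j → ≤-trans
            (∣∣-cong-≤ (solve 4 (λ x a y s → x :- (y :+ s) := (a :- y) :+ (x :- a :- s)) ≈-refl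
              (total-answer x′ j) (total-answer a j) (answers st j) (c * signedSum v j)))
            (∣∣-+ (g j) (close j))
      in st′ , st′∈ , dist-min x st′ p₁ g′
      where
      e = dist x st

    refine : Vec D n → State H → Measure (State H′)
    refine x st = expMechanism 0≤lam (dist x) (refinements st)

    refine-private : ∀ x x′ → Neighboring x x′ → ∀ f → (∀ st → 0ℝ ≤ f st) → ∀ st →
      -- Here `cover` supplies a member of the candidate list, which makes the normalising constants
      -- for x and x′ positive.
      ∫ (refine x st) f ≤ ∫ (refine x′ st) f * exp (lam + lam)
    refine-private x x′ nb f 0≤f st = let (_ , st′∈ , _) = cover x st in ≤-trans
      (expMechanism-private 0≤lam st′∈ {dist x} {dist x′} (dist-neighbor {x = x} {x′} nb) (dist-neighbor {x = x′} {x} (neighboring-sym {x = x} {x′} nb)) 0≤f)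
      (≈⇒≤ (*-comm (exp (lam + lam)) (∫ (refine x′ st) f)))

    -- The factor `1ℝ` in front of `κ₀` gives the constant the shape of `∫-*ʳ`, by which
    -- `advance-excess` integrates it.
    refine-excess : ∀ x st → ∫ (refine x st) (λ st′ → fromℕ (dist x st′ ℕ.∸ h′)) ≤ fromℕ (dist x st ℕ.∸ h) + 1ℝ * κ₀
    refine-excess x st = let (_ , st′∈ , d≤) = cover x st in ≤-trans
      (expMechanism-excess 0≤lam st′∈ (dist x) (dist x st ℕ.∸ h) h′ {B} {κ₀} d≤
        (≤-trans (fromℕ-mono-≤ (length-candidates st c H′ (suc m))) count) 0≤κ₀ λκ≈2 large)
      (≈⇒≤ (solve 2 (λ a k → a :+ k := a :+ κ 1 :* k) ≈-refl (fromℕ (dist x st ℕ.∸ h)) κ₀))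

    advance : Kernel H′
    advance x = K x >>= refine x

    advance-total : Total K → Total advance
    advance-total total x = ≈-trans (∫->>= (K x) (refine x) (λ _ → 1ℝ))
      (≈-trans (∫-cong (λ st → expMechanism-total 0≤lam (proj₁ (proj₂ (cover x st))) (dist x)) (K x)) (total x))

    -- The input of `refine` is exchanged first, pointwise in the state; then the input of `K`, with
    -- the integral over `refine x′` as test function.
    advance-private : ∀ {ε} → Private (exp ε) K → Private (exp (ε + (lam + lam))) advance
    advance-private {ε} private′ x x′ nb f 0≤f = begin
      ∫ (K x >>= refine x) f
        ≈⟨ ∫->>= (K x) (refine x) f ⟩
      ∫ (K x) (λ st → ∫ (refine x st) f)
        ≤⟨ ∫-mono-≤ (refine-private x x′ nb f 0≤f) (K x) ⟩
      ∫ (K x) (λ st → ∫ (refine x′ st) f * exp (lam + lam))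
        ≤⟨ private′ x x′ nb (λ st → ∫ (refine x′ st) f * exp (lam + lam))
             (λ st → *-nonneg (∫-nonneg (refine x′ st) 0≤f) (exp-nonneg (lam + lam))) ⟩
      exp ε * ∫ (K x′) (λ st → ∫ (refine x′ st) f * exp (lam + lam))
        ≈⟨ *-cong (≈-refl {exp ε}) (∫-*ʳ (λ st → ∫ (refine x′ st) f) (exp (lam + lam)) (K x′)) ⟩
      exp ε * (∫ (K x′) (λ st → ∫ (refine x′ st) f) * exp (lam + lam))
        ≈⟨ solve 3 (λ a s b → a :* (s :* b) := a :* b :* s) ≈-refl (exp ε) (∫ (K x′) (λ st → ∫ (refine x′ st) f)) (exp (lam + lam)) ⟩
      exp ε * exp (lam + lam) * ∫ (K x′) (λ st → ∫ (refine x′ st) f)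
        ≈⟨ *-cong (exp-+ ε (lam + lam)) (∫->>= (K x′) (refine x′) f) ⟨
      exp (ε + (lam + lam)) * ∫ (K x′ >>= refine x′) f ∎
      where open ≤-Reasoning

    advance-excess : ∀ {τ} → Total K → Excess h τ K → Excess h′ (τ + κ₀) advance
    advance-excess {τ} total excess x = begin
      ∫ (K x >>= refine x) (λ st → fromℕ (dist x st ℕ.∸ h′))
        ≈⟨ ∫->>= (K x) (refine x) (λ st → fromℕ (dist x st ℕ.∸ h′)) ⟩
      ∫ (K x) (λ st → ∫ (refine x st) (λ st′ → fromℕ (dist x st′ ℕ.∸ h′)))
        ≤⟨ ∫-mono-≤ (refine-excess x) (K x) ⟩
      ∫ (K x) (λ st → fromℕ (dist x st ℕ.∸ h) + 1ℝ * κ₀)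
        ≈⟨ ∫-+ (λ st → fromℕ (dist x st ℕ.∸ h)) (λ _ → 1ℝ * κ₀) (K x) ⟩
      ∫ (K x) (λ st → fromℕ (dist x st ℕ.∸ h)) + ∫ (K x) (λ _ → 1ℝ * κ₀)
        ≤⟨ +-mono-≤ (excess x) (≈⇒≤ (≈-trans (∫-*ʳ (λ _ → 1ℝ) κ₀ (K x))
             (≈-trans (*-cong (total x) (≈-refl {κ₀})) (solve 1 (λ k → κ 1 :* k := k) ≈-refl κ₀)))) ⟩
      τ + κ₀ ∎
      where open ≤-Reasoning

  module Release {H : ℝ} (0≤H : 0ℝ ≤ H) (K : Kernel H) (total : Total K) where
    output : State H → Fin k → ℝ
    output st j = answers st j * recip n₀

    released : Vec D n → Measure (Fin k → ℝ)
    released x = push output (K x)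

    released-total : ∀ x → ∫ (released x) (λ _ → 1ℝ) ≈ 1ℝ
    released-total x = subst (_≈ 1ℝ) (sym (∫-push output (K x) (λ _ → 1ℝ))) (total x)

    mechanism : Mechanism D n k
    mechanism x = toLaw (released x) (released-total x)

    𝔼-mechanism : ∀ x f → 𝔼 (mechanism x) f ≡ ∫ (K x) (f ∘ output)
    𝔼-mechanism x f = trans (𝔼-toLaw (released x) (released-total x) f) (∫-push output (K x) f)

    mechanism-private : ∀ {ε ε′} → Private (exp ε) K → ε ≤ ε′ → PureDP ε′ mechanism
    mechanism-private {ε} {ε′} private′ ε≤ε′ x x′ nb E = subst₂ (λ a b → a ≤ exp ε′ * b)
      (sym (𝔼-mechanism x indicator)) (sym (𝔼-mechanism x′ indicator))
      (≤-trans (private′ x x′ nb (indicator ∘ output) (λ st → 0≤indicator (output st)))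
        (*-monoʳ-≤ (∫ (K x′) (indicator ∘ output)) (∫-nonneg (K x′) λ st → 0≤indicator (output st)) (exp-mono-≤ ε≤ε′)))
      where
      indicator : (Fin k → ℝ) → ℝ
      indicator y = if does (lem {member E y}) then 1ℝ else 0ℝ
      0≤indicator : ∀ y → 0ℝ ≤ indicator y
      0≤indicator y = 0≤if (does (lem {member E y}))
        where
        0≤if : ∀ b → 0ℝ ≤ (if b then 1ℝ else 0ℝ)
        0≤if true  = fromℕ-nonneg 1
        0≤if false = ≤-refl

    output-error : ∀ x st → ∥ (λ j → output st j - F q x j) ∥∞ ≤ fromℕ (dist x st ℕ.* 2) * recip n₀ + H * recip n₀
    output-error x st = ∥∥∞-lub
      (+-nonneg (*-nonneg (fromℕ-nonneg (dist x st ℕ.* 2)) 0≤r) (*-nonneg 0≤H 0≤r)) λ j → ≤-trans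
        (∣∣-cong-≤ (≈-trans (+-cong (≈-refl {output st j}) (neg-cong (F≈ j)))
          (solve 3 (λ y g r → y :* r :- g :* r := (:- (g :- y)) :* r) ≈-refl (answers st j) (total-answer x j) (recip n₀))))
        (≤-trans (∣∣-* {X = fromℕ (dist x st ℕ.* 2) + H} (∣neg∣ (answers-error x st j)) (∣∣-nonneg 0≤r))
          (≈⇒≤ (solve 3 (λ d h r → (d :+ h) :* r := d :* r :+ h :* r) ≈-refl (fromℕ (dist x st ℕ.* 2)) H (recip n₀))))
      where
      0≤r = <⇒≤ (recip-pos n₀)
      ∣neg∣ : ∀ {x c} → ∣ x ∣ ≤ c → ∣ - x ∣ ≤ c
      ∣neg∣ {x} h = ∣∣-lub (∣∣-≤⁻ h) (≤-trans (≈⇒≤ (neg-involutive x)) (∣∣-≤⁺ h))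
      F≈ : ∀ j → F q x j ≈ total-answer x j * recip n₀
      F≈ j = ÷-≈ (fromℕ-suc-pos n₀) (≈-trans
        (solve 3 (λ g r m → g :* r :* m := m :* r :* g) ≈-refl (total-answer x j) (recip n₀) (fromℕ n))
        (≈-trans (*-cong (recip-inverse n₀) (≈-refl {total-answer x j}))
          (solve 1 (λ g → κ 1 :* g := g) ≈-refl (total-answer x j))))

    mechanism-error : ∀ {h τ} → Excess h τ K → ∀ x → 𝔼 (mechanism x) (λ y → ∥ (λ j → y j - F q x j) ∥∞) ≤ (fromℕ 2 * (fromℕ h + τ) + H) * recip n₀
    mechanism-error {h} {τ} excess x = subst (_≤ (fromℕ 2 * (fromℕ h + τ) + H) * recip n₀)
      (sym (𝔼-mechanism x (λ y → ∥ (λ j → y j - F q x j) ∥∞))) (begin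
        ∫ (K x) (λ st → ∥ (λ j → output st j - F q x j) ∥∞)
          ≤⟨ ∫-mono-≤ pointwise (K x) ⟩
        ∫ (K x) (λ st → fromℕ (dist x st ℕ.∸ h) * (fromℕ 2 * r) + 1ℝ * b)
          ≈⟨ ≈-trans (∫-+ (λ st → fromℕ (dist x st ℕ.∸ h) * (fromℕ 2 * r)) (λ _ → 1ℝ * b) (K x))
               (+-cong (∫-*ʳ (λ st → fromℕ (dist x st ℕ.∸ h)) (fromℕ 2 * r) (K x)) (∫-*ʳ (λ _ → 1ℝ) b (K x))) ⟩
        ∫ (K x) (λ st → fromℕ (dist x st ℕ.∸ h)) * (fromℕ 2 * r) + ∫ (K x) (λ _ → 1ℝ) * b
          ≤⟨ +-mono-≤ (*-monoʳ-≤ (fromℕ 2 * r) (*-nonneg (fromℕ-nonneg 2) 0≤r) (excess x))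
               (≈⇒≤ (*-cong (total x) (≈-refl {b}))) ⟩
        τ * (fromℕ 2 * r) + 1ℝ * b
          ≈⟨ solve 4 (λ t r h H → t :* (κ 2 :* r) :+ κ 1 :* ((κ 2 :* h :+ H) :* r) := (κ 2 :* (h :+ t) :+ H) :* r) ≈-refl τ r (fromℕ h) H ⟩
        (fromℕ 2 * (fromℕ h + τ) + H) * r ∎)
      where
      open ≤-Reasoning
      r = recip n₀
      0≤r = <⇒≤ (recip-pos n₀)
      b = (fromℕ 2 * fromℕ h + H) * r
      pointwise : ∀ st → ∥ (λ j → output st j - F q x j) ∥∞ ≤ fromℕ (dist x st ℕ.∸ h) * (fromℕ 2 * r) + 1ℝ * b
      pointwise st = ≤-trans (output-error x st) (≤-trans
        (+-mono-≤ (*-monoʳ-≤ r 0≤r (≤-trans (≈⇒≤ (fromℕ-* d 2)) (*-monoʳ-≤ (fromℕ 2) (fromℕ-nonneg 2)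
          (≤-trans (fromℕ-mono-≤ (ℕₚ.m≤n+m∸n d h)) (≈⇒≤ (fromℕ-+ h (d ℕ.∸ h))))))) (≤-refl {H * r}))
        (≈⇒≤ (solve 4 (λ e r h H → (h :+ e) :* κ 2 :* r :+ H :* r := e :* (κ 2 :* r) :+ κ 1 :* ((κ 2 :* h :+ H) :* r)) ≈-refl
          (fromℕ (d ℕ.∸ h)) r (fromℕ h) H)))
        where
        d = dist x st

-- Choice of parameters

-- At scale j the distance is about N 8⁻ʲ and the step may spend privacy ε 2⁻ʲ⁻¹. The sample size is
-- the largest for which the exponential mechanism reaches distance N 8⁻ʲ⁻¹; the rate θ = 8 a 4ʲ
-- then satisfies 64 r² · sampleSize = L₂, so that each step costs accuracy 64 N a 2⁻ʲ.
module Schedule (lem : ExcludedMiddle 0ℓ) {ε ε⁻¹ N N⁻¹ L₁ L₁⁻¹ L₂ a : ℝ}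
  (0<ε : 0ℝ < ε) (εε⁻¹ : ε * ε⁻¹ ≈ 1ℝ) (0≤ε⁻¹ : 0ℝ ≤ ε⁻¹)
  (0<N : 0ℝ < N) (NN⁻¹ : N * N⁻¹ ≈ 1ℝ) (0≤N⁻¹ : 0ℝ ≤ N⁻¹)
  (½≤L₁ : ½ʳ ≤ L₁) (L₁L₁⁻¹ : L₁ * L₁⁻¹ ≈ 1ℝ) (0≤L₁⁻¹ : 0ℝ ≤ L₁⁻¹)
  (½≤L₂ : ½ʳ ≤ L₂) (0<a : 0ℝ < a) (a²εN : a * a * (ε * N) ≈ L₁ * L₂) where
  open Order lem
  open Limits lem

  0≤a = <⇒≤ 0<a
  0≤ε = <⇒≤ 0<ε
  0≤N = <⇒≤ 0<N

  0≤L₁ : 0ℝ ≤ L₁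
  0≤L₁ = ≤-trans 0≤½ ½≤L₁

  ρ P Q r θ : ℕ → ℝ
  ρ j = ½ʳ ^ j
  P j = fromℕ 2 ^ j
  Q j = fromℕ 4 ^ j
  r j = a * Q j
  θ j = fromℕ 8 * r j

  -- The factor 1/64 solves 2 · sampleSize · L₁ = λ · (next radius), where λ = ε 2⁻ʲ/4 and the next
  -- radius is N 8⁻ʲ/8; see `budget`. The value of `κ₀` is 2/λ.
  radius sampleSize lam κ₀ : ℕ → ℝ
  radius j = N * (ρ j * ρ j * ρ j)
  sampleSize j = fromℚ (+ 1 ℚ./ 64) * (ε * N * L₁⁻¹ * (ρ j * ρ j * (ρ j * ρ j)))
  lam j = ½ʳ * (½ʳ * (ε * ρ j))
  κ₀ j = fromℕ 8 * (ε⁻¹ * P j)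

  ^-nonneg : ∀ {x} → 0ℝ ≤ x → ∀ j → 0ℝ ≤ x ^ j
  ^-nonneg 0≤x zero    = fromℕ-nonneg 1
  ^-nonneg 0≤x (suc j) = *-nonneg 0≤x (^-nonneg 0≤x j)

  0≤ρ : ∀ j → 0ℝ ≤ ρ j
  0≤ρ = ^-nonneg 0≤½

  0≤P : ∀ j → 0ℝ ≤ P j
  0≤P = ^-nonneg (fromℕ-nonneg 2)

  0≤Q : ∀ j → 0ℝ ≤ Q j
  0≤Q = ^-nonneg (fromℕ-nonneg 4)

  1≤Q : ∀ j → 1ℝ ≤ Q j
  1≤Q zero = ≤-refl
  1≤Q (suc j) = ≤-trans (1≤Q j) (≤-by (fromℕ 3 * Q j) (*-nonneg (fromℕ-nonneg 3) (0≤Q j))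
    (solve 1 (λ q → q :+ κ 3 :* q := κ 4 :* q) ≈-refl (Q j)))

  n≤Q : ∀ j → fromℕ j ≤ Q j
  n≤Q zero = fromℕ-nonneg 1
  n≤Q (suc j) = ≤-trans (≤-trans (≈⇒≤ (fromℕ-suc j)) (+-mono-≤ (1≤Q j) (n≤Q j)))
    (≤-by (fromℕ 2 * Q j) (*-nonneg (fromℕ-nonneg 2) (0≤Q j))
      (solve 1 (λ q → q :+ q :+ κ 2 :* q := κ 4 :* q) ≈-refl (Q j)))

  P≤Q : ∀ j → P j ≤ Q j
  P≤Q zero = ≤-refl
  P≤Q (suc j) = *-mono-≤ (0≤P j) (fromℕ-nonneg 4) (fromℕ-mono-≤ {2} {4} (s≤s (s≤s z≤n))) (P≤Q j)

  ρ≤1 : ∀ j → ρ j ≤ 1ℝ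
  ρ≤1 zero = ≤-refl
  ρ≤1 (suc j) = ≤-trans (≤-by (½ʳ * ρ j) (*-nonneg 0≤½ (0≤ρ j)) (½-halves (ρ j))) (ρ≤1 j)

  ρρQ : ∀ j → ρ j * ρ j * Q j ≈ 1ℝ
  ρρQ zero = solve 0 (κ 1 :* κ 1 :* κ 1 := κ 1) ≈-refl
  ρρQ (suc j) = ≈-trans (solve 2 (λ p q → con ½ :* p :* (con ½ :* p) :* (κ 4 :* q) := p :* p :* q) ≈-refl (ρ j) (Q j)) (ρρQ j)

  ρP : ∀ j → ρ j * P j ≈ 1ℝ
  ρP zero = solve 0 (κ 1 :* κ 1 := κ 1) ≈-refl
  ρP (suc j) = ≈-trans (solve 2 (λ p q → con ½ :* p :* (κ 2 :* q) := p :* q) ≈-refl (ρ j) (P j)) (ρP j)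

  0≤r : ∀ j → 0ℝ ≤ r j
  0≤r j = *-nonneg 0≤a (0≤Q j)

  0≤radius : ∀ j → 0ℝ ≤ radius j
  0≤radius j = *-nonneg 0≤N (*-nonneg (*-nonneg (0≤ρ j) (0≤ρ j)) (0≤ρ j))

  0≤sampleSize : ∀ j → 0ℝ ≤ sampleSize j
  0≤sampleSize j = *-nonneg (fromℚ-mono-≤ (ℚₚ.nonNegative⁻¹ (+ 1 ℚ./ 64)))
    (*-nonneg (*-nonneg (*-nonneg 0≤ε 0≤N) 0≤L₁⁻¹) (*-nonneg (*-nonneg (0≤ρ j) (0≤ρ j)) (*-nonneg (0≤ρ j) (0≤ρ j))))

  0≤lam : ∀ j → 0ℝ ≤ lam j
  0≤lam j = *-nonneg 0≤½ (*-nonneg 0≤½ (*-nonneg 0≤ε (0≤ρ j)))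

  0≤κ₀ : ∀ j → 0ℝ ≤ κ₀ j
  0≤κ₀ j = *-nonneg (fromℕ-nonneg 8) (*-nonneg 0≤ε⁻¹ (0≤P j))

  0<θ : ∀ j → 0ℝ < θ j
  0<θ j = *-pos (fromℕ-mono-< {0} {8} (s≤s z≤n)) (*-pos 0<a (<-≤-trans 0<1 (1≤Q j)))

  θ≤½ : ∀ j → fromℕ 16 * r j ≤ 1ℝ → θ j ≤ ½ʳ
  θ≤½ j h = ≤-by (½ʳ * (1ℝ - fromℕ 16 * r j)) (*-nonneg 0≤½ (≤-gap h))
    (solve 1 (λ r → κ 8 :* r :+ con ½ :* (κ 1 :- κ 16 :* r) := con ½) ≈-refl (r j))

  λκ≈2 : ∀ j → lam j * κ₀ j ≈ fromℕ 2
  λκ≈2 j = ≈-trans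
    (solve 4 (λ e i p q → con ½ :* (con ½ :* (e :* p)) :* (κ 8 :* (i :* q)) := κ 2 :* ((e :* i) :* (p :* q))) ≈-refl ε ε⁻¹ (ρ j) (P j))
    (≈-trans (*-cong ≈-refl (*-cong εε⁻¹ (ρP j))) (solve 0 (κ 2 :* (κ 1 :* κ 1) := κ 2) ≈-refl))

  sampleSize-r : ∀ j → sampleSize j * (fromℕ 64 * (r j * r j)) ≈ L₂
  sampleSize-r j = ≈-trans
    (solve 6 (λ e n i p q a → con (+ 1 ℚ./ 64) :* (e :* n :* i :* (p :* p :* (p :* p))) :* (κ 64 :* (a :* q :* (a :* q)))
        := i :* (a :* a :* (e :* n)) :* ((p :* p :* q) :* (p :* p :* q))) ≈-refl ε N L₁⁻¹ (ρ j) (Q j) a)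
    (≈-trans (*-cong (*-cong ≈-refl a²εN) (*-cong (ρρQ j) (ρρQ j)))
    (≈-trans (solve 3 (λ i l m → i :* (l :* m) :* (κ 1 :* κ 1) := (l :* i) :* m) ≈-refl L₁⁻¹ L₁ L₂)
    (≈-trans (*-cong L₁L₁⁻¹ ≈-refl) (solve 1 (λ m → κ 1 :* m := m) ≈-refl L₂))))

  -- Before stopping, 64 r² ≤ ¼, while 64 r² times the sample size is L₂ ≥ ½.
  2≤sampleSize : ∀ j → fromℕ 16 * r j ≤ 1ℝ → fromℕ 2 ≤ sampleSize j
  2≤sampleSize j h =
    ≤-by (fromℕ 4 * (X * (fromℕ 64 * (r j * r j)) - ½ʳ) + X * ((1ℝ - fromℕ 16 * r j) * (1ℝ + fromℕ 16 * r j)))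
      (+-nonneg (*-nonneg (fromℕ-nonneg 4) (≤-gap (≤-trans ½≤L₂ (proj₂ (sampleSize-r j)))))
        (*-nonneg (0≤sampleSize j) (*-nonneg (≤-gap h) (+-nonneg (fromℕ-nonneg 1) (*-nonneg (fromℕ-nonneg 16) (0≤r j))))))
      (solve 2 (λ x r → κ 2 :+ (κ 4 :* (x :* (κ 64 :* (r :* r)) :- con ½) :+ x :* ((κ 1 :- κ 16 :* r) :* (κ 1 :+ κ 16 :* r))) := x)
        ≈-refl X (r j))
    where
    X = sampleSize j

  -- From X ≥ 2 and X ≤ 1 + F follows X ≤ 2F. Rounding the sample size down thus costs a factor 2,
  -- which the 2θ² in `sampling` provides.
  L₂≤ : ∀ j → fromℕ 16 * r j ≤ 1ℝ → ∀ {F} → sampleSize j ≤ 1ℝ + F → L₂ ≤ F * (fromℕ 2 * (θ j * θ j))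
  L₂≤ j h {F} X≤1+F = ≤-trans (proj₂ (sampleSize-r j))
    (≤-by (fromℕ 64 * (r j * r j) * ((1ℝ + F - X) + (1ℝ + F - fromℕ 2)))
      (*-nonneg (*-nonneg (fromℕ-nonneg 64) (*-nonneg (0≤r j) (0≤r j)))
        (+-nonneg (≤-gap X≤1+F) (≤-gap (≤-trans (2≤sampleSize j h) X≤1+F))))
      (solve 3 (λ x f r → x :* (κ 64 :* (r :* r)) :+ κ 64 :* (r :* r) :* ((κ 1 :+ f :- x) :+ (κ 1 :+ f :- κ 2))
          := f :* (κ 2 :* (κ 8 :* r :* (κ 8 :* r)))) ≈-refl X F (r j)))
    where
    X = sampleSize j

  budget : ∀ j {F U} → F ≤ sampleSize j → radius (suc j) ≤ U → fromℕ 2 * (F * L₁) ≤ lam j * U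
  budget j {F} {U} F≤X R≤U = begin
    fromℕ 2 * (F * L₁)
      ≤⟨ *-monoˡ-≤ (fromℕ 2) (fromℕ-nonneg 2) (*-monoʳ-≤ L₁ 0≤L₁ F≤X) ⟩
    fromℕ 2 * (sampleSize j * L₁)
      ≈⟨ solve 5 (λ e n i p l → κ 2 :* (con (+ 1 ℚ./ 64) :* (e :* n :* i :* (p :* p :* (p :* p))) :* l)
           := (l :* i) :* (con ½ :* (con ½ :* (e :* p)) :* (n :* ((con ½ :* p) :* (con ½ :* p) :* (con ½ :* p))))) ≈-refl ε N L₁⁻¹ (ρ j) L₁ ⟩
    L₁ * L₁⁻¹ * (lam j * radius (suc j))
      ≈⟨ *-cong L₁L₁⁻¹ ≈-refl ⟩
    1ℝ * (lam j * radius (suc j))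
      ≈⟨ solve 1 (λ x → κ 1 :* x := x) ≈-refl (lam j * radius (suc j)) ⟩
    lam j * radius (suc j)
      ≤⟨ *-monoˡ-≤ (lam j) (0≤lam j) R≤U ⟩
    lam j * U ∎
    where open ≤-Reasoning

  -- The closed form of the geometric sum of the losses 64 N a 2⁻ⁱ over i < j. Likewise `spent` sums
  -- the privacy ε 2⁻ⁱ⁻¹ and `τ` the excesses 8 · 2ⁱ/ε, so that induction steps become ring
  -- identities.
  slack : ℕ → ℝ
  slack j = fromℕ 128 * (N * a * (1ℝ - ρ j))

  slack-suc : ∀ j {H h} → H ≤ slack j → h ≤ radius j → H + fromℕ 4 * θ j * (h * fromℕ 2) ≤ slack (suc j)
  slack-suc j {H} {h} H≤ h≤ = begin
    H + fromℕ 4 * θ j * (h * fromℕ 2)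
      ≤⟨ +-mono-≤ H≤ (*-monoˡ-≤ (fromℕ 4 * θ j) (*-nonneg (fromℕ-nonneg 4) (<⇒≤ (0<θ j))) (*-monoʳ-≤ (fromℕ 2) (fromℕ-nonneg 2) h≤)) ⟩
    slack j + fromℕ 4 * θ j * (radius j * fromℕ 2)
      ≈⟨ solve 4 (λ n a p q → κ 128 :* (n :* a :* (κ 1 :- p)) :+ κ 4 :* (κ 8 :* (a :* q)) :* (n :* (p :* p :* p) :* κ 2)
           := κ 128 :* (n :* a :* (κ 1 :- p)) :+ (p :* p :* q) :* (κ 64 :* (n :* a :* p))) ≈-refl N a (ρ j) (Q j) ⟩
    slack j + ρ j * ρ j * Q j * (fromℕ 64 * (N * a * ρ j))
      ≈⟨ +-cong ≈-refl (*-cong (ρρQ j) ≈-refl) ⟩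
    slack j + 1ℝ * (fromℕ 64 * (N * a * ρ j))
      ≈⟨ solve 3 (λ n a p → κ 128 :* (n :* a :* (κ 1 :- p)) :+ κ 1 :* (κ 64 :* (n :* a :* p))
           := κ 128 :* (n :* a :* (κ 1 :- con ½ :* p))) ≈-refl N a (ρ j) ⟩
    slack (suc j) ∎
    where open ≤-Reasoning

  spent : ℕ → ℝ
  spent j = ε * (1ℝ - ρ j)

  spent-suc : ∀ j → spent j + (lam j + lam j) ≈ spent (suc j)
  spent-suc j = solve 2 (λ e p → let l = con ½ :* (con ½ :* (e :* p)) in e :* (κ 1 :- p) :+ (l :+ l) := e :* (κ 1 :- con ½ :* p)) ≈-refl ε (ρ j)

  spent≤ε : ∀ j → spent j ≤ ε
  spent≤ε j = ≤-by (ε * ρ j) (*-nonneg 0≤ε (0≤ρ j)) (solve 2 (λ e p → e :* (κ 1 :- p) :+ e :* p := e) ≈-refl ε (ρ j))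

  τ : ℕ → ℝ
  τ j = fromℕ 8 * (ε⁻¹ * (P j - 1ℝ))

  τ-suc : ∀ j → τ j + κ₀ j ≈ τ (suc j)
  τ-suc j = solve 2 (λ i p → κ 8 :* (i :* (p :- κ 1)) :+ κ 8 :* (i :* p) := κ 8 :* (i :* (κ 2 :* p :- κ 1))) ≈-refl ε⁻¹ (P j)

  -- Because 4 L₁ L₂ ≥ 1, the quotient 1/(εN) is at most 4 L₁ L₂/(εN) = 4a². This expresses the
  -- accumulated excess through a.
  ε⁻¹N⁻¹≤ : ε⁻¹ * N⁻¹ ≤ fromℕ 4 * (a * a)
  ε⁻¹N⁻¹≤ = begin
    ε⁻¹ * N⁻¹
      ≤⟨ ≤-by (fromℕ 4 * (ε⁻¹ * N⁻¹) * (½ʳ * (L₁ - ½ʳ) + L₁ * (L₂ - ½ʳ)))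
           (*-nonneg (*-nonneg (fromℕ-nonneg 4) (*-nonneg 0≤ε⁻¹ 0≤N⁻¹))
             (+-nonneg (*-nonneg 0≤½ (≤-gap ½≤L₁)) (*-nonneg 0≤L₁ (≤-gap ½≤L₂))))
           (solve 4 (λ i j l m → i :* j :+ κ 4 :* (i :* j) :* (con ½ :* (l :- con ½) :+ l :* (m :- con ½))
             := κ 4 :* (i :* j) :* (l :* m)) ≈-refl ε⁻¹ N⁻¹ L₁ L₂) ⟩
    fromℕ 4 * (ε⁻¹ * N⁻¹) * (L₁ * L₂)
      ≈⟨ *-cong ≈-refl a²εN ⟨
    fromℕ 4 * (ε⁻¹ * N⁻¹) * (a * a * (ε * N))
      ≈⟨ solve 5 (λ i j a e n → κ 4 :* (i :* j) :* (a :* a :* (e :* n)) := κ 4 :* (a :* a) :* ((e :* i) :* (n :* j))) ≈-refl ε⁻¹ N⁻¹ a ε N ⟩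
    fromℕ 4 * (a * a) * ((ε * ε⁻¹) * (N * N⁻¹))
      ≈⟨ *-cong ≈-refl (*-cong εε⁻¹ NN⁻¹) ⟩
    fromℕ 4 * (a * a) * (1ℝ * 1ℝ)
      ≈⟨ solve 1 (λ a → κ 4 :* (a :* a) :* (κ 1 :* κ 1) := κ 4 :* (a :* a)) ≈-refl a ⟩
    fromℕ 4 * (a * a) ∎
    where open ≤-Reasoning

  totalError : ℕ → ℝ → ℝ → ℝ
  totalError j h H = (fromℕ 2 * (h + τ j) + H) * N⁻¹

  totalError-≤ : ∀ j {h H} → h ≤ radius j → H ≤ slack j →
    totalError j h H ≤ fromℕ 2 * (ρ j * ρ j * ρ j) + fromℕ 16 * (ε⁻¹ * N⁻¹ * (P j - 1ℝ)) + fromℕ 128 * (a * (1ℝ - ρ j))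
  totalError-≤ j {h} {H} h≤ H≤ = begin
    (fromℕ 2 * (h + τ j) + H) * N⁻¹
      ≤⟨ *-monoʳ-≤ N⁻¹ 0≤N⁻¹ (+-mono-≤ (*-monoˡ-≤ (fromℕ 2) (fromℕ-nonneg 2) (+-mono-≤ h≤ (≤-refl {τ j}))) H≤) ⟩
    (fromℕ 2 * (radius j + τ j) + slack j) * N⁻¹
      ≈⟨ solve 6 (λ n m i p q a → (κ 2 :* (n :* (p :* p :* p) :+ κ 8 :* (i :* (q :- κ 1))) :+ κ 128 :* (n :* a :* (κ 1 :- p))) :* m
           := n :* m :* (κ 2 :* (p :* p :* p)) :+ κ 16 :* (i :* m :* (q :- κ 1)) :+ n :* m :* (κ 128 :* (a :* (κ 1 :- p))))
           ≈-refl N N⁻¹ ε⁻¹ (ρ j) (P j) a ⟩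
    N * N⁻¹ * (fromℕ 2 * (ρ j * ρ j * ρ j)) + fromℕ 16 * (ε⁻¹ * N⁻¹ * (P j - 1ℝ)) + N * N⁻¹ * (fromℕ 128 * (a * (1ℝ - ρ j)))
      ≈⟨ +-cong (+-cong (*-cong NN⁻¹ ≈-refl) ≈-refl) (*-cong NN⁻¹ ≈-refl) ⟩
    1ℝ * (fromℕ 2 * (ρ j * ρ j * ρ j)) + fromℕ 16 * (ε⁻¹ * N⁻¹ * (P j - 1ℝ)) + 1ℝ * (fromℕ 128 * (a * (1ℝ - ρ j)))
      ≈⟨ solve 3 (λ x y z → κ 1 :* x :+ y :+ κ 1 :* z := x :+ y :+ z) ≈-refl
           (fromℕ 2 * (ρ j * ρ j * ρ j)) (fromℕ 16 * (ε⁻¹ * N⁻¹ * (P j - 1ℝ))) (fromℕ 128 * (a * (1ℝ - ρ j))) ⟩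
    fromℕ 2 * (ρ j * ρ j * ρ j) + fromℕ 16 * (ε⁻¹ * N⁻¹ * (P j - 1ℝ)) + fromℕ 128 * (a * (1ℝ - ρ j)) ∎
    where open ≤-Reasoning

  ρρρ≤16a : ∀ j → 1ℝ ≤ fromℕ 16 * r j → ρ j * ρ j * ρ j ≤ fromℕ 16 * a
  ρρρ≤16a j h = ≤-trans
    (≤-by (ρ j * ρ j * (1ℝ - ρ j) + ρ j * ρ j * (fromℕ 16 * r j - 1ℝ))
      (+-nonneg (*-nonneg (*-nonneg (0≤ρ j) (0≤ρ j)) (≤-gap (ρ≤1 j))) (*-nonneg (*-nonneg (0≤ρ j) (0≤ρ j)) (≤-gap h)))
      (solve 3 (λ p a q → p :* p :* p :+ (p :* p :* (κ 1 :- p) :+ p :* p :* (κ 16 :* (a :* q) :- κ 1)) := p :* p :* q :* (κ 16 :* a)) ≈-refl (ρ j) a (Q j)))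
    (≈⇒≤ (≈-trans (*-cong (ρρQ j) ≈-refl) (solve 1 (λ x → κ 1 :* x := x) ≈-refl (fromℕ 16 * a))))

  -- If j = 0, the error is at most 2 while 16 a ≥ 1. Otherwise the three parts of `totalError-≤`
  -- are at most 32 a by the stopping rule, 16 a since 4 a 2ʲ ≤ 1 (the previous scale had not
  -- stopped), and 128 a; the total 176 a leaves room up to 258 a. In that case a ≤ 1 as well, which
  -- gives the constant bound.
  finalError : ∀ j {h H} → h ≤ radius j → H ≤ slack j → 1ℝ ≤ fromℕ 16 * r j → (∀ i → i ℕ.< j → fromℕ 16 * r i < 1ℝ) →
    (totalError j h H ≤ fromℕ 258 * 1ℝ) × (totalError j h H ≤ fromℕ 258 * a)
  finalError zero h≤ H≤ 1≤16r _ =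
    ≤-trans ≤2 (fromℕ-mono-≤-*1 {258} (s≤s (s≤s z≤n))) , ≤-trans ≤2 (≤-by (fromℕ 2 * (fromℕ 16 * (a * 1ℝ) - 1ℝ) + fromℕ 226 * a)
      (+-nonneg (*-nonneg (fromℕ-nonneg 2) (≤-gap 1≤16r)) (*-nonneg (fromℕ-nonneg 226) 0≤a))
      (solve 1 (λ a → κ 2 :+ (κ 2 :* (κ 16 :* (a :* κ 1) :- κ 1) :+ κ 226 :* a) := κ 258 :* a) ≈-refl a))
    where
    ≤2 = ≤-trans (totalError-≤ zero h≤ H≤) (≈⇒≤ (solve 2 (λ i a →
      κ 2 :* (κ 1 :* κ 1 :* κ 1) :+ κ 16 :* (i :* (κ 1 :- κ 1)) :+ κ 128 :* (a :* (κ 1 :- κ 1)) := κ 2) ≈-refl (ε⁻¹ * N⁻¹) a))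
    fromℕ-mono-≤-*1 : ∀ {m} → 2 ℕ.≤ m → fromℕ 2 ≤ fromℕ m * 1ℝ
    fromℕ-mono-≤-*1 {m} h = ≤-trans (fromℕ-mono-≤ h) (≈⇒≤ (solve 1 (λ m → m := m :* κ 1) ≈-refl (fromℕ m)))
  finalError (suc i) h≤ H≤ 1≤16r small =
    ≤-trans ≤258a (*-monoˡ-≤ (fromℕ 258) (fromℕ-nonneg 258) a≤1) , ≤258a
    where
    j = suc i
    16r≤1 : fromℕ 16 * r i ≤ 1ℝ
    16r≤1 = <⇒≤ (small i ℕₚ.≤-refl)
    a≤1 : a ≤ 1ℝ
    a≤1 = ≤-by ((1ℝ - fromℕ 16 * r i) + a * (fromℕ 16 * (Q i - 1ℝ)) + fromℕ 15 * a)
      (+-nonneg (+-nonneg (≤-gap 16r≤1) (*-nonneg 0≤a (*-nonneg (fromℕ-nonneg 16) (≤-gap (1≤Q i))))) (*-nonneg (fromℕ-nonneg 15) 0≤a))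
      (solve 2 (λ a q → a :+ ((κ 1 :- κ 16 :* (a :* q)) :+ a :* (κ 16 :* (q :- κ 1)) :+ κ 15 :* a) := κ 1) ≈-refl a (Q i))
    4aP≤1 : fromℕ 4 * (a * P j) ≤ 1ℝ
    4aP≤1 = ≤-by (fromℕ 4 * (a * (Q j - P j)) + (1ℝ - fromℕ 16 * r i))
      (+-nonneg (*-nonneg (fromℕ-nonneg 4) (*-nonneg 0≤a (≤-gap (P≤Q j)))) (≤-gap 16r≤1))
      (solve 3 (λ a p q → κ 4 :* (a :* p) :+ (κ 4 :* (a :* (κ 4 :* q :- p)) :+ (κ 1 :- κ 16 :* (a :* q))) := κ 1) ≈-refl a (P j) (Q i))
    1≤P : 1ℝ ≤ P j
    1≤P = ≤-trans (≈⇒≤ (≈-sym (ρP j))) (≤-trans (*-monoʳ-≤ (P j) (0≤P j) (ρ≤1 j)) (≈⇒≤ (solve 1 (λ x → κ 1 :* x := x) ≈-refl (P j))))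
    ≤258a : totalError j _ _ ≤ fromℕ 258 * a
    ≤258a = ≤-trans (totalError-≤ j h≤ H≤)
      (≤-by (fromℕ 2 * (fromℕ 16 * a - ρ j * ρ j * ρ j) + fromℕ 16 * ((P j - 1ℝ) * (fromℕ 4 * (a * a) - ε⁻¹ * N⁻¹))
             + fromℕ 16 * (a * (1ℝ - fromℕ 4 * (a * P j))) + fromℕ 64 * (a * a) + fromℕ 128 * (a * ρ j) + fromℕ 82 * a)
        (+-nonneg (+-nonneg (+-nonneg (+-nonneg (+-nonneg
          (*-nonneg (fromℕ-nonneg 2) (≤-gap (ρρρ≤16a j 1≤16r)))
          (*-nonneg (fromℕ-nonneg 16) (*-nonneg (≤-gap 1≤P) (≤-gap ε⁻¹N⁻¹≤))))
          (*-nonneg (fromℕ-nonneg 16) (*-nonneg 0≤a (≤-gap 4aP≤1))))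
          (*-nonneg (fromℕ-nonneg 64) (*-nonneg 0≤a 0≤a)))
          (*-nonneg (fromℕ-nonneg 128) (*-nonneg 0≤a (0≤ρ j))))
          (*-nonneg (fromℕ-nonneg 82) 0≤a))
        (solve 4 (λ a p q i →
            κ 2 :* (p :* p :* p) :+ κ 16 :* (i :* (q :- κ 1)) :+ κ 128 :* (a :* (κ 1 :- p))
            :+ (κ 2 :* (κ 16 :* a :- p :* p :* p) :+ κ 16 :* ((q :- κ 1) :* (κ 4 :* (a :* a) :- i))
             :+ κ 16 :* (a :* (κ 1 :- κ 4 :* (a :* q))) :+ κ 64 :* (a :* a) :+ κ 128 :* (a :* p) :+ κ 82 :* a)
            := κ 258 :* a) ≈-refl a (ρ j) (P j) (ε⁻¹ * N⁻¹)))

-- Assembly of the mechanism along the scales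

module Construction (lem : ExcludedMiddle 0ℓ) {D : Set} (T k n₀ : ℕ) (D↔T : D ↔ Fin T)
  (q : Fin k → D → ℝ) (q-bounds : ∀ j d → (- 1ℝ ≤ q j d) × (q j d ≤ 1ℝ)) (x₀ : Vec D (suc n₀))
  {ε ε⁻¹ L₁ L₁⁻¹ L₂ a : ℝ} (0<ε : 0ℝ < ε) (εε⁻¹ : ε * ε⁻¹ ≈ 1ℝ) (0≤ε⁻¹ : 0ℝ ≤ ε⁻¹)
  (½≤L₁ : ½ʳ ≤ L₁) (2T≤expL₁ : fromℕ (2 ℕ.* T) ≤ Classical.exp lem L₁) (L₁L₁⁻¹ : L₁ * L₁⁻¹ ≈ 1ℝ) (0≤L₁⁻¹ : 0ℝ ≤ L₁⁻¹)
  (½≤L₂ : ½ʳ ≤ L₂) (2k≤expL₂ : fromℕ (2 ℕ.* k) ≤ Classical.exp lem L₂)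
  (0<a : 0ℝ < a) (a²εN : a * a * (ε * fromℕ (suc n₀)) ≈ L₁ * L₂) where
  open Order lem
  open Limits lem
  open Classical lem
  open Exponential lem
  open ExpProperties lem
  open Logarithm lem

  ∣q∣≤1 : ∀ j d → ∣ q j d ∣ ≤ 1ℝ
  ∣q∣≤1 j d = let (lo , hi) = q-bounds j d in
    ∣∣-lub hi (≤-trans (neg-mono-≤ lo) (≈⇒≤ (neg-involutive 1ℝ)))

  elements : List D
  elements = List.map (Inverse.from D↔T) (List.allFin T)

  with-sign : Bool → List (Bool × D)
  with-sign b = List.map (b ,_) elements

  alphabet : List (Bool × D)
  alphabet = with-sign true ++ with-sign false

  ∈-elements : ∀ d → d ∈ elements
  ∈-elements d = subst (_∈ elements) (Inverse.strictlyInverseʳ D↔T d)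
    (∈ₚ.∈-map⁺ (Inverse.from D↔T) (∈ₚ.∈-allFin (Inverse.to D↔T d)))

  ∈-alphabet : ∀ s → s ∈ alphabet
  ∈-alphabet (true  , d) = ∈ₚ.∈-++⁺ˡ (∈ₚ.∈-map⁺ (true ,_) (∈-elements d))
  ∈-alphabet (false , d) = ∈ₚ.∈-++⁺ʳ (with-sign true) (∈ₚ.∈-map⁺ (false ,_) (∈-elements d))

  length-alphabet : length alphabet ≡ 2 ℕ.* T
  length-alphabet = trans (Listₚ.length-++ (with-sign true) {with-sign false})
    (trans (cong₂ ℕ._+_ (length-half true) (length-half false)) (cong (T ℕ.+_) (sym (ℕₚ.+-identityʳ T))))
    where
    length-half : ∀ b → length (with-sign b) ≡ T
    length-half b = trans (Listₚ.length-map (b ,_) elements)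
      (trans (Listₚ.length-map (Inverse.from D↔T) (List.allFin T)) (Listₚ.length-tabulate {n = T} (λ i → i)))

  open Stages lem {D} {n₀} {k} q ∣q∣≤1 alphabet ∈-alphabet
  open Schedule lem {ε} {ε⁻¹} {fromℕ (suc n₀)} {recip n₀} {L₁} {L₁⁻¹} {L₂} {a}
    0<ε εε⁻¹ 0≤ε⁻¹ (fromℕ-suc-pos n₀) (recip-inverse n₀) (<⇒≤ (recip-pos n₀))
    ½≤L₁ L₁L₁⁻¹ 0≤L₁⁻¹ ½≤L₂ 0<a a²εN

  h : ℕ → ℕ
  h j = proj₁ (floor (0≤radius j))

  h≤radius : ∀ j → fromℕ (h j) ≤ radius j
  h≤radius j = proj₁ (proj₂ (floor (0≤radius j)))

  radius<1+h : ∀ j → radius j < fromℕ (suc (h j))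
  radius<1+h j = proj₂ (proj₂ (floor (0≤radius j)))

  -- The initial radius is the integer n, so its floor loses nothing and the constant start has
  -- excess 0.
  n≤h₀ : suc n₀ ℕ.≤ h zero
  n≤h₀ = ℕₚ.≤-pred (fromℕ-cancel-< {suc n₀} {suc (h zero)} (≤-<-trans
    (≈⇒≤ (solve 1 (λ n → n := n :* (κ 1 :* κ 1 :* κ 1)) ≈-refl (fromℕ (suc n₀)))) (radius<1+h zero)))

  count : ∀ f → fromℕ (length alphabet ℕ.^ f) ≤ exp (fromℕ f * L₁)
  count zero = ≤-trans (≈⇒≤ (≈-sym exp-0)) (exp-mono-≤ {0ℝ} {0ℝ * L₁} (≈⇒≤ (solve 1 (λ l → κ 0 := κ 0 :* l) ≈-refl L₁)))
  count (suc f) = begin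
    fromℕ (length alphabet ℕ.* length alphabet ℕ.^ f)
      ≈⟨ fromℕ-* (length alphabet) (length alphabet ℕ.^ f) ⟩
    fromℕ (length alphabet) * fromℕ (length alphabet ℕ.^ f)
      ≤⟨ *-mono-≤ (fromℕ-nonneg (length alphabet ℕ.^ f)) (exp-nonneg L₁)
           (subst (λ l → fromℕ l ≤ exp L₁) (sym length-alphabet) 2T≤expL₁) (count f) ⟩
    exp L₁ * exp (fromℕ f * L₁)
      ≈⟨ exp-+ L₁ (fromℕ f * L₁) ⟨
    exp (L₁ + fromℕ f * L₁)
      ≤⟨ exp-mono-≤ {L₁ + fromℕ f * L₁} {fromℕ (suc f) * L₁} (≈⇒≤ (≈-trans
           (solve 2 (λ l f → l :+ f :* l := (κ 1 :+ f) :* l) ≈-refl L₁ (fromℕ f)) (*-cong (≈-sym (fromℕ-suc f)) (≈-refl {L₁})))) ⟩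
    exp (fromℕ (suc f) * L₁) ∎
    where open ≤-Reasoning

  k+k≤expL₂ : fromℕ (k ℕ.+ k) ≤ exp L₂
  k+k≤expL₂ = subst (λ m → fromℕ m ≤ exp L₂) (cong (k ℕ.+_) (ℕₚ.+-identityʳ k)) 2k≤expL₂

  -- The invariant of the iteration. The accuracy `H` is existential because it accumulates the
  -- floors `h i`; its closed-form bound `slack` is all that matters afterwards.
  Reached : ℕ → Set
  Reached j = ∃ λ H → (0ℝ ≤ H) × (H ≤ slack j) ×
    Σ (Kernel H) λ K → Total K × Private (exp (spent j)) K × Excess (h j) (τ j) K

  private-mono : ∀ {H} (K : Kernel H) {e e′} → e ≤ e′ → Private (exp e) K → Private (exp e′) K
  private-mono K {e} {e′} e≤e′ private′ x x′ nb f 0≤f = ≤-trans (private′ x x′ nb f 0≤f)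
    (*-monoʳ-≤ (∫ (K x′) f) (∫-nonneg (K x′) 0≤f) (exp-mono-≤ {e} {e′} e≤e′))

  0≤slack-0 : 0ℝ ≤ slack zero
  0≤slack-0 = ≈⇒≤ (solve 2 (λ n a → κ 0 := κ 128 :* (n :* a :* (κ 1 :- κ 1))) ≈-refl (fromℕ (suc n₀)) a)

  slack-advance : ∀ j {H} → H ≤ slack j → H + fromℕ 4 * θ j * fromℕ (h j ℕ.* 2) ≤ slack (suc j)
  slack-advance j {H} H≤ = ≤-trans
    (+-mono-≤ (≤-refl {H}) (*-monoˡ-≤ (fromℕ 4 * θ j) (*-nonneg (fromℕ-nonneg 4) (<⇒≤ (0<θ j))) (≈⇒≤ (fromℕ-* (h j) 2))))
    (slack-suc j H≤ (h≤radius j))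

  reached-0 : Reached zero
  reached-0 = 0ℝ , ≤-refl , 0≤slack-0 , initial , initial-total , private-mono initial {0ℝ} {spent zero} 0≤spent initial-private
    , (λ x → ≤-trans (initial-excess n≤h₀ x) 0≤τ₀)
    where
    open Initial x₀
    0≤spent : 0ℝ ≤ spent zero
    0≤spent = ≈⇒≤ (solve 1 (λ e → κ 0 := e :* (κ 1 :- κ 1)) ≈-refl ε)
    0≤τ₀ : 0ℝ ≤ τ zero
    0≤τ₀ = ≈⇒≤ (solve 1 (λ i → κ 0 := κ 8 :* (i :* (κ 1 :- κ 1))) ≈-refl ε⁻¹)

  module Step (j : ℕ) (16r≤1 : fromℕ 16 * r j ≤ 1ℝ) where
    sampled : ∃ λ m → (fromℕ (suc m) ≤ sampleSize j) × (sampleSize j ≤ 1ℝ + fromℕ (suc m))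
    sampled = positive (floor (0≤sampleSize j))
      where
      positive : (∃ λ f → (fromℕ f ≤ sampleSize j) × (sampleSize j < fromℕ (suc f))) →
                 ∃ λ m → (fromℕ (suc m) ≤ sampleSize j) × (sampleSize j ≤ 1ℝ + fromℕ (suc m))
      -- A sample size below 1 is impossible before stopping, so the floor is a successor, as
      -- `Advance` demands.
      positive (zero , _ , X<1) = contradiction
        (≤-trans (fromℕ-mono-≤ {1} {2} (s≤s z≤n)) (2≤sampleSize j 16r≤1)) (<⇒≱ X<1)
      positive (suc m , m≤X , X<) = m , m≤X , ≤-trans (<⇒≤ X<) (≈⇒≤ (fromℕ-suc (suc m)))

    m = proj₁ sampled

    module Refined {H : ℝ} (K : Kernel H) = Advance K {h j} {lam j} {κ₀ j} {θ j} {L₂} {fromℕ (suc m) * L₁} m (h (suc j))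
      (0≤lam j) (0<θ j) (θ≤½ j 16r≤1) k+k≤expL₂ (L₂≤ j 16r≤1 (proj₂ (proj₂ sampled))) (count (suc m)) (0≤κ₀ j) (λκ≈2 j)
      -- An integer beyond the floor of the next radius is beyond the radius itself, so flooring
      -- does not weaken the threshold.
      (λ u h<u → budget j (proj₁ (proj₂ sampled)) (≤-trans (<⇒≤ (radius<1+h (suc j))) (fromℕ-mono-≤ h<u)))

    step-reached : Reached j → Reached (suc j)
    step-reached (H , 0≤H , H≤ , K , total , private′ , excess) = H′ , 0≤H′ , slack-advance j H≤ , advance , advance-total total
      , private-mono advance (≈⇒≤ (spent-suc j)) (advance-private {spent j} private′)
      , (λ x → ≤-trans (advance-excess {τ j} total excess x) (≈⇒≤ (τ-suc j)))
      where
      open Refined K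
      0≤H′ : 0ℝ ≤ H + fromℕ 4 * θ j * fromℕ (h j ℕ.* 2)
      0≤H′ = +-nonneg 0≤H (*-nonneg (*-nonneg (fromℕ-nonneg 4) (<⇒≤ (0<θ j))) (fromℕ-nonneg (h j ℕ.* 2)))

  reach : ∀ j → (∀ i → i ℕ.< j → fromℕ 16 * r i < 1ℝ) → Reached j
  reach zero    _     = reached-0
  reach (suc j) small = Step.step-reached j (<⇒≤ (small j ℕₚ.≤-refl))
    (reach j λ i i<j → small i (ℕₚ.≤-trans i<j (ℕₚ.n≤1+n j)))

  -- Minimality provides the strict inequality at all earlier scales, which `reach` needs for every
  -- step; existence follows from j ≤ 4ʲ.
  stopping : ∃ λ J → (1ℝ ≤ fromℕ 16 * r J) × (∀ i → i ℕ.< J → fromℕ 16 * r i < 1ℝ)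
  stopping = let (J , reached , min) = least (λ J → 1ℝ ≤ fromℕ 16 * r J) exists in
    J , reached , λ i i<J → ≰⇒> λ 1≤ → ℕₚ.<⇒≱ i<J (min i 1≤)
    where
    exists : ∃ λ J → 1ℝ ≤ fromℕ 16 * r J
    exists = let (J , 1≤) = archimedean-* 1ℝ (*-pos (fromℕ-suc-pos 15) 0<a) in
      J , ≤-trans 1≤ (≤-trans (*-monoʳ-≤ (fromℕ 16 * a) (*-nonneg (fromℕ-nonneg 16) 0≤a) (n≤Q J))
        (≈⇒≤ (solve 2 (λ q a → q :* (κ 16 :* a) := κ 16 :* (a :* q)) ≈-refl (Q J) a)))

  -- The final constant is 258 = 129 · 2 with 2 ≤ e. Division by 258 reduces the two bounds to the
  -- universal property of the minimum.
  258≤129e : ∀ {E a} → 0ℝ ≤ a → E ≤ fromℕ 258 * 1ℝ → E ≤ fromℕ 258 * a → E ≤ fromℕ 129 * exp 1ℝ * (1ℝ ⊓ a)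
  258≤129e {E} {a} 0≤a E≤258 E≤258a = begin
    E
      ≈⟨ solve 1 (λ e → e := κ 258 :* (con (+ 1 ℚ./ 258) :* e)) ≈-refl E ⟩
    fromℕ 258 * (c * E)
      ≤⟨ *-monoˡ-≤ (fromℕ 258) (fromℕ-nonneg 258) (⊓-glb (shrink E≤258) (shrink E≤258a)) ⟩
    fromℕ 258 * (1ℝ ⊓ a)
      ≈⟨ solve 1 (λ m → κ 258 :* m := κ 129 :* κ 2 :* m) ≈-refl (1ℝ ⊓ a) ⟩
    fromℕ 129 * fromℕ 2 * (1ℝ ⊓ a)
      ≤⟨ *-monoʳ-≤ (1ℝ ⊓ a) (⊓-glb (fromℕ-nonneg 1) 0≤a) (*-monoˡ-≤ (fromℕ 129) (fromℕ-nonneg 129) 2≤exp-1) ⟩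
    fromℕ 129 * exp 1ℝ * (1ℝ ⊓ a) ∎
    where
    open ≤-Reasoning
    c : ℝ
    c = fromℚ (+ 1 ℚ./ 258)
    shrink : ∀ {y} → E ≤ fromℕ 258 * y → c * E ≤ y
    shrink {y} h = ≤-trans (*-monoˡ-≤ c (fromℚ-mono-≤ (ℚₚ.nonNegative⁻¹ (+ 1 ℚ./ 258))) h)
      (≈⇒≤ (solve 1 (λ y → con (+ 1 ℚ./ 258) :* (κ 258 :* y) := y) ≈-refl y))

  result : ∃ λ (M : Mechanism D (suc n₀) k) → PureDP ε M ×
    (∀ x → 𝔼 (M x) (λ y → ∥ (λ j → y j - F q x j) ∥∞) ≤ fromℕ 129 * exp 1ℝ * (1ℝ ⊓ a))
  result =
    let (J , 1≤16r , small) = stopping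
        (H , 0≤H , H≤ , K , total , private′ , excess) = reach J small
        (E≤258 , E≤258a) = finalError J (h≤radius J) H≤ 1≤16r small
        module R = Release 0≤H K total
    in R.mechanism , R.mechanism-private {spent J} {ε} private′ (spent≤ε J)
     , λ x → ≤-trans (R.mechanism-error {h J} {τ J} excess x) (258≤129e 0≤a E≤258 E≤258a)

-- The logarithms and the square root of the theorem

module Constants (lem : ExcludedMiddle 0ℓ) {T k n₀ : ℕ} (1≤T : 1 ℕ.≤ T) (1≤k : 1 ℕ.≤ k) {ε : ℝ} (0<ε : 0ℝ < ε) where
  open Order lem
  open Limits lem
  open Classical lem
  open Exponential lem
  open Logarithm lem

  N L₁ L₂ a : ℝ
  N = fromℕ (suc n₀)
  L₁ = log (fromℕ (2 ℕ.* T))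
  L₂ = log (fromℕ (2 ℕ.* k))
  a = sqrt (L₁ * L₂ ÷ (ε * N))

  2≤fromℕ2* : ∀ {m} → 1 ℕ.≤ m → fromℕ 2 ≤ fromℕ (2 ℕ.* m)
  2≤fromℕ2* {m} h = fromℕ-mono-≤ {2} {2 ℕ.* m} (ℕₚ.*-monoʳ-≤ 2 h)

  exp-log-2* : ∀ {m} → 1 ℕ.≤ m → exp (log (fromℕ (2 ℕ.* m))) ≈ fromℕ (2 ℕ.* m)
  exp-log-2* {m} h = exp-log {fromℕ (2 ℕ.* m)} (<-≤-trans (fromℕ-suc-pos 1) (2≤fromℕ2* h))

  ½≤L₁ : ½ʳ ≤ L₁
  ½≤L₁ = ½≤log {fromℕ (2 ℕ.* T)} (2≤fromℕ2* 1≤T)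

  ½≤L₂ : ½ʳ ≤ L₂
  ½≤L₂ = ½≤log {fromℕ (2 ℕ.* k)} (2≤fromℕ2* 1≤k)

  0<L₁ : 0ℝ < L₁
  0<L₁ = <-≤-trans 0<½ ½≤L₁

  0<L₁L₂ : 0ℝ < L₁ * L₂
  0<L₁L₂ = *-pos 0<L₁ (<-≤-trans 0<½ ½≤L₂)

  0<N : 0ℝ < N
  0<N = fromℕ-suc-pos n₀

  0<εN : 0ℝ < ε * N
  0<εN = *-pos 0<ε 0<N

  radicand : L₁ * L₂ ÷ (ε * N) ≈ L₁ * L₂ * inv (ε * N)
  radicand = ÷-inv {L₁ * L₂} {ε * N} 0<εN

  0<radicand : 0ℝ < L₁ * L₂ ÷ (ε * N)
  0<radicand = <-≤-trans (*-pos 0<L₁L₂ (inv-pos (ε * N))) (proj₂ radicand)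

  a-spec : (0ℝ ≤ a) × (a * a ≈ L₁ * L₂ ÷ (ε * N))
  a-spec = sqrt-spec {L₁ * L₂ ÷ (ε * N)} 0<radicand

  a²εN : a * a * (ε * N) ≈ L₁ * L₂
  a²εN = ≈-trans (*-cong (≈-trans (proj₂ a-spec) radicand) (≈-refl {ε * N})) (cancel (L₁ * L₂) (ε * N) (inv (ε * N)) (*-inv 0<εN))
    where
    cancel : ∀ x y z → y * z ≈ 1ℝ → x * z * y ≈ x
    cancel x y z yz≈1 = ≈-trans (solve 3 (λ x y z → x :* z :* y := x :* (y :* z)) ≈-refl x y z)
      (≈-trans (*-cong (≈-refl {x}) yz≈1) (solve 1 (λ x → x :* κ 1 := x) ≈-refl x))

  0<a : 0ℝ < a
  0<a = nonzero a (proj₁ a-spec) (<-≤-trans 0<radicand (proj₂ (proj₂ a-spec)))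
    where
    nonzero : ∀ a → 0ℝ ≤ a → 0ℝ < a * a → 0ℝ < a
    nonzero a 0≤a 0<a² = ≰⇒> λ a≤0 → <⇒≱ 0<a²
      (≤-by (a * (0ℝ - a)) (*-nonneg 0≤a (≤-gap a≤0)) (solve 1 (λ a → a :* a :+ a :* (κ 0 :- a) := κ 0) ≈-refl a))

theorem1p1 : (lem : ExcludedMiddle 0ℓ) → let open Classical lem in
    (D : Set) (T k n : ℕ) → D ↔ Fin T → 1 ℕ.≤ T → 1 ℕ.≤ k → 1 ℕ.≤ n →
    (q : Fin k → D → ℝ) → (∀ j d → (- 1ℝ ≤ q j d) × (q j d ≤ 1ℝ)) →
    (ε : ℝ) → 0ℝ < ε →
    ∃ λ (M : Mechanism D n k) →
    PureDP ε M ×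
    (∀ (x : Vec D n) →
    𝔼 (M x) (λ y → ∥ (λ j → y j - F q x j) ∥∞)
    ≤ fromℕ 129 * exp 1ℝ
    * (1ℝ ⊓ sqrt (log (fromℕ (2 ℕ.* T)) * log (fromℕ (2 ℕ.* k))
    ÷ (ε * fromℕ n))))
theorem1p1 lem D (suc T) k (suc n₀) D↔T 1≤T 1≤k 1≤n q q-bounds ε 0<ε =
  -- As T is at least 1, there is a record whose n-fold repetition serves as the starting database.
  Construction.result lem (suc T) k n₀ D↔T q q-bounds (Vec.replicate (suc n₀) (Inverse.from D↔T zero))
    0<ε (*-inv 0<ε) (<⇒≤ (inv-pos ε)) ½≤L₁ (proj₂ (exp-log-2* 1≤T)) (*-inv 0<L₁) (<⇒≤ (inv-pos L₁))
    ½≤L₂ (proj₂ (exp-log-2* 1≤k)) 0<a a²εN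
  where
  open Logarithm lem
  open Constants lem {suc T} {k} {n₀} 1≤T 1≤k 0<ε
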